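{- For every integer $k \geq 3$ there is a function $f_k:\mathbb{N}\to\mathbb{R}$ with $f_k(n)=o(n)$ such that every graph $G$ with $n$ vertices and minimum degree at least $n\left(1-\frac{1}{9k^{10}}\right)+f_k(n)$ has an $\mathcal{F}_k$-decomposition, where $\mathcal{F}_k=\{K_k, K_{2k-1}, K_{2k-1}^-\}$.
   Context: All graphs are finite, undirected and simple. $K_t$ is the complete graph on $t$ vertices and $K_t^-$ is the complete graph on $t$ vertices with one edge removed. For a family $\mathcal{F}$ of graphs, an $\mathcal{F}$-decomposition of a graph $G$ is a set $L$ of subgraphs of $G$, each isomorphic to an element of $\mathcal{F}$, such that each edge of $G$ lies in precisely one element of $L$. -}

module Defs where

open import Data.Nat using (ℕ; zero; suc; _*_; _^_; _∸_; _+_)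
open import Data.Nat.Properties using (m*n≢0; m^n≢0)
open import Data.Nat.ListAction using (sum)
open import Data.Bool using (Bool; true; false; if_then_else_)
open import Data.Fin using (Fin; toℕ)
open import Data.List using (List; length; lookup; map; allFin)
open import Data.Integer using (+_)
open import Data.Rational using (ℚ; _/_)
open import Data.Product using (Σ; ∃; _×_; _,_)
open import Data.Sum using (_⊎_)
open import Function.Definitions using (Injective)
open import Relation.Binary.PropositionalEquality using (_≡_; _≢_)
open import Relation.Nullary using (¬_)

record Graph (n : ℕ) : Set where
  field
    adj      : Fin n → Fin n → Bool
    adj-sym  : ∀ u v → adj u v ≡ adj v u
    adj-irr  : ∀ v → adj v v ≡ false
open Graph public

Edge : ∀ {n} → Graph n → Fin n → Fin n → Set
Edge G u v = adj G u v ≡ true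

degree : ∀ {n} → Graph n → Fin n → ℕ
degree {n} G v = sum (map (λ w → if adj G v w then 1 else 0) (allFin n))

ℕ→ℚ : ℕ → ℚ
ℕ→ℚ m = (+ m) / 1

-- 1 / (9 k^10)   (the value at k = 0 is irrelevant: the theorem has k ≥ 3)
eps : ℕ → ℚ
eps zero = (+ 0) / 1
eps (suc k) = (+ 1) / (9 * suc k ^ 10)
  where instance _ = m*n≢0 9 (suc k ^ 10) {{_}} {{m^n≢0 (suc k) 10}}

KAdj : ∀ {t} → Fin t → Fin t → Set
KAdj a b = a ≢ b

K⁻Adj : ∀ {t} → Fin t → Fin t → Set
K⁻Adj a b = a ≢ b × ¬ ((toℕ a ≡ 0 × toℕ b ≡ 1) ⊎ (toℕ a ≡ 1 × toℕ b ≡ 0))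

data Shape : Set where
  cliqueK       : Shape
  clique2k-1    : Shape
  clique2k-1⁻   : Shape

size : ℕ → Shape → ℕ
size k cliqueK     = k
size k clique2k-1  = 2 * k ∸ 1
size k clique2k-1⁻ = 2 * k ∸ 1

PatAdj : ∀ k (s : Shape) → Fin (size k s) → Fin (size k s) → Set
PatAdj k cliqueK     = KAdj
PatAdj k clique2k-1  = KAdj
PatAdj k clique2k-1⁻ = K⁻Adj

-- A subgraph of G isomorphic to a member of F_k, given by an injective
-- map φ from the pattern's vertices into V(G) sending pattern edges to
-- edges of G; its edge set is the image of the pattern's edges.

record Copy (k : ℕ) {n : ℕ} (G : Graph n) : Set where
  field
    shape    : Shape
    φ        : Fin (size k shape) → Fin n
    φ-inj    : Injective _≡_ _≡_ φ
    φ-edges  : ∀ a b → PatAdj k shape a b → Edge G (φ a) (φ b)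
open Copy public

InCopy : ∀ {k n} {G : Graph n} → Copy k G → Fin n → Fin n → Set
InCopy {k} C u v =
  Σ (Fin (size k (shape C))) λ a → Σ (Fin (size k (shape C))) λ b →
    PatAdj k (shape C) a b × φ C a ≡ u × φ C b ≡ v

Decomposition : (k : ℕ) {n : ℕ} → Graph n → Set
Decomposition k G =
  Σ (List (Copy k G)) λ L →
    ∀ u v → Edge G u v →
      Σ (Fin (length L)) λ i →
        InCopy (lookup L i) u v × (∀ j → InCopy (lookup L j) u v → j ≡ i)

open import Data.Rational as Q using (0ℚ; ∣_∣)

IsLittleO-n : (ℕ → ℚ) → Set
IsLittleO-n f =
  ∀ (ε : ℚ) → 0ℚ Q.< ε → Σ ℕ λ N → ∀ n → N Data.Nat.≤ n → ∣ f n ∣ Q.≤ ε Q.* ℕ→ℚ n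

threshold : ℕ → (ℕ → ℚ) → ℕ → ℚ
threshold k f n = ℕ→ℚ n Q.* (Q.1ℚ Q.- eps k) Q.+ f n

{-# OPTIONS --safe #-}
-- Put k = j + 1 and r = 2k − 1. A transversal design, applied recursively, packs K_r's into the complete graph
-- so that every vertex keeps only a tiny fraction of its edges. Placed on V(G) by a permutation that is
-- locally optimal for an exponential potential, the packing loses few blocks at every vertex to the non-edges of G.
-- Each remaining uncovered edge e of G is then completed to a K_k whose other edges lie in distinct blocks that
-- have not been touched before; a block that gives up one edge turns into a K_r⁻. The cliques are found greedily:
-- a vertex lying in many touched blocks is avoided unless it is an end of e, so there is always room.
module Submission where

open import Defs
open import Data.Nat using (ℕ; _≤_)
open import Data.Fin using (Fin)
open import Data.Rational using (ℚ) renaming (_≤_ to _≤ℚ_)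
open import Data.Product using (Σ; _×_)

-- Exact designs exist only under divisibility conditions, so the packing leaves gaps; a `K_k` fills
-- one gap at the price of one edge from each of C(k,2) - 1 blocks. Two requirements hold per
-- vertex, not on average. Non-edges of `G` at a vertex spoil few of its blocks anyway, but a
-- non-edge inside a block spoils it for all its other points too. How many blocks a vertex loses in
-- this way depends on the placement, and averaging controls only a mean; in a sum of exponentials
-- over all vertices a single large loss outweighs everything else. The greedy choice must likewise
-- keep the touched blocks at every vertex below a small fraction of n. Ends of uncovered edges
-- cannot be avoided, but a vertex is an end of few of them. The exponent 10 arises here. Let d be
-- about n/(9k^10) and s = C(k,2) - 1. A vertex has at most M = 6j²d uncovered partners, at most snM
-- blocks are touched, and at most 9j²rsM vertices reach load n/(8j²). Each of at most j chosen
-- vertices must avoid its blocks through these, 2j vertices apiece. That is at most 2n/3 exclusions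
-- when 18j^6·rs ≤ k^10, and rs grows like j³.

module LineArithmetic where
  open import Data.Nat as ℕ using (zero; suc; _!)
  import Data.Nat.Properties as ℕ
  open import Data.Nat.Divisibility using (_∣_; divides; ∣-trans; m≤n⇒m!∣n!; m∣m*n)
  open import Data.Nat.DivMod using (_mod_; _%_; m≡m%n+[m/n]*n; m%n<n)
  open import Data.Integer as ℤ using (ℤ; +_; -[1+_]; _+_; _*_; -_; _-_)
  import Data.Integer.Properties as ℤ
  import Data.Integer.DivMod as ℤ
  open import Data.Integer.Tactic.RingSolver using (solve-∀)
  open import Data.Fin as F using (toℕ; fromℕ<)
  import Data.Fin.Properties as F
  open import Data.Product using (_,_; proj₁; proj₂)
  open import Relation.Nullary using (contradiction)
  open import Relation.Binary.PropositionalEquality hiding ([_]; J)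
  open import Relation.Binary.Definitions using (tri<; tri≈; tri>)

  -- Residues and affine lines modulo p

  residue-unique-ℕ : ∀ {p x y} c → x ℕ.< p → x ≡ y ℕ.+ c ℕ.* p → x ≡ y
  residue-unique-ℕ zero x<p e = trans e (ℕ.+-identityʳ _)
  residue-unique-ℕ {p} {x} {y} (suc c) x<p e = contradiction x<p (ℕ.≤⇒≯ (ℕ.≤-trans (ℕ.m≤m+n p (c ℕ.* p)) (ℕ.≤-trans (ℕ.m≤n+m _ y) (ℕ.≤-reflexive (sym e)))))

  residue-unique : ∀ {p x y} (c : ℤ) → x ℕ.< p → y ℕ.< p → + x ≡ + y + c * + p → x ≡ y
  residue-unique {p} {x} {y} (+ c) x<p y<p e = residue-unique-ℕ c x<p (ℤ.+-injective (trans e (trans (cong (λ z → + y + z) (sym (ℤ.pos-* c p))) (sym (ℤ.pos-+ y (c ℕ.* p))))))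
  residue-unique {p} {x} {y} (-[1+ c ]) x<p y<p e = sym (residue-unique-ℕ (suc c) y<p (ℤ.+-injective (begin
    + y ≡⟨ move (+ y) (+ suc c) (+ p) ⟩
    (+ y + - (+ suc c) * + p) + + suc c * + p ≡⟨ cong (λ z → z + + suc c * + p) (sym e) ⟩
    + x + + suc c * + p ≡⟨ cong (λ z → + x + z) (sym (ℤ.pos-* (suc c) p)) ⟩
    + x + + (suc c ℕ.* p) ≡⟨ sym (ℤ.pos-+ x (suc c ℕ.* p)) ⟩
    + (x ℕ.+ suc c ℕ.* p) ∎)))
    where
    open ≡-Reasoning
    move : ∀ y c p → y ≡ (y + - c * p) + c * p
    move = solve-∀

  -- Lines i ↦ a i + b over ℤ/p, where p = 1 + t·w! makes all differences of small i invertible.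
  module Lines (w t : ℕ) where
    p : ℕ
    p = suc (w ! ℕ.* t)

    line : Fin p → Fin p → Fin (suc w) → Fin p
    line a b i = (toℕ a ℕ.* toℕ i ℕ.+ toℕ b) mod p

    private
      P : ℤ
      P = + p

      inverse< : ∀ {i j} → i ℕ.< j → j ℕ.< suc w → Σ ℕ λ u → (j ℕ.∸ i) ℕ.* u ≡ w ! ℕ.* t
      inverse< {i} {j} i<j j<w with ∣-trans (δ∣δ! (j ℕ.∸ i) (ℕ.m<n⇒0<n∸m i<j)) (m≤n⇒m!∣n! (ℕ.≤-trans (ℕ.m∸n≤m j i) (ℕ.s≤s⁻¹ j<w)))
        where
        δ∣δ! : ∀ δ → 0 ℕ.< δ → δ ∣ δ !
        δ∣δ! (suc δ) _ = m∣m*n (δ !)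
      ... | divides c e = c ℕ.* t , trans (sym (ℕ.*-assoc (j ℕ.∸ i) c t)) (cong (ℕ._* t) (trans (ℕ.*-comm (j ℕ.∸ i) c) (sym e)))

      pos-∸ : ∀ {i j} → i ℕ.≤ j → + (j ℕ.∸ i) ≡ + j - + i
      pos-∸ {i} {j} le = trans (sym (ℤ.⊖-≥ le)) (sym (ℤ.m-n≡m⊖n j i))

      -- The difference divides `w !`, hence also p - 1 = `w ! * t`, whose residue is -1. So `u` is
      -- minus the inverse of the difference, and the identity holds over the integers, not only
      -- modulo `p`.
      inverse : ∀ (i j : Fin (suc w)) → i ≢ j → Σ ℤ λ u → (+ toℕ i - + toℕ j) * u ≡ P - + 1
      inverse i j i≢j with ℕ.<-cmp (toℕ i) (toℕ j)
      ... | tri≈ _ e _ = contradiction (F.toℕ-injective e) i≢j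
      ... | tri< lt _ _ with inverse< lt (F.toℕ<n j)
      ...   | u , e = - (+ u) , (begin
        (+ toℕ i - + toℕ j) * - (+ u) ≡⟨ flip (+ toℕ i) (+ toℕ j) (+ u) ⟩
        (+ toℕ j - + toℕ i) * + u ≡⟨ cong (_* + u) (sym (pos-∸ (ℕ.<⇒≤ lt))) ⟩
        + (toℕ j ℕ.∸ toℕ i) * + u ≡⟨ sym (ℤ.pos-* (toℕ j ℕ.∸ toℕ i) u) ⟩
        + ((toℕ j ℕ.∸ toℕ i) ℕ.* u) ≡⟨ cong +_ e ⟩
        + (w ! ℕ.* t) ∎)
        where
        open ≡-Reasoning
        flip : ∀ i j u → (i - j) * - u ≡ (j - i) * u
        flip = solve-∀
      inverse i j i≢j | tri> _ _ gt with inverse< gt (F.toℕ<n i)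
      ...   | u , e = + u , trans (cong (_* + u) (sym (pos-∸ (ℕ.<⇒≤ gt)))) (trans (sym (ℤ.pos-* (toℕ i ℕ.∸ toℕ j) u)) (cong +_ e))

      mod-spec : ∀ m → Σ ℤ λ c → + m ≡ + toℕ (m mod p) + c * P
      mod-spec m = + (m ℕ./ p) , (begin
        + m ≡⟨ cong +_ (m≡m%n+[m/n]*n m p) ⟩
        + (m % p ℕ.+ m ℕ./ p ℕ.* p) ≡⟨ ℤ.pos-+ (m % p) _ ⟩
        + (m % p) + + (m ℕ./ p ℕ.* p) ≡⟨ cong₂ _+_ (cong +_ (sym (F.toℕ-fromℕ< (m%n<n m p)))) (ℤ.pos-* (m ℕ./ p) p) ⟩
        + toℕ (m mod p) + + (m ℕ./ p) * P ∎)
        where open ≡-Reasoning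

      line-spec : ∀ a b i → Σ ℤ λ c → + toℕ a * + toℕ i + + toℕ b ≡ + toℕ (line a b i) + c * P
      line-spec a b i with mod-spec (toℕ a ℕ.* toℕ i ℕ.+ toℕ b)
      ... | c , e = c , trans (trans (cong (λ z → z + + toℕ b) (sym (ℤ.pos-* (toℕ a) (toℕ i)))) (sym (ℤ.pos-+ (toℕ a ℕ.* toℕ i) (toℕ b)))) e

      toFin : ∀ (z : ℤ) → Σ (Fin p) λ a → Σ ℤ λ c → z ≡ + toℕ a + c * P
      toFin z = fromℕ< (ℤ.n%ℕd<d z p) , z ℤ./ℕ p , trans (ℤ.a≡a%ℕn+[a/ℕn]*n z p) (cong (λ x → + x + z ℤ./ℕ p * P) (sym (F.toℕ-fromℕ< (ℤ.n%ℕd<d z p))))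

      sub : ∀ {x y : ℤ} → x ≡ y → x - y ≡ + 0
      sub {x} refl = ℤ.+-inverseʳ x

    line-unique : ∀ {a b a′ b′ i j} → i ≢ j → line a b i ≡ line a′ b′ i → line a b j ≡ line a′ b′ j → a ≡ a′ × b ≡ b′
    line-unique {a} {b} {a′} {b′} {i} {j} i≢j ei ej = F.toℕ-injective a≡ , F.toℕ-injective b≡
      where
      open ≡-Reasoning
      u = proj₁ (inverse i j i≢j)
      diff : ∀ i → line a b i ≡ line a′ b′ i → Σ ℤ λ c → (+ toℕ a - + toℕ a′) * + toℕ i + (+ toℕ b - + toℕ b′) ≡ c * P
      diff i e with line-spec a b i | line-spec a′ b′ i
      ... | c , s | c′ , s′ = c - c′ , (begin
        (+ toℕ a - + toℕ a′) * + toℕ i + (+ toℕ b - + toℕ b′) ≡⟨ r1 (+ toℕ a) (+ toℕ a′) (+ toℕ i) (+ toℕ b) (+ toℕ b′) ⟩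
        (+ toℕ a * + toℕ i + + toℕ b) - (+ toℕ a′ * + toℕ i + + toℕ b′) ≡⟨ cong₂ _-_ s s′ ⟩
        (+ toℕ (line a b i) + c * P) - (+ toℕ (line a′ b′ i) + c′ * P) ≡⟨ cong (λ z → (+ toℕ z + c * P) - (+ toℕ (line a′ b′ i) + c′ * P)) e ⟩
        (+ toℕ (line a′ b′ i) + c * P) - (+ toℕ (line a′ b′ i) + c′ * P) ≡⟨ r2 (+ toℕ (line a′ b′ i)) c c′ P ⟩
        (c - c′) * P ∎)
        where
        r1 : ∀ a a′ i b b′ → (a - a′) * i + (b - b′) ≡ (a * i + b) - (a′ * i + b′)
        r1 = solve-∀
        r2 : ∀ x c c′ P → (x + c * P) - (x + c′ * P) ≡ (c - c′) * P
        r2 = solve-∀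
      A = + toℕ a - + toℕ a′
      D = + toℕ b - + toℕ b′
      cᵢ = proj₁ (diff i ei)
      cⱼ = proj₁ (diff j ej)
      -- Modulo `P`, `A` is -A(P - 1), and P - 1 is the difference of the two positions times `u`.
      -- This makes `A` a multiple of the difference of the two congruences, in which `D` cancels.
      A≡ : A ≡ (A - u * (cᵢ - cⱼ)) * P
      A≡ = begin
        A ≡⟨ r1 A P ⟩
        A * P - A * (P - + 1) ≡⟨ cong (λ z → A * P - A * z) (sym (proj₂ (inverse i j i≢j))) ⟩
        A * P - A * ((+ toℕ i - + toℕ j) * u) ≡⟨ r2 A P (+ toℕ i) (+ toℕ j) u D ⟩
        A * P - u * ((A * + toℕ i + D) - (A * + toℕ j + D)) ≡⟨ cong₂ (λ x y → A * P - u * (x - y)) (proj₂ (diff i ei)) (proj₂ (diff j ej)) ⟩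
        A * P - u * (cᵢ * P - cⱼ * P) ≡⟨ r3 A u cᵢ cⱼ P ⟩
        (A - u * (cᵢ - cⱼ)) * P ∎
        where
        r1 : ∀ A P → A ≡ A * P - A * (P - + 1)
        r1 = solve-∀
        r2 : ∀ A P i j u D → A * P - A * ((i - j) * u) ≡ A * P - u * ((A * i + D) - (A * j + D))
        r2 = solve-∀
        r3 : ∀ A u c c′ P → A * P - u * (c * P - c′ * P) ≡ (A - u * (c - c′)) * P
        r3 = solve-∀
      back : ∀ x y z → x - y ≡ z → x ≡ y + z
      back x y z refl = r x y
        where
        r : ∀ x y → x ≡ y + (x - y)
        r = solve-∀
      a≡ : toℕ a ≡ toℕ a′
      a≡ = residue-unique (A - u * (cᵢ - cⱼ)) (F.toℕ<n a) (F.toℕ<n a′) (back (+ toℕ a) (+ toℕ a′) _ A≡)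
      D≡ : D ≡ cᵢ * P
      D≡ = begin
        D ≡⟨ r D (+ toℕ i) (+ toℕ a) ⟩
        (+ toℕ a - + toℕ a) * + toℕ i + D ≡⟨ cong (λ z → (+ toℕ a - + z) * + toℕ i + D) a≡ ⟩
        A * + toℕ i + D ≡⟨ proj₂ (diff i ei) ⟩
        cᵢ * P ∎
        where
        r : ∀ D i a → D ≡ (a - a) * i + D
        r = solve-∀
      b≡ : toℕ b ≡ toℕ b′
      b≡ = residue-unique cᵢ (F.toℕ<n b) (F.toℕ<n b′) (back (+ toℕ b) (+ toℕ b′) _ D≡)

    line-exists : ∀ {i j} → i ≢ j → ∀ x y → Σ (Fin p) λ a → Σ (Fin p) λ b → line a b i ≡ x × line a b j ≡ y
    line-exists {i} {j} i≢j x y = a , b , hit i x i-spec , hit j y j-spec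
      where
      open ≡-Reasoning
      u = proj₁ (inverse i j i≢j)
      X = + toℕ x
      Y = + toℕ y
      I = + toℕ i
      J = + toℕ j
      -- Since (J - I)u is 1 modulo `p`, this slope carries `X` at `i` to `Y` at `j`.
      az = u * (Y - X)
      a = proj₁ (toFin az)
      ca = proj₁ (proj₂ (toFin az))
      bz = X - az * I
      b = proj₁ (toFin bz)
      cb = proj₁ (proj₂ (toFin bz))
      aeq : + toℕ a ≡ az - ca * P
      aeq = trans (r (+ toℕ a) (ca * P)) (cong (_- ca * P) (sym (proj₂ (proj₂ (toFin az)))))
        where
        r : ∀ a z → a ≡ (a + z) - z
        r = solve-∀
      beq : + toℕ b ≡ bz - cb * P
      beq = trans (r (+ toℕ b) (cb * P)) (cong (_- cb * P) (sym (proj₂ (proj₂ (toFin bz)))))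
        where
        r : ∀ a z → a ≡ (a + z) - z
        r = solve-∀
      hit : ∀ i x → (Σ ℤ λ c → + toℕ a * + toℕ i + + toℕ b ≡ + toℕ x + c * P) → line a b i ≡ x
      hit i x (c , e) with line-spec a b i
      ... | c′ , e′ = F.toℕ-injective (residue-unique (c - c′) (F.toℕ<n _) (F.toℕ<n x) (begin
        + toℕ (line a b i) ≡⟨ r (+ toℕ (line a b i)) (c′ * P) ⟩
        (+ toℕ (line a b i) + c′ * P) - c′ * P ≡⟨ cong (_- c′ * P) (trans (sym e′) e) ⟩
        (+ toℕ x + c * P) - c′ * P ≡⟨ r2 (+ toℕ x) c c′ P ⟩
        + toℕ x + (c - c′) * P ∎))
        where
        r : ∀ a z → a ≡ (a + z) - z
        r = solve-∀
        r2 : ∀ x c c′ P → (x + c * P) - c′ * P ≡ x + (c - c′) * P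
        r2 = solve-∀
      i-spec : Σ ℤ λ c → + toℕ a * I + + toℕ b ≡ X + c * P
      i-spec = - (ca * I) - cb , (begin
        + toℕ a * I + + toℕ b ≡⟨ cong₂ (λ s t → s * I + t) aeq beq ⟩
        (az - ca * P) * I + (X - az * I - cb * P) ≡⟨ r az ca P I X cb ⟩
        X + (- (ca * I) - cb) * P ∎)
        where
        r : ∀ az ca P I X cb → (az - ca * P) * I + (X - az * I - cb * P) ≡ X + (- (ca * I) - cb) * P
        r = solve-∀
      j-spec : Σ ℤ λ c → + toℕ a * J + + toℕ b ≡ Y + c * P
      j-spec = - (ca * J) - cb - (Y - X) , (begin
        + toℕ a * J + + toℕ b ≡⟨ cong₂ (λ s t → s * J + t) aeq beq ⟩
        (u * (Y - X) - ca * P) * J + (X - u * (Y - X) * I - cb * P) ≡⟨ r u Y X ca P J I cb ⟩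
        X - (I - J) * u * (Y - X) + (- (ca * J) - cb) * P ≡⟨ cong (λ z → X - z * (Y - X) + (- (ca * J) - cb) * P) (proj₂ (inverse i j i≢j)) ⟩
        X - (P - + 1) * (Y - X) + (- (ca * J) - cb) * P ≡⟨ r2 X Y P ca J cb ⟩
        Y + (- (ca * J) - cb - (Y - X)) * P ∎)
        where
        r : ∀ u Y X ca P J I cb → (u * (Y - X) - ca * P) * J + (X - u * (Y - X) * I - cb * P) ≡ X - (I - J) * u * (Y - X) + (- (ca * J) - cb) * P
        r = solve-∀
        r2 : ∀ X Y P ca J cb → X - (P - + 1) * (Y - X) + (- (ca * J) - cb) * P ≡ Y + (- (ca * J) - cb - (Y - X)) * P
        r2 = solve-∀

-- The degree condition over the natural numbers

module RationalThreshold where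
  open import Data.Nat using (suc; NonZero; _^_)
  import Data.Nat as ℕ
  import Data.Nat.Properties as ℕ
  open import Data.Integer as ℤ using (ℤ; +_)
  import Data.Integer.Properties as ℤ
  open import Data.Integer.Tactic.RingSolver using (solve-∀)
  open import Data.Rational as ℚ using (1ℚ; toℚᵘ)
  import Data.Rational.Properties as ℚ
  open import Data.Rational.Unnormalised as ℚᵘ using (ℚᵘ; mkℚᵘ; _≃_)
  import Data.Rational.Unnormalised.Properties as ℚᵘ
  open import Relation.Binary.PropositionalEquality hiding ([_]; J)

  ℕ→ℚᵘ : ℕ → ℚᵘ
  ℕ→ℚᵘ m = mkℚᵘ (+ m) 0

  toℚᵘ-ℕ→ℚ : ∀ m → toℚᵘ (ℕ→ℚ m) ≃ ℕ→ℚᵘ m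
  toℚᵘ-ℕ→ℚ m = ℚ.toℚᵘ-fromℚᵘ (ℕ→ℚᵘ m)

  -- Multiplication by the denominator `suc e`. The comparison is moved to unnormalised rationals,
  -- where it unfolds to an inequality of integers without any gcd.
  threshold-inequality : ∀ e n c D →
    ℕ→ℚ n ℚ.* (1ℚ ℚ.- (+ 1) ℚ./ suc e) ℚ.+ ℕ→ℚ c ℚ.≤ ℕ→ℚ D → suc e ℕ.* n ℕ.+ suc e ℕ.* c ℕ.≤ suc e ℕ.* D ℕ.+ n
  threshold-inequality e n c D le = ℤ.drop‿+≤+ (begin
    + (suc e ℕ.* n ℕ.+ suc e ℕ.* c) ≡⟨ trans (ℤ.pos-+ (suc e ℕ.* n) _) (cong₂ ℤ._+_ (ℤ.pos-* (suc e) n) (ℤ.pos-* (suc e) c)) ⟩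
    E ℤ.* + n ℤ.+ E ℤ.* + c ≡⟨ r₁ E (+ n) (+ c) ⟩
    (+ n ℤ.* (+ 1 ℤ.* E ℤ.+ ℤ.- (+ 1) ℤ.* + 1) ℤ.* + 1 ℤ.+ + c ℤ.* E) ℤ.* + 1 ℤ.+ + n ≤⟨ ℤ.+-monoˡ-≤ (+ n) (subst₂ (λ a b → (+ n ℤ.* (+ 1 ℤ.* E ℤ.+ ℤ.- (+ 1) ℤ.* + 1) ℤ.* + 1 ℤ.+ + c ℤ.* + suc a) ℤ.* + 1 ℤ.≤ + D ℤ.* + suc b) (pf₁ e) (pf₂ e) (ℚᵘ.drop-*≤* leᵘ)) ⟩
    + D ℤ.* E ℤ.+ + n ≡⟨ cong (ℤ._+ + n) (trans (ℤ.*-comm (+ D) E) (sym (ℤ.pos-* (suc e) D))) ⟩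
    + (suc e ℕ.* D) ℤ.+ + n ≡⟨ sym (ℤ.pos-+ (suc e ℕ.* D) n) ⟩
    + (suc e ℕ.* D ℕ.+ n) ∎)
    where
    E = + suc e
    open ℤ.≤-Reasoning
    pf₁ : ∀ e → e ℕ.+ 0 ℕ.+ 0 ≡ e
    pf₁ e = trans (ℕ.+-identityʳ _) (ℕ.+-identityʳ e)
    pf₂ : ∀ e → (e ℕ.+ 0 ℕ.+ 0) ℕ.* 1 ≡ e
    pf₂ e = trans (ℕ.*-identityʳ _) (pf₁ e)
    r₁ : ∀ E n c → E ℤ.* n ℤ.+ E ℤ.* c ≡ (n ℤ.* (+ 1 ℤ.* E ℤ.+ ℤ.- (+ 1) ℤ.* + 1) ℤ.* + 1 ℤ.+ c ℤ.* E) ℤ.* + 1 ℤ.+ n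
    r₁ = solve-∀
    leᵘ : ℕ→ℚᵘ n ℚᵘ.* (ℚᵘ.1ℚᵘ ℚᵘ.- mkℚᵘ (+ 1) e) ℚᵘ.+ ℕ→ℚᵘ c ℚᵘ.≤ ℕ→ℚᵘ D
    leᵘ = ℚᵘ.≤-trans (ℚᵘ.≤-reflexive (ℚᵘ.≃-sym lhs)) (ℚᵘ.≤-trans (ℚ.toℚᵘ-mono-≤ le) (ℚᵘ.≤-reflexive (toℚᵘ-ℕ→ℚ D)))
      where
      ε = (+ 1) ℚ./ suc e
      lhs : toℚᵘ (ℕ→ℚ n ℚ.* (1ℚ ℚ.- ε) ℚ.+ ℕ→ℚ c) ≃ ℕ→ℚᵘ n ℚᵘ.* (ℚᵘ.1ℚᵘ ℚᵘ.- mkℚᵘ (+ 1) e) ℚᵘ.+ ℕ→ℚᵘ c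
      lhs = ℚᵘ.≃-trans (ℚ.toℚᵘ-homo-+ (ℕ→ℚ n ℚ.* (1ℚ ℚ.- ε)) (ℕ→ℚ c)) (ℚᵘ.+-cong
        (ℚᵘ.≃-trans (ℚ.toℚᵘ-homo-* (ℕ→ℚ n) (1ℚ ℚ.- ε)) (ℚᵘ.*-cong (toℚᵘ-ℕ→ℚ n)
          (ℚᵘ.≃-trans (ℚ.toℚᵘ-homo-+ 1ℚ (ℚ.- ε)) (ℚᵘ.+-cong (ℚᵘ.≃-refl {ℚᵘ.1ℚᵘ})
            (ℚᵘ.≃-trans (ℚ.toℚᵘ-homo‿- ε) (ℚᵘ.-‿cong (ℚ.toℚᵘ-fromℚᵘ (mkℚᵘ (+ 1) e))))))))
        (toℚᵘ-ℕ→ℚ c))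

  threshold-ℕ : ∀ k n c D (f : ℕ → ℚ) → f n ≡ ℕ→ℚ c → threshold (suc k) f n ℚ.≤ ℕ→ℚ D →
    let E = 9 ℕ.* suc k ^ 10 in E ℕ.* n ℕ.+ E ℕ.* c ℕ.≤ E ℕ.* D ℕ.+ n
  threshold-ℕ k n c D f fn le = go (9 ℕ.* suc k ^ 10) {{ℕ.m*n≢0 9 (suc k ^ 10) {{_}} {{ℕ.m^n≢0 (suc k) 10}}}}
    (subst (λ z → ℕ→ℚ n ℚ.* (1ℚ ℚ.- eps (suc k)) ℚ.+ z ℚ.≤ ℕ→ℚ D) fn le)
    where
    -- With the denominator a variable, matching it against `suc e` does not unfold the tenth power.
    go : ∀ E .{{_ : NonZero E}} → ℕ→ℚ n ℚ.* (1ℚ ℚ.- (+ 1) ℚ./ E) ℚ.+ ℕ→ℚ c ℚ.≤ ℕ→ℚ D → E ℕ.* n ℕ.+ E ℕ.* c ℕ.≤ E ℕ.* D ℕ.+ n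
    go (suc e) = threshold-inequality e n c D

open import Data.Nat hiding (_≟_)
open import Data.Nat.Properties hiding (_≟_)
open import Data.Nat.DivMod using (m≡m%n+[m/n]*n; m%n<n; m/n*n≤m)
open import Data.Nat.Induction using (<-wellFounded)
open import Data.Nat.ListAction using (sum)
open import Data.Nat.Tactic.RingSolver using (solve-∀)
open import Induction.WellFounded using (Acc; acc)
open import Data.Bool using (Bool; true; false; if_then_else_)
import Data.Bool.Properties as Bool
open import Data.Fin as F using (toℕ; combine; splitAt; _↑ˡ_; _↑ʳ_)
import Data.Fin.Properties as F
open import Data.Fin.Permutation using (Permutation′; _⟨$⟩ʳ_; _⟨$⟩ˡ_; _∘ₚ_; transpose; inverseˡ; inverseʳ)
import Data.Fin.Permutation as Perm
import Data.Fin.Permutation.Components as PC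
open import Data.Maybe using (Maybe; just; nothing)
open import Data.Maybe.Properties using (just-injective)
open import Data.List using (List; []; _∷_; _++_; length; lookup; map; allFin; concatMap; filter)
import Data.List.Properties as L
open import Data.List.Relation.Unary.Any as Any using (Any; here; there)
open import Data.List.Relation.Unary.Any.Properties using (lookup-index)
open import Data.List.Relation.Unary.All as All using ([]; _∷_)
open import Data.List.Relation.Unary.AllPairs using (AllPairs; []; _∷_)
open import Data.List.Relation.Unary.Unique.Propositional using (Unique)
import Data.List.Relation.Unary.Unique.Propositional.Properties as Unique
open import Data.List.Membership.Propositional using (_∈_; _∉_; find; lose)
open import Data.List.Membership.Propositional.Properties
open import Data.Product using (∃; _,_; proj₁; proj₂)
open import Data.Sum using (_⊎_; inj₁; inj₂; [_,_]; [_,_]′)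
open import Data.Sum.Function.Propositional using (_⊎-↔_)
open import Data.Empty using (⊥; ⊥-elim)
import Data.Rational as ℚ
import Data.Rational.Properties as ℚ
open import Data.Rational using (0ℚ)
open import Function using (_∘_; id; const)
open import Function.Bundles using (Inverse; _↔_)
open import Function.Construct.Composition using (_↔-∘_)
open import Function.Definitions using (Injective)
open import Relation.Nullary using (¬_; Dec; yes; no; does; contradiction; ¬?; decidable-stable)
open import Relation.Nullary.Decidable using (_×-dec_; _⊎-dec_; dec-true; dec-false)
open import Relation.Unary using (Decidable)
open import Relation.Binary.PropositionalEquality hiding ([_]; J)

open LineArithmetic using (module Lines)
open RationalThreshold using (threshold-ℕ)

-- Sums over lists

∑ : ∀ {A : Set} → List A → (A → ℕ) → ℕ
∑ xs f = sum (map f xs)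

𝟙 : ∀ {P : Set} → Dec P → ℕ
𝟙 P? = if does P? then 1 else 0

𝟙-yes : ∀ {P : Set} (P? : Dec P) → P → 𝟙 P? ≡ 1
𝟙-yes (yes _) _ = refl
𝟙-yes (no ¬p) p = contradiction p ¬p

𝟙-no : ∀ {P : Set} (P? : Dec P) → ¬ P → 𝟙 P? ≡ 0
𝟙-no (yes p) ¬p = contradiction p ¬p
𝟙-no (no _) _ = refl

𝟙-≤ : ∀ {P : Set} (P? : Dec P) {m} → (P → 1 ≤ m) → 𝟙 P? ≤ m
𝟙-≤ (yes p) h = h p
𝟙-≤ (no _) _ = z≤n

𝟙*-≤ : ∀ {P : Set} (P? : Dec P) {c m} → (P → c ≤ m) → 𝟙 P? * c ≤ m
𝟙*-≤ (yes p) {c} h = ≤-trans (≤-reflexive (+-identityʳ c)) (h p)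
𝟙*-≤ (no _) _ = z≤n

𝟙≤1 : ∀ {P : Set} (P? : Dec P) → 𝟙 P? ≤ 1
𝟙≤1 P? = 𝟙-≤ P? (λ _ → ≤-refl)

𝟙-mono : ∀ {P Q : Set} (P? : Dec P) (Q? : Dec Q) → (P → Q) → 𝟙 P? ≤ 𝟙 Q?
𝟙-mono P? Q? h = 𝟙-≤ P? λ p → ≤-reflexive (sym (𝟙-yes Q? (h p)))

𝟙-cong : ∀ {P Q : Set} (P? : Dec P) (Q? : Dec Q) → (P → Q) → (Q → P) → 𝟙 P? ≡ 𝟙 Q?
𝟙-cong P? Q? f g = ≤-antisym (𝟙-mono P? Q? f) (𝟙-mono Q? P? g)

module _ {A : Set} where

  ∑-cong∈ : ∀ (xs : List A) {f g} → (∀ {x} → x ∈ xs → f x ≡ g x) → ∑ xs f ≡ ∑ xs g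
  ∑-cong∈ [] h = refl
  ∑-cong∈ (x ∷ xs) h = cong₂ _+_ (h (here refl)) (∑-cong∈ xs (h ∘ there))

  ∑-cong : ∀ (xs : List A) {f g} → (∀ x → f x ≡ g x) → ∑ xs f ≡ ∑ xs g
  ∑-cong xs h = ∑-cong∈ xs (λ {x} _ → h x)

  ∑-mono∈ : ∀ (xs : List A) {f g} → (∀ {x} → x ∈ xs → f x ≤ g x) → ∑ xs f ≤ ∑ xs g
  ∑-mono∈ [] h = z≤n
  ∑-mono∈ (x ∷ xs) h = +-mono-≤ (h (here refl)) (∑-mono∈ xs (h ∘ there))

  ∑-mono : ∀ (xs : List A) {f g} → (∀ x → f x ≤ g x) → ∑ xs f ≤ ∑ xs g
  ∑-mono xs h = ∑-mono∈ xs (λ {x} _ → h x)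

  ∑-+ : ∀ (xs : List A) f g → ∑ xs (λ x → f x + g x) ≡ ∑ xs f + ∑ xs g
  ∑-+ [] f g = refl
  ∑-+ (x ∷ xs) f g rewrite ∑-+ xs f g = +-interchange (f x) (g x) (∑ xs f) (∑ xs g)
    where
    +-interchange : ∀ a b c d → (a + b) + (c + d) ≡ (a + c) + (b + d)
    +-interchange = solve-∀

  ∑-*ˡ : ∀ (xs : List A) c f → ∑ xs (λ x → c * f x) ≡ c * ∑ xs f
  ∑-*ˡ [] c f = sym (*-zeroʳ c)
  ∑-*ˡ (x ∷ xs) c f rewrite ∑-*ˡ xs c f = sym (*-distribˡ-+ c (f x) (∑ xs f))

  ∑-*ʳ : ∀ (xs : List A) c f → ∑ xs (λ x → f x * c) ≡ ∑ xs f * c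
  ∑-*ʳ [] c f = refl
  ∑-*ʳ (x ∷ xs) c f rewrite ∑-*ʳ xs c f = sym (*-distribʳ-+ c (f x) (∑ xs f))

  ∑-const : ∀ (xs : List A) c → ∑ xs (λ _ → c) ≡ length xs * c
  ∑-const [] c = refl
  ∑-const (x ∷ xs) c = cong (c +_) (∑-const xs c)

  ∑-≤const : ∀ (xs : List A) {f} c → (∀ x → f x ≤ c) → ∑ xs f ≤ length xs * c
  ∑-≤const xs c h = ≤-trans (∑-mono xs h) (≤-reflexive (∑-const xs c))

  ∑-++ : ∀ (xs ys : List A) f → ∑ (xs ++ ys) f ≡ ∑ xs f + ∑ ys f
  ∑-++ [] ys f = refl
  ∑-++ (x ∷ xs) ys f rewrite ∑-++ xs ys f = sym (+-assoc (f x) (∑ xs f) (∑ ys f))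

  ∑-∈ : ∀ {xs : List A} {x} f → x ∈ xs → f x ≤ ∑ xs f
  ∑-∈ {_ ∷ xs} f (here refl) = m≤m+n _ (∑ xs f)
  ∑-∈ {y ∷ _} f (there p) = ≤-trans (∑-∈ f p) (m≤n+m _ (f y))

  ∑-pos : ∀ (xs : List A) f → 1 ≤ ∑ xs f → Σ A λ x → x ∈ xs × 1 ≤ f x
  ∑-pos (x ∷ xs) f h with 1 ≤? f x
  ... | yes p = x , here refl , p
  ... | no ¬p with ∑-pos xs f (subst (λ z → 1 ≤ z + ∑ xs f) (n<1⇒n≡0 (≰⇒> ¬p)) h)
  ...   | y , y∈ , q = y , there y∈ , q

  length-filter-∑ : ∀ {P : A → Set} (P? : Decidable P) xs → length (filter P? xs) ≡ ∑ xs (𝟙 ∘ P?)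
  length-filter-∑ P? [] = refl
  length-filter-∑ P? (x ∷ xs) with does (P? x)
  ... | true = cong suc (length-filter-∑ P? xs)
  ... | false = length-filter-∑ P? xs

∑-map : ∀ {A B : Set} (g : A → B) xs f → ∑ (map g xs) f ≡ ∑ xs (f ∘ g)
∑-map g [] f = refl
∑-map g (x ∷ xs) f = cong (f (g x) +_) (∑-map g xs f)

∑-swap : ∀ {A B : Set} (xs : List A) (ys : List B) (f : A → B → ℕ) →
  ∑ xs (λ x → ∑ ys (f x)) ≡ ∑ ys (λ y → ∑ xs (λ x → f x y))
∑-swap [] ys f = sym (trans (∑-const ys 0) (*-zeroʳ (length ys)))
∑-swap (x ∷ xs) ys f rewrite ∑-swap xs ys f = sym (∑-+ ys (f x) (λ y → ∑ xs (λ x → f x y)))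

∑-concatMap : ∀ {A B : Set} (g : A → List B) xs f → ∑ (concatMap g xs) f ≡ ∑ xs (λ x → ∑ (g x) f)
∑-concatMap g [] f = refl
∑-concatMap g (x ∷ xs) f = trans (∑-++ (g x) (concatMap g xs) f) (cong (∑ (g x) f +_) (∑-concatMap g xs f))

length-concatMap : ∀ {A B : Set} (g : A → List B) xs → length (concatMap g xs) ≡ ∑ xs (length ∘ g)
length-concatMap g [] = refl
length-concatMap g (x ∷ xs) = trans (L.length-++ (g x)) (cong (length (g x) +_) (length-concatMap g xs))

∈-concatMap : ∀ {A B : Set} (g : A → List B) {xs x y} → x ∈ xs → y ∈ g x → y ∈ concatMap g xs
∈-concatMap g {_ ∷ xs} (here refl) q = ∈-++⁺ˡ q
∈-concatMap g {x ∷ _} (there p) q = ∈-++⁺ʳ (g x) (∈-concatMap g p q)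

length-allFin : ∀ n → length (allFin n) ≡ n
length-allFin n = L.length-tabulate id

map-suc-allFin : ∀ n → allFin (suc n) ≡ F.zero ∷ map F.suc (allFin n)
map-suc-allFin n = cong (F.zero ∷_) (sym (L.map-tabulate id F.suc))

∑-allFin-suc : ∀ n (f : Fin (suc n) → ℕ) → ∑ (allFin (suc n)) f ≡ f F.zero + ∑ (allFin n) (f ∘ F.suc)
∑-allFin-suc n f = trans (cong (λ l → ∑ l f) (map-suc-allFin n)) (cong (f F.zero +_) (∑-map F.suc (allFin n) f))

∑-allFin-const : ∀ n c → ∑ (allFin n) (λ _ → c) ≡ n * c
∑-allFin-const n c = trans (∑-const (allFin n) c) (cong (_* c) (length-allFin n))

∑-point : ∀ {n} (w : Fin n) (f : Fin n → ℕ) → ∑ (allFin n) (λ x → 𝟙 (x F.≟ w) * f x) ≡ f w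
∑-point {suc n} F.zero f = trans (∑-allFin-suc n (λ x → 𝟙 (x F.≟ F.zero) * f x))
  (trans (cong₂ _+_ (+-identityʳ (f F.zero)) (trans (∑-const (allFin n) 0) (*-zeroʳ (length (allFin n))))) (+-identityʳ (f F.zero)))
∑-point {suc n} (F.suc w) f = trans (∑-allFin-suc n (λ x → 𝟙 (x F.≟ F.suc w) * f x))
  (trans (∑-cong (allFin n) (λ x → cong (_* f (F.suc x)) (𝟙-cong (F.suc x F.≟ F.suc w) (x F.≟ w) F.suc-injective (cong F.suc))))
         (∑-point w (f ∘ F.suc)))

∑-point₁ : ∀ {n} (w : Fin n) → ∑ (allFin n) (λ x → 𝟙 (x F.≟ w)) ≡ 1
∑-point₁ {n} w = trans (∑-cong (allFin n) (λ x → sym (*-identityʳ _))) (∑-point w (λ _ → 1))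

∑-list : ∀ {n} {P : Fin n → Set} (P? : Decidable P) (ys : List (Fin n)) → (∀ {x} → P x → x ∈ ys) →
  ∑ (allFin n) (𝟙 ∘ P?) ≤ length ys
∑-list {n} P? ys h = begin
  ∑ (allFin n) (𝟙 ∘ P?) ≤⟨ ∑-mono (allFin n) (λ x → 𝟙-≤ (P? x) λ p → ≤-trans (≤-reflexive (sym (𝟙-yes (x F.≟ x) refl))) (∑-∈ (λ y → 𝟙 (x F.≟ y)) (h p))) ⟩
  ∑ (allFin n) (λ x → ∑ ys (λ y → 𝟙 (x F.≟ y))) ≡⟨ ∑-swap (allFin n) ys (λ x y → 𝟙 (x F.≟ y)) ⟩
  ∑ ys (λ y → ∑ (allFin n) (λ x → 𝟙 (x F.≟ y))) ≡⟨ ∑-cong ys ∑-point₁ ⟩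
  ∑ ys (λ _ → 1) ≡⟨ ∑-const ys 1 ⟩
  length ys * 1 ≡⟨ *-identityʳ _ ⟩
  length ys ∎
  where open ≤-Reasoning

fresh : ∀ {n} (ys : List (Fin n)) → length ys < n → Σ (Fin n) λ x → x ∉ ys
fresh {n} ys lt with F.any? (λ x → ¬? (Any.any? (x F.≟_) ys))
... | yes p = p
... | no ¬p = contradiction lt (≤⇒≯ (begin
  n ≡⟨ trans (sym (*-identityʳ n)) (sym (∑-allFin-const n 1)) ⟩
  ∑ (allFin n) (λ _ → 1) ≤⟨ ∑-mono (allFin n) (λ x → ≤-reflexive (sym (𝟙-yes (mem? x) (decidable-stable (mem? x) λ ¬q → ¬p (x , ¬q))))) ⟩
  ∑ (allFin n) (λ x → 𝟙 (mem? x)) ≤⟨ ∑-list mem? ys id ⟩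
  length ys ∎))
  where
  open ≤-Reasoning
  mem? : ∀ x → Dec (x ∈ ys)
  mem? x = Any.any? (x F.≟_) ys

-- Swapping two positions

∑-perm : ∀ {n} (π : Permutation′ n) (f : Fin n → ℕ) → ∑ (allFin n) (λ x → f (π ⟨$⟩ʳ x)) ≡ ∑ (allFin n) f
∑-perm {n} π f = begin
  ∑ (allFin n) (λ x → f (π ⟨$⟩ʳ x)) ≡⟨ ∑-cong (allFin n) (λ x → sym (∑-point (π ⟨$⟩ʳ x) f)) ⟩
  ∑ (allFin n) (λ x → ∑ (allFin n) (λ y → 𝟙 (y F.≟ π ⟨$⟩ʳ x) * f y)) ≡⟨ ∑-swap (allFin n) (allFin n) _ ⟩
  ∑ (allFin n) (λ y → ∑ (allFin n) (λ x → 𝟙 (y F.≟ π ⟨$⟩ʳ x) * f y)) ≡⟨ ∑-cong (allFin n) (λ y → trans (∑-*ʳ (allFin n) (f y) _) (cong (_* f y) (inner y))) ⟩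
  ∑ (allFin n) (λ y → 1 * f y) ≡⟨ ∑-cong (allFin n) (λ y → *-identityˡ (f y)) ⟩
  ∑ (allFin n) f ∎
  where
  open ≡-Reasoning
  inner : ∀ y → ∑ (allFin n) (λ x → 𝟙 (y F.≟ π ⟨$⟩ʳ x)) ≡ 1
  inner y = trans (∑-cong (allFin n) (λ x → 𝟙-cong (y F.≟ π ⟨$⟩ʳ x) (x F.≟ π ⟨$⟩ˡ y)
      (λ e → trans (sym (inverseˡ π)) (cong (π ⟨$⟩ˡ_) (sym e)))
      (λ e → trans (sym (inverseʳ π)) (cong (π ⟨$⟩ʳ_) (sym e))))) (∑-point₁ (π ⟨$⟩ˡ y))

-- Descent: `F` takes values in the natural numbers, so strict improvements by transpositions come
-- to an end.
local-min : ∀ {n} (F : Permutation′ n → ℕ) → Σ (Permutation′ n) λ π → ∀ x y → F π ≤ F (transpose x y ∘ₚ π)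
local-min {n} F = go Perm.id (<-wellFounded _)
  where
  go : ∀ π → Acc _<_ (F π) → Σ (Permutation′ n) λ π → ∀ x y → F π ≤ F (transpose x y ∘ₚ π)
  go π (acc rs) with F.any? (λ x → F.any? (λ y → F (transpose x y ∘ₚ π) <? F π))
  ... | yes (x , y , lt) = go (transpose x y ∘ₚ π) (rs lt)
  ... | no ¬p = π , λ x y → ≮⇒≥ (λ lt → ¬p (x , y , lt))

transpose-other : ∀ {n} (x y : Fin n) {u} → u ≢ x → u ≢ y → PC.transpose x y u ≡ u
transpose-other x y {u} ux uy rewrite dec-false (u F.≟ x) ux | dec-false (u F.≟ y) uy = refl

transpose-ˡ : ∀ {n} (x y : Fin n) → PC.transpose x y x ≡ y
transpose-ˡ x y rewrite dec-true (x F.≟ x) refl = refl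

transpose-ʳ : ∀ {n} (x y : Fin n) → PC.transpose x y y ≡ x
transpose-ʳ x y with y F.≟ x
... | yes p = p
... | no _ rewrite dec-true (y F.≟ y) refl = refl

module _ {n : ℕ} (x y : Fin n) (x≢y : x ≢ y) where
  private
    V = allFin n
    δ : Fin n → ℕ
    δ u = 𝟙 (u F.≟ x) + 𝟙 (u F.≟ y)

    ∑-δ : ∀ (g : Fin n → ℕ) → ∑ V (λ u → δ u * g u) ≡ g x + g y
    ∑-δ g = trans (∑-cong V (λ u → *-distribʳ-+ (g u) (𝟙 (u F.≟ x)) (𝟙 (u F.≟ y))))
      (trans (∑-+ V _ _) (cong₂ _+_ (∑-point x g) (∑-point y g)))

    ∑∑-δ : ∀ (f : Fin n → Fin n → ℕ) → (∀ u a → f u a ≡ f a u) →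
      ∑ V (λ u → ∑ V (λ a → (δ u + δ a) * f u a)) ≡ 2 * (∑ V (f x) + ∑ V (f y))
    ∑∑-δ f f-sym = begin
      ∑ V (λ u → ∑ V (λ a → (δ u + δ a) * f u a)) ≡⟨ ∑-cong V (λ u → trans (∑-cong V (λ a → *-distribʳ-+ (f u a) (δ u) (δ a))) (∑-+ V _ _)) ⟩
      ∑ V (λ u → ∑ V (λ a → δ u * f u a) + ∑ V (λ a → δ a * f u a)) ≡⟨ ∑-+ V _ _ ⟩
      ∑ V (λ u → ∑ V (λ a → δ u * f u a)) + ∑ V (λ u → ∑ V (λ a → δ a * f u a)) ≡⟨ cong₂ _+_ first second ⟩
      R + R ≡⟨ cong (R +_) (+-identityʳ R) ⟨
      2 * R ∎
      where
      open ≡-Reasoning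
      R = ∑ V (f x) + ∑ V (f y)
      first : ∑ V (λ u → ∑ V (λ a → δ u * f u a)) ≡ R
      first = trans (∑-cong V (λ u → ∑-*ˡ V (δ u) (f u))) (∑-δ (λ u → ∑ V (f u)))
      second : ∑ V (λ u → ∑ V (λ a → δ a * f u a)) ≡ R
      second = trans (∑-cong V (λ u → ∑-δ (f u)))
        (trans (∑-+ V _ _) (cong₂ _+_ (∑-cong V (λ u → f-sym u x)) (∑-cong V (λ u → f-sym u y))))

  -- The weight `δ u + δ a` is 1 on the cells with exactly one index among `x` and `y`, where adding
  -- the weighted copy of the other matrix gives f + g on both sides. On all other cells `f` and `g`
  -- agree. The factor 2 accounts for rows and columns.
  ∑∑-exchange : (f g : Fin n → Fin n → ℕ) → (∀ u a → f u a ≡ f a u) → (∀ u a → g u a ≡ g a u) →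
    (∀ u → f u u ≡ 0) → (∀ u → g u u ≡ 0) → f x y ≡ g x y →
    (∀ {u a} → u ≢ x → u ≢ y → a ≢ x → a ≢ y → f u a ≡ g u a) →
    ∑ V (λ u → ∑ V (g u)) + 2 * (∑ V (f x) + ∑ V (f y)) ≡ ∑ V (λ u → ∑ V (f u)) + 2 * (∑ V (g x) + ∑ V (g y))
  ∑∑-exchange f g f-sym g-sym f0 g0 fgxy fg = begin
    ∑ V (λ u → ∑ V (g u)) + 2 * (∑ V (f x) + ∑ V (f y)) ≡⟨ join g f f-sym ⟩
    ∑ V (λ u → ∑ V (λ a → g u a + (δ u + δ a) * f u a)) ≡⟨ ∑-cong V (λ u → ∑-cong V (pt u)) ⟩
    ∑ V (λ u → ∑ V (λ a → f u a + (δ u + δ a) * g u a)) ≡⟨ join f g g-sym ⟨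
    ∑ V (λ u → ∑ V (f u)) + 2 * (∑ V (g x) + ∑ V (g y)) ∎
    where
    open ≡-Reasoning
    join : ∀ (f g : Fin n → Fin n → ℕ) → (∀ u a → g u a ≡ g a u) →
      ∑ V (λ u → ∑ V (f u)) + 2 * (∑ V (g x) + ∑ V (g y)) ≡ ∑ V (λ u → ∑ V (λ a → f u a + (δ u + δ a) * g u a))
    join f g g-sym = sym (trans (∑-cong V (λ u → ∑-+ V (f u) _)) (trans (∑-+ V _ _) (cong (∑ V (λ u → ∑ V (f u)) +_) (∑∑-δ g g-sym))))
    eq⇒ : ∀ u a → f u a ≡ g u a → g u a + (δ u + δ a) * f u a ≡ f u a + (δ u + δ a) * g u a
    eq⇒ u a e rewrite e = refl
    one⇒ : ∀ u a → δ u + δ a ≡ 1 → g u a + (δ u + δ a) * f u a ≡ f u a + (δ u + δ a) * g u a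
    one⇒ u a e rewrite e | *-identityˡ (f u a) | *-identityˡ (g u a) = +-comm (g u a) (f u a)
    δx : δ x ≡ 1
    δx rewrite 𝟙-yes (x F.≟ x) refl | 𝟙-no (x F.≟ y) x≢y = refl
    δy : δ y ≡ 1
    δy rewrite 𝟙-yes (y F.≟ y) refl | 𝟙-no (y F.≟ x) (x≢y ∘ sym) = refl
    δ0 : ∀ {u} → u ≢ x → u ≢ y → δ u ≡ 0
    δ0 {u} p q rewrite 𝟙-no (u F.≟ x) p | 𝟙-no (u F.≟ y) q = refl
    fgyx = trans (f-sym y x) (trans fgxy (g-sym x y))
    loc : ∀ u → u ≡ x ⊎ u ≡ y ⊎ (u ≢ x × u ≢ y)
    loc u with u F.≟ x | u F.≟ y
    ... | yes p | _ = inj₁ p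
    ... | no _ | yes q = inj₂ (inj₁ q)
    ... | no p | no q = inj₂ (inj₂ (p , q))
    diag : ∀ u → f u u ≡ g u u
    diag u = trans (f0 u) (sym (g0 u))
    pt : ∀ u a → g u a + (δ u + δ a) * f u a ≡ f u a + (δ u + δ a) * g u a
    pt u a with loc u | loc a
    ... | inj₁ refl | inj₁ refl = eq⇒ x x (diag x)
    ... | inj₁ refl | inj₂ (inj₁ refl) = eq⇒ x y fgxy
    ... | inj₂ (inj₁ refl) | inj₁ refl = eq⇒ y x fgyx
    ... | inj₂ (inj₁ refl) | inj₂ (inj₁ refl) = eq⇒ y y (diag y)
    ... | inj₁ refl | inj₂ (inj₂ (p , q)) = one⇒ x a (cong₂ _+_ δx (δ0 p q))
    ... | inj₂ (inj₁ refl) | inj₂ (inj₂ (p , q)) = one⇒ y a (cong₂ _+_ δy (δ0 p q))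
    ... | inj₂ (inj₂ (p , q)) | inj₁ refl = one⇒ u x (cong₂ _+_ (δ0 p q) δx)
    ... | inj₂ (inj₂ (p , q)) | inj₂ (inj₁ refl) = one⇒ u y (cong₂ _+_ (δ0 p q) δy)
    ... | inj₂ (inj₂ (p , q)) | inj₂ (inj₂ (p′ , q′)) = eq⇒ u a (fg p q p′ q′)

module Overlap {n : ℕ} (h : Fin n → Fin n → ℕ) (h-sym : ∀ u v → h u v ≡ h v u) (h-diag : ∀ u → h u u ≡ 0) where
  private V = allFin n

  -- For adjacency matrices `S` and `h`, this is the number of conflicts at `x` if it were placed at
  -- `v` and all else stayed at its `π`-image. Consequently `total` counts every `S`-edge that lands
  -- on an `h`-edge twice.
  row : (Fin n → Fin n → ℕ) → (Fin n → Fin n) → Fin n → Fin n → ℕ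
  row S π x v = ∑ V (λ a → S x a * h v (π a))

  total : (Fin n → Fin n → ℕ) → (Fin n → Fin n) → ℕ
  total S π = ∑ V (λ u → row S π u (π u))

  module _ (S : Fin n → Fin n → ℕ) (S-sym : ∀ u v → S u v ≡ S v u) (S-diag : ∀ u → S u u ≡ 0) (π : Fin n → Fin n) where

    -- Terms are added on both sides to avoid truncated subtraction. The last summand is a
    -- correction: when `x` moves to `π y`, its row still reads `y` at `π y`, where `h` vanishes,
    -- although `y` has moved to `π x`. The rows of `x` and `y` each miss this conflict once.
    total-transpose : ∀ x y →
      total S (π ∘ PC.transpose x y) + 2 * (row S π x (π x) + row S π y (π y)) ≡
      total S π + 2 * (row S π x (π y) + row S π y (π x) + 2 * (S x y * h (π x) (π y)))
    total-transpose x y with x F.≟ y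
    ... | yes refl = cong₂ _+_
      (∑-cong V (λ u → ∑-cong V (λ a → cong₂ (λ v w → S u a * h (π v) (π w)) (triv u) (triv a))))
      (cong (2 *_) (trans (sym (+-identityʳ _)) (cong (row S π x (π x) + row S π x (π x) +_) (sym (cong (λ z → 2 * (z * h (π x) (π x))) (S-diag x))))))
      where
      triv′ : ∀ u → Dec (u ≡ x) → PC.transpose x x u ≡ u
      triv′ u (yes refl) = transpose-ˡ u u
      triv′ u (no p) = transpose-other x x p p
      triv : ∀ u → PC.transpose x x u ≡ u
      triv u = triv′ u (u F.≟ x)
    ... | no x≢y = begin
      total S (π ∘ τ) + 2 * (row S π x (π x) + row S π y (π y)) ≡⟨ ∑∑-exchange x y x≢y f g f-sym g-sym (λ u → cong (_* h (π u) (π u)) (S-diag u)) (λ u → cong (_* h (π (τ u)) (π (τ u))) (S-diag u)) fgxy fg ⟩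
      total S π + 2 * (∑ V (g x) + ∑ V (g y)) ≡⟨ cong (λ z → total S π + 2 * z) (cong₂ _+_ rowx rowy) ⟩
      total S π + 2 * ((row S π x (π y) + e) + (row S π y (π x) + e)) ≡⟨ cong (λ z → total S π + 2 * z) (arith (row S π x (π y)) (row S π y (π x)) e) ⟩
      total S π + 2 * (row S π x (π y) + row S π y (π x) + 2 * e) ∎
      where
      open ≡-Reasoning
      τ = PC.transpose x y
      e = S x y * h (π x) (π y)
      arith : ∀ a b e → (a + e) + (b + e) ≡ a + b + 2 * e
      arith = solve-∀
      f g : Fin n → Fin n → ℕ
      f u a = S u a * h (π u) (π a)
      g u a = S u a * h (π (τ u)) (π (τ a))
      f-sym : ∀ u a → f u a ≡ f a u
      f-sym u a = cong₂ _*_ (S-sym u a) (h-sym (π u) (π a))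
      g-sym : ∀ u a → g u a ≡ g a u
      g-sym u a = cong₂ _*_ (S-sym u a) (h-sym (π (τ u)) (π (τ a)))
      fgxy : f x y ≡ g x y
      fgxy = cong (S x y *_) (trans (h-sym (π x) (π y)) (cong₂ (λ v w → h (π v) (π w)) (sym (transpose-ˡ x y)) (sym (transpose-ʳ x y))))
      fg : ∀ {u a} → u ≢ x → u ≢ y → a ≢ x → a ≢ y → f u a ≡ g u a
      fg {u} {a} p q p′ q′ = cong₂ (λ v w → S u a * h (π v) (π w)) (sym (transpose-other x y p q)) (sym (transpose-other x y p′ q′))
      rowgen : ∀ x y → S x x ≡ 0 → (τ′ : Fin n → Fin n) → τ′ x ≡ y → τ′ y ≡ x → (∀ {a} → a ≢ x → a ≢ y → τ′ a ≡ a) →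
        ∑ V (λ a → S x a * h (π y) (π (τ′ a))) ≡ row S π x (π y) + S x y * h (π x) (π y)
      rowgen x y S0 τ′ tx ty to = trans (∑-cong V pt) (trans (∑-+ V _ _) (cong (row S π x (π y) +_) (∑-point y (λ a → S x a * h (π x) (π y)))))
        where
        pt : ∀ a → S x a * h (π y) (π (τ′ a)) ≡ S x a * h (π y) (π a) + 𝟙 (a F.≟ y) * (S x a * h (π x) (π y))
        pt a with a F.≟ y
        ... | yes refl rewrite ty | h-diag (π a) | *-zeroʳ (S x a) | h-sym (π a) (π x) = sym (+-identityʳ _)
        ... | no p with a F.≟ x
        ...   | yes refl rewrite S0 = refl
        ...   | no q rewrite to q p = sym (+-identityʳ _)
      rowx : ∑ V (g x) ≡ row S π x (π y) + e
      rowx = trans (∑-cong V (λ a → cong (λ w → S x a * h (π w) (π (τ a))) (transpose-ˡ x y)))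
        (rowgen x y (S-diag x) τ (transpose-ˡ x y) (transpose-ʳ x y) (transpose-other x y))
      rowy : ∑ V (g y) ≡ row S π y (π x) + e
      rowy = trans (∑-cong V (λ a → cong (λ w → S y a * h (π w) (π (τ a))) (transpose-ʳ x y)))
        (trans (rowgen y x (S-diag y) τ (transpose-ʳ x y) (transpose-ˡ x y) (λ p q → transpose-other x y q p))
          (cong (row S π y (π x) +_) (cong₂ _*_ (S-sym y x) (h-sym (π y) (π x)))))

-- Permutations with small overlaps

module Potential (Z : ℕ) (0<Z : 0 < Z) (U : ℕ) where

  -- This is (1 + 1/Z)^t scaled by Z^U to stay integral. It is exponential only up to `U`, so `U`
  -- has to exceed every overlap that can occur.
  Φ : ℕ → ℕ
  Φ t = suc Z ^ t * Z ^ (U ∸ t)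

  private
    Φ-suc : ∀ {t} → t < U → Z * Φ (suc t) ≡ suc Z * Φ t
    Φ-suc {t} t<U = begin
      Z * (suc Z * suc Z ^ t * Z ^ (U ∸ suc t)) ≡⟨ lemma Z (suc Z) (suc Z ^ t) (Z ^ (U ∸ suc t)) ⟩
      suc Z * (suc Z ^ t * Z ^ suc (U ∸ suc t)) ≡⟨ cong (λ z → suc Z * (suc Z ^ t * Z ^ z)) (sym (+-∸-assoc 1 t<U)) ⟩
      suc Z * Φ t ∎
      where
      open ≡-Reasoning
      lemma : ∀ a b c e → a * (b * c * e) ≡ b * (c * (a * e))
      lemma = solve-∀

    instance
      nzZ : NonZero Z
      nzZ = >-nonZero 0<Z

  Φ-mono : ∀ {t t′} → t ≤ t′ → t′ ≤ U → Φ t ≤ Φ t′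
  Φ-mono {t} {t′} le le′ = go (≤⇒≤′ le) le′
    where
    go : ∀ {t′} → t ≤′ t′ → t′ ≤ U → Φ t ≤ Φ t′
    go ≤′-refl _ = ≤-refl
    go (≤′-step {t′} p) q = ≤-trans (go p (<⇒≤ q)) (*-cancelˡ-≤ Z (≤-trans (*-monoˡ-≤ (Φ t′) (n≤1+n Z)) (≤-reflexive (sym (Φ-suc q)))))

  -- Telescoping: the ratio 1 + 1/Z of a step is at most (K + i + 1)/(K + i) as long as K + i ≤ Z.
  Φ-up : ∀ {K} t m → K + m ≤ suc Z → t + m ≤ U → K * Φ (t + m) ≤ (K + m) * Φ t
  Φ-up {K} t zero _ _ rewrite +-identityʳ K | +-identityʳ t = ≤-refl
  Φ-up {K} t (suc m) Km tm rewrite +-suc K m | +-suc t m = *-cancelˡ-≤ Z (begin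
    Z * (K * Φ (suc (t + m))) ≡⟨ c1 Z K _ ⟩
    K * (Z * Φ (suc (t + m))) ≡⟨ cong (K *_) (Φ-suc tm) ⟩
    K * (suc Z * Φ (t + m)) ≡⟨ c1 K (suc Z) _ ⟩
    suc Z * (K * Φ (t + m)) ≤⟨ *-monoʳ-≤ (suc Z) (Φ-up {K} t m (<⇒≤ Km) (<⇒≤ tm)) ⟩
    suc Z * ((K + m) * Φ t) ≡⟨ c2 Z (K + m) (Φ t) ⟩
    (K + m) * Φ t + Z * ((K + m) * Φ t) ≤⟨ +-monoˡ-≤ _ (*-monoˡ-≤ (Φ t) (s≤s⁻¹ Km)) ⟩
    Z * Φ t + Z * ((K + m) * Φ t) ≡⟨ *-distribˡ-+ Z (Φ t) _ ⟨
    Z * (suc (K + m) * Φ t) ∎)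
    where
    open ≤-Reasoning
    c1 : ∀ a b c → a * (b * c) ≡ b * (a * c)
    c1 = solve-∀
    c2 : ∀ z a p → (1 + z) * (a * p) ≡ a * p + z * (a * p)
    c2 = solve-∀

  -- Bernoulli's inequality, again by telescoping: for e ≥ Z each factor (e + i + 1)/(e + i) is at
  -- most 1 + 1/Z. Taking e = m = Z shows that `Z` steps double `Φ`.
  Φ-down : ∀ t e m → Z ≤ e → t + m ≤ U → (e + m) * Φ t ≤ e * Φ (t + m)
  Φ-down t e zero _ _ rewrite +-identityʳ e | +-identityʳ t = ≤-refl
  Φ-down t e (suc m) Ze tm rewrite +-suc t m = *-cancelˡ-≤ Z (begin
    Z * ((e + suc m) * Φ t) ≡⟨ cong (λ z → Z * (z * Φ t)) (+-suc e m) ⟩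
    Z * ((suc e + m) * Φ t) ≤⟨ *-monoʳ-≤ Z (Φ-down t (suc e) m (m≤n⇒m≤1+n Ze) (<⇒≤ tm)) ⟩
    Z * (suc e * Φ (t + m)) ≡⟨ c2 Z e (Φ (t + m)) ⟩
    Z * Φ (t + m) + e * (Z * Φ (t + m)) ≤⟨ +-monoˡ-≤ _ (*-monoˡ-≤ (Φ (t + m)) Ze) ⟩
    e * Φ (t + m) + e * (Z * Φ (t + m)) ≡⟨ c3 Z e (Φ (t + m)) ⟩
    e * (suc Z * Φ (t + m)) ≡⟨ cong (e *_) (Φ-suc tm) ⟨
    e * (Z * Φ (suc (t + m))) ≡⟨ c1 e Z _ ⟩
    Z * (e * Φ (suc (t + m))) ∎)
    where
    open ≤-Reasoning
    c1 : ∀ a b c → a * (b * c) ≡ b * (a * c)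
    c1 = solve-∀
    c2 : ∀ z e p → z * ((1 + e) * p) ≡ z * p + e * (z * p)
    c2 = solve-∀
    c3 : ∀ z e p → e * p + e * (z * p) ≡ e * ((1 + z) * p)
    c3 = solve-∀

  Φ-double : ∀ t → t + Z ≤ U → 2 * Φ t ≤ Φ (t + Z)
  Φ-double t le = *-cancelˡ-≤ Z (≤-trans (≤-reflexive (c Z (Φ t))) (Φ-down t Z Z ≤-refl le))
    where
    c : ∀ z p → z * (2 * p) ≡ (z + z) * p
    c = solve-∀

  Φ-exp : ∀ t j → t + j * Z ≤ U → 2 ^ j * Φ t ≤ Φ (t + j * Z)
  Φ-exp t zero _ = ≤-reflexive (trans (*-identityˡ (Φ t)) (cong Φ (sym (+-identityʳ t))))
  Φ-exp t (suc j) le = begin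
    2 * 2 ^ j * Φ t ≡⟨ *-assoc 2 (2 ^ j) (Φ t) ⟩
    2 * (2 ^ j * Φ t) ≤⟨ *-monoʳ-≤ 2 (Φ-exp t j (m+n≤o⇒m≤o _ le′)) ⟩
    2 * Φ (t + j * Z) ≤⟨ Φ-double (t + j * Z) le′ ⟩
    Φ (t + j * Z + Z) ≡⟨ cong Φ (sym e) ⟩
    Φ (t + (Z + j * Z)) ∎
    where
    open ≤-Reasoning
    e : t + (Z + j * Z) ≡ t + j * Z + Z
    e = trans (cong (t +_) (+-comm Z (j * Z))) (sym (+-assoc t (j * Z) Z))
    le′ = subst (_≤ U) e le

  -- First-order expansion of Φ around t: raising t costs a factor 1 + 2A/K₂ and
  -- lowering it gains a factor 1 − 2B/K₁.
  Φ-change : ∀ {c K₂ t t′ A B} → 2 * A ≤ c → 2 * B ≤ c → K₂ + c ≡ suc Z → t + c ≤ U →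
    t′ + 2 * B ≡ t + 2 * A →
    (Z + c) * K₂ * Φ t′ + 2 * B * K₂ * Φ t ≤ (Z + c) * K₂ * Φ t + 2 * A * (Z + c) * Φ t
  Φ-change {c} {K₂} {t} {t′} {A} {B} Ac Bc K₂c tU eq with m≤n⇒∃[o]m+o≡n Bc
  -- The slack `o` of 2B ≤ c is put into the base `Z + o`, so that the denominator becomes Z + c for
  -- every `B`; only then can the inequalities of all transpositions be added. The mixed term 4AB of
  -- the product has the favourable sign and is dropped.
  ... | o , refl = begin
    (Z + (2 * B + o)) * K₂ * Φ t′ + 2 * B * K₂ * Φ t ≡⟨ c1 Z B o K₂ (Φ t′) (Φ t) ⟩
    K₂ * (((Z + o) + 2 * B) * Φ t′) + 2 * B * K₂ * Φ t ≤⟨ +-monoˡ-≤ _ (*-monoʳ-≤ K₂ (Φ-down t′ (Z + o) (2 * B) (m≤m+n Z o) (≤-trans (≤-reflexive eq) tA))) ⟩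
    K₂ * ((Z + o) * Φ (t′ + 2 * B)) + 2 * B * K₂ * Φ t ≡⟨ cong (λ z → K₂ * ((Z + o) * Φ z) + 2 * B * K₂ * Φ t) eq ⟩
    K₂ * ((Z + o) * Φ (t + 2 * A)) + 2 * B * K₂ * Φ t ≡⟨ cong (_+ 2 * B * K₂ * Φ t) (c2 K₂ (Z + o) _) ⟩
    (Z + o) * (K₂ * Φ (t + 2 * A)) + 2 * B * K₂ * Φ t ≤⟨ +-monoˡ-≤ _ (*-monoʳ-≤ (Z + o) (Φ-up {K₂} t (2 * A) (≤-trans (+-monoʳ-≤ K₂ Ac) (≤-reflexive K₂c)) tA)) ⟩
    (Z + o) * ((K₂ + 2 * A) * Φ t) + 2 * B * K₂ * Φ t ≤⟨ m≤m+n _ (2 * A * (2 * B) * Φ t) ⟩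
    (Z + o) * ((K₂ + 2 * A) * Φ t) + 2 * B * K₂ * Φ t + 2 * A * (2 * B) * Φ t ≡⟨ c3 Z o K₂ A B (Φ t) ⟩
    (Z + (2 * B + o)) * K₂ * Φ t + 2 * A * (Z + (2 * B + o)) * Φ t ∎
    where
    open ≤-Reasoning
    tA = ≤-trans (+-monoʳ-≤ t Ac) tU
    c1 : ∀ z b o k p q → (z + (2 * b + o)) * k * p + 2 * b * k * q ≡ k * (((z + o) + 2 * b) * p) + 2 * b * k * q
    c1 = solve-∀
    c2 : ∀ a b c → a * (b * c) ≡ b * (a * c)
    c2 = solve-∀
    c3 : ∀ z o k a b p → (z + o) * ((k + 2 * a) * p) + 2 * b * k * p + 2 * a * (2 * b) * p ≡ (z + (2 * b + o)) * k * p + 2 * a * (z + (2 * b + o)) * p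
    c3 = solve-∀

-- A permutation minimising Σ_q Φ(overlap of S_q with h) against all transpositions has all overlaps
-- close to the average value: a random transposition decreases a large overlap by more than it increases it.
module SmallOverlap {n : ℕ} (h : Fin n → Fin n → ℕ) (h-sym : ∀ u v → h u v ≡ h v u) (h-diag : ∀ u → h u u ≡ 0) (h≤1 : ∀ u v → h u v ≤ 1)
  (d : ℕ) (h-deg : ∀ u → ∑ (allFin n) (h u) ≤ d)
  (S : Fin n → Fin n → Fin n → ℕ) (S-sym : ∀ q u v → S q u v ≡ S q v u) (S-diag : ∀ q u → S q u u ≡ 0) (S≤1 : ∀ q u v → S q u v ≤ 1)
  (ρ : ℕ) (S-deg : ∀ q u → ∑ (allFin n) (S q u) ≤ ρ)
  (Z K₂ : ℕ) (0<Z : 0 < Z) (K₂c : K₂ + (4 * ρ + 4) ≡ suc Z)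
  where

  private
    V = allFin n
    c = 4 * ρ + 4
    K₁ = Z + c

  open Overlap h h-sym h-diag

  row≤ρ : ∀ q π x v → row (S q) π x v ≤ ρ
  row≤ρ q π x v = ≤-trans (∑-mono V (λ a → ≤-trans (*-monoʳ-≤ (S q x a) (h≤1 v (π a))) (≤-reflexive (*-identityʳ _)))) (S-deg q x)

  total≤ : ∀ q π → total (S q) π ≤ n * ρ
  total≤ q π = ≤-trans (∑-≤const V ρ (λ u → row≤ρ q π u (π u))) (≤-reflexive (cong (_* ρ) (length-allFin n)))

  -- Each of the at most `ρ` neighbours `a` of `x` conflicts with at most `d` targets `π y`. So a
  -- random target costs `x` about ρd/n, the value to which overlaps are drawn.
  ∑∑-row : ∀ q (π : Permutation′ n) → ∑ V (λ x → ∑ V (λ y → row (S q) (π ⟨$⟩ʳ_) x (π ⟨$⟩ʳ y))) ≤ n * (ρ * d)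
  ∑∑-row q π = ≤-trans (∑-≤const V (ρ * d) λ x → begin
      ∑ V (λ y → ∑ V (λ a → S q x a * h (p y) (p a))) ≡⟨ ∑-swap V V _ ⟩
      ∑ V (λ a → ∑ V (λ y → S q x a * h (p y) (p a))) ≡⟨ ∑-cong V (λ a → ∑-*ˡ V (S q x a) _) ⟩
      ∑ V (λ a → S q x a * ∑ V (λ y → h (p y) (p a))) ≤⟨ ∑-mono V (λ a → *-monoʳ-≤ (S q x a) (≤-trans (≤-reflexive (trans (∑-cong V (λ y → h-sym (p y) (p a))) (∑-perm π (h (p a))))) (h-deg (p a)))) ⟩
      ∑ V (λ a → S q x a * d) ≡⟨ ∑-*ʳ V d (S q x) ⟩
      ∑ V (S q x) * d ≤⟨ *-monoˡ-≤ d (S-deg q x) ⟩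
      ρ * d ∎) (≤-reflexive (cong (_* (ρ * d)) (length-allFin n)))
    where
    open ≤-Reasoning
    p = π ⟨$⟩ʳ_

  module _ (T₀ j : ℕ)
    (T₀-large : K₁ * (n * (ρ * d) + T₀) ≤ n * K₂ * T₀) (K₁<nK₂ : K₁ < n * K₂)
    (j-large : n * (K₁ * (n * (ρ * d))) < 2 ^ j) where

    private
      m = suc (j * Z)
      -- Large enough for every overlap followed by one change of at most `c`, and also for the
      -- level T₀ + m.
      U = n * ρ + c + T₀ + m
    open Potential Z 0<Z U

    private
      T : Fin n → Permutation′ n → ℕ
      T q π = total (S q) (π ⟨$⟩ʳ_)

      T≤U : ∀ q π → T q π ≤ U
      T≤U q π = ≤-trans (total≤ q _) (≤-trans (m≤m+n (n * ρ) (c + T₀ + m)) (≤-reflexive (e (n * ρ) c T₀ m)))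
        where
        e : ∀ a b c d → a + (b + c + d) ≡ a + b + c + d
        e = solve-∀

      T+c≤U : ∀ q π → T q π + c ≤ U
      T+c≤U q π = ≤-trans (+-monoˡ-≤ c (total≤ q _)) (≤-trans (m≤m+n _ T₀) (m≤m+n _ m))

      F : Permutation′ n → ℕ
      F π = ∑ V (λ q → Φ (T q π))

      A B : Fin n → Permutation′ n → Fin n → Fin n → ℕ
      A q π x y = row (S q) (π ⟨$⟩ʳ_) x (π ⟨$⟩ʳ y) + row (S q) (π ⟨$⟩ʳ_) y (π ⟨$⟩ʳ x) + 2 * (S q x y * h (π ⟨$⟩ʳ x) (π ⟨$⟩ʳ y))
      B q π x y = row (S q) (π ⟨$⟩ʳ_) x (π ⟨$⟩ʳ x) + row (S q) (π ⟨$⟩ʳ_) y (π ⟨$⟩ʳ y)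

      2A≤c : ∀ q π x y → 2 * A q π x y ≤ c
      2A≤c q π x y = ≤-trans (*-monoʳ-≤ 2 (+-mono-≤ (+-mono-≤ (row≤ρ q _ x _) (row≤ρ q _ y _)) (*-monoʳ-≤ 2 (*-mono-≤ (S≤1 q x y) (h≤1 _ _))))) (≤-reflexive (e ρ))
        where
        e : ∀ ρ → 2 * (ρ + ρ + 2 * (1 * 1)) ≡ 4 * ρ + 4
        e = solve-∀

      2B≤c : ∀ q π x y → 2 * B q π x y ≤ c
      2B≤c q π x y = ≤-trans (*-monoʳ-≤ 2 (+-mono-≤ (row≤ρ q _ x _) (row≤ρ q _ y _))) (≤-trans (≤-reflexive (e ρ)) (m≤m+n _ 4))
        where
        e : ∀ ρ → 2 * (ρ + ρ) ≡ 4 * ρ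
        e = solve-∀

      ∑∑-sum : ∀ (f : Fin n → ℕ) → ∑ V (λ x → ∑ V (λ y → f x + f y)) ≡ 2 * (n * ∑ V f)
      ∑∑-sum f = begin
        ∑ V (λ x → ∑ V (λ y → f x + f y)) ≡⟨ ∑-cong V (λ x → trans (∑-+ V _ f) (cong (_+ ∑ V f) (∑-allFin-const n (f x)))) ⟩
        ∑ V (λ x → n * f x + ∑ V f) ≡⟨ trans (∑-+ V _ _) (cong₂ _+_ (∑-*ˡ V n f) (∑-allFin-const n (∑ V f))) ⟩
        n * ∑ V f + n * ∑ V f ≡⟨ cong (n * ∑ V f +_) (sym (+-identityʳ _)) ⟩
        2 * (n * ∑ V f) ∎
        where open ≡-Reasoning

      ∑∑B : ∀ q π → ∑ V (λ x → ∑ V (B q π x)) ≡ 2 * (n * T q π)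
      ∑∑B q π = ∑∑-sum (λ x → row (S q) (π ⟨$⟩ʳ_) x (π ⟨$⟩ʳ x))

      ∑∑A : ∀ q π → ∑ V (λ x → ∑ V (A q π x)) ≤ 2 * (n * (ρ * d)) + 2 * T q π
      ∑∑A q π = begin
        ∑ V (λ x → ∑ V (A q π x)) ≡⟨ ∑-cong V (λ x → trans (∑-+ V _ _) (cong₂ _+_ (∑-+ V _ _) (∑-*ˡ V 2 _))) ⟩
        ∑ V (λ x → (∑ V (R x) + ∑ V (λ y → R y x)) + 2 * row (S q) (π ⟨$⟩ʳ_) x (π ⟨$⟩ʳ x)) ≡⟨ trans (∑-+ V _ _) (cong₂ _+_ (∑-+ V _ _) (∑-*ˡ V 2 _)) ⟩
        (∑ V (λ x → ∑ V (R x)) + ∑ V (λ x → ∑ V (λ y → R y x))) + 2 * T q π ≡⟨ cong (λ z → (∑ V (λ x → ∑ V (R x)) + z) + 2 * T q π) (∑-swap V V (λ x y → R y x)) ⟩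
        (∑ V (λ x → ∑ V (R x)) + ∑ V (λ x → ∑ V (R x))) + 2 * T q π ≤⟨ +-monoˡ-≤ _ (+-mono-≤ (∑∑-row q π) (∑∑-row q π)) ⟩
        (n * (ρ * d) + n * (ρ * d)) + 2 * T q π ≡⟨ cong (λ z → (n * (ρ * d) + z) + 2 * T q π) (sym (+-identityʳ _)) ⟩
        2 * (n * (ρ * d)) + 2 * T q π ∎
        where
        open ≤-Reasoning
        R : Fin n → Fin n → ℕ
        R x y = row (S q) (π ⟨$⟩ʳ_) x (π ⟨$⟩ʳ y)

      -- The sum of `Φ-change` over all ordered pairs, including the trivial transpositions. Its
      -- coefficients do not depend on `x` and `y`, so only the sums of `A` and `B` enter.
      ∑∑Φ : ∀ q π → K₁ * K₂ * ∑ V (λ x → ∑ V (λ y → Φ (T q (transpose x y ∘ₚ π)))) + 4 * (n * T q π) * K₂ * Φ (T q π)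
                  ≤ K₁ * K₂ * (n * (n * Φ (T q π))) + 4 * (n * (ρ * d) + T q π) * K₁ * Φ (T q π)
      ∑∑Φ q π = begin
        K₁ * K₂ * ∑ V (λ x → ∑ V (λ y → Φ (T q (transpose x y ∘ₚ π)))) + 4 * (n * t) * K₂ * Φ t
          ≡⟨ cong₂ _+_ (sym (trans (∑-cong V (λ x → ∑-*ˡ V (K₁ * K₂) _)) (∑-*ˡ V (K₁ * K₂) _)))
                       (trans (c1 (n * t) K₂ (Φ t)) (trans (cong (λ z → z * (2 * K₂ * Φ t)) (sym (∑∑B q π))) (sym (trans (∑-cong V (λ x → ∑-*ʳ V (2 * K₂ * Φ t) _)) (∑-*ʳ V (2 * K₂ * Φ t) _))))) ⟩
        ∑ V (λ x → ∑ V (λ y → K₁ * K₂ * Φ (T q (transpose x y ∘ₚ π)))) + ∑ V (λ x → ∑ V (λ y → B q π x y * (2 * K₂ * Φ t)))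
          ≡⟨ trans (sym (∑-+ V _ _)) (∑-cong V (λ x → sym (∑-+ V _ _))) ⟩
        ∑ V (λ x → ∑ V (λ y → K₁ * K₂ * Φ (T q (transpose x y ∘ₚ π)) + B q π x y * (2 * K₂ * Φ t)))
          ≤⟨ ∑-mono V (λ x → ∑-mono V (λ y → ≤-trans (≤-reflexive (cong (K₁ * K₂ * Φ (T q (transpose x y ∘ₚ π)) +_) (c2 (B q π x y) K₂ (Φ t))))
              (≤-trans (Φ-change {t = T q π} {t′ = T q (transpose x y ∘ₚ π)} {A = A q π x y} {B = B q π x y} (2A≤c q π x y) (2B≤c q π x y) K₂c (T+c≤U q π) (total-transpose (S q) (S-sym q) (S-diag q) (π ⟨$⟩ʳ_) x y))
                (≤-reflexive (cong (K₁ * K₂ * Φ t +_) (sym (c2 (A q π x y) K₁ (Φ t)))))))) ⟩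
        ∑ V (λ x → ∑ V (λ y → K₁ * K₂ * Φ t + A q π x y * (2 * K₁ * Φ t)))
          ≡⟨ trans (∑-cong V (λ x → ∑-+ V _ _)) (∑-+ V _ _) ⟩
        ∑ V (λ x → ∑ V (λ y → K₁ * K₂ * Φ t)) + ∑ V (λ x → ∑ V (λ y → A q π x y * (2 * K₁ * Φ t)))
          ≡⟨ cong₂ _+_ (trans (∑-cong V (λ x → ∑-allFin-const n _)) (trans (∑-allFin-const n _) (c3 n (K₁ * K₂) (Φ t))))
                       (trans (∑-cong V (λ x → ∑-*ʳ V (2 * K₁ * Φ t) _)) (∑-*ʳ V (2 * K₁ * Φ t) _)) ⟩
        K₁ * K₂ * (n * (n * Φ t)) + ∑ V (λ x → ∑ V (A q π x)) * (2 * K₁ * Φ t)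
          ≤⟨ +-monoʳ-≤ (K₁ * K₂ * (n * (n * Φ t))) (*-monoˡ-≤ (2 * K₁ * Φ t) (∑∑A q π)) ⟩
        K₁ * K₂ * (n * (n * Φ t)) + (2 * (n * (ρ * d)) + 2 * t) * (2 * K₁ * Φ t)
          ≡⟨ cong (K₁ * K₂ * (n * (n * Φ t)) +_) (c4 (n * (ρ * d)) t K₁ (Φ t)) ⟩
        K₁ * K₂ * (n * (n * Φ t)) + 4 * (n * (ρ * d) + t) * K₁ * Φ t ∎
        where
        open ≤-Reasoning
        t = T q π
        c1 : ∀ a k p → 4 * a * k * p ≡ 2 * a * (2 * k * p)
        c1 = solve-∀
        c2 : ∀ b k p → b * (2 * k * p) ≡ 2 * b * k * p
        c2 = solve-∀
        c3 : ∀ n k p → n * (n * (k * p)) ≡ k * (n * (n * p))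
        c3 = solve-∀
        c4 : ∀ a t k p → (2 * a + 2 * t) * (2 * k * p) ≡ 4 * (a + t) * k * p
        c4 = solve-∀

    -- In `drift`, a vertex with overlap above `T₀` pushes the left side up by at least its excess
    -- times its potential, and a vertex below `T₀` pushes the right side up by at most `X`. Between
    -- `T₀` and `T₀ + j * Z` the potential doubles `j` times, so one vertex at T₀ + m would outweigh
    -- `n` copies of `X`.
    small-overlap : Σ (Permutation′ n) λ π → ∀ q → total (S q) (π ⟨$⟩ʳ_) < T₀ + m
    small-overlap with local-min F
    ... | π , min = π , λ q* → ≰⇒> λ big → <⇒≱ (exceeds q* big) (bound q* big)
      where
      open ≤-Reasoning
      N = n * (ρ * d)
      Φq : Fin n → ℕ
      Φq q = Φ (T q π)
      -- By local minimality the n² transposed placements have potential at least `F π` on average,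
      -- so the zeroth-order terms cancel. What remains compares the gain from the conflicts
      -- removed, on the left, with the cost of those created, on the right.
      drift : ∑ V (λ q → n * T q π * K₂ * Φq q) ≤ ∑ V (λ q → (N + T q π) * K₁ * Φq q)
      drift = *-cancelˡ-≤ 4 (+-cancelˡ-≤ (K₁ * K₂ * (n * (n * F π))) _ _ (begin
        K₁ * K₂ * (n * (n * F π)) + 4 * ∑ V (λ q → n * T q π * K₂ * Φq q)
          ≤⟨ +-monoˡ-≤ _ (*-monoʳ-≤ (K₁ * K₂) avg) ⟩
        K₁ * K₂ * ∑ V (λ q → ∑ V (λ x → ∑ V (λ y → Φ (T q (transpose x y ∘ₚ π))))) + 4 * ∑ V (λ q → n * T q π * K₂ * Φq q)
          ≡⟨ trans (cong₂ _+_ (sym (∑-*ˡ V (K₁ * K₂) _)) (sym (∑-*ˡ V 4 _))) (sym (∑-+ V _ _)) ⟩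
        ∑ V (λ q → K₁ * K₂ * ∑ V (λ x → ∑ V (λ y → Φ (T q (transpose x y ∘ₚ π)))) + 4 * (n * T q π * K₂ * Φq q))
          ≤⟨ ∑-mono V (λ q → ≤-trans (≤-reflexive (cong (K₁ * K₂ * ∑ V (λ x → ∑ V (λ y → Φ (T q (transpose x y ∘ₚ π)))) +_) (c1 (n * T q π) K₂ (Φq q))))
               (≤-trans (∑∑Φ q π) (≤-reflexive (cong (K₁ * K₂ * (n * (n * Φq q)) +_) (sym (c1 (N + T q π) K₁ (Φq q))))))) ⟩
        ∑ V (λ q → K₁ * K₂ * (n * (n * Φq q)) + 4 * ((N + T q π) * K₁ * Φq q))
          ≡⟨ trans (∑-+ V _ _) (cong₂ _+_ (trans (∑-*ˡ V (K₁ * K₂) _) (cong (K₁ * K₂ *_) (trans (∑-*ˡ V n _) (cong (n *_) (∑-*ˡ V n Φq))))) (∑-*ˡ V 4 _)) ⟩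
        K₁ * K₂ * (n * (n * F π)) + 4 * ∑ V (λ q → (N + T q π) * K₁ * Φq q) ∎))
        where
        c1 : ∀ a k p → 4 * (a * k * p) ≡ 4 * a * k * p
        c1 = solve-∀
        avg : n * (n * F π) ≤ ∑ V (λ q → ∑ V (λ x → ∑ V (λ y → Φ (T q (transpose x y ∘ₚ π)))))
        avg = begin
          n * (n * F π) ≡⟨ trans (∑-cong V (λ _ → ∑-allFin-const n (F π))) (∑-allFin-const n (n * F π)) ⟨
          ∑ V (λ x → ∑ V (λ y → F π)) ≤⟨ ∑-mono V (λ x → ∑-mono V (λ y → min x y)) ⟩
          ∑ V (λ x → ∑ V (λ y → F (transpose x y ∘ₚ π))) ≡⟨ ∑-cong V (λ x → ∑-swap V V _) ⟩
          ∑ V (λ x → ∑ V (λ q → ∑ V (λ y → Φ (T q (transpose x y ∘ₚ π))))) ≡⟨ ∑-swap V V _ ⟩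
          ∑ V (λ q → ∑ V (λ x → ∑ V (λ y → Φ (T q (transpose x y ∘ₚ π))))) ∎

      X = K₁ * N * Φ T₀
      module _ (q* : Fin n) (big : T₀ + m ≤ T q* π) where
        weight : Fin n → ℕ
        weight q = 𝟙 (q F.≟ q*) * (m * Φq q)
        bound : m * Φq q* ≤ n * X
        bound = +-cancelˡ-≤ (∑ V (λ q → (N + T q π) * K₁ * Φq q)) _ _ (begin
          ∑ V (λ q → (N + T q π) * K₁ * Φq q) + m * Φq q* ≡⟨ cong (∑ V (λ q → (N + T q π) * K₁ * Φq q) +_) (sym (∑-point q* (λ q → m * Φq q))) ⟩
          ∑ V (λ q → (N + T q π) * K₁ * Φq q) + ∑ V weight ≡⟨ sym (∑-+ V _ weight) ⟩
          ∑ V (λ q → (N + T q π) * K₁ * Φq q + weight q) ≤⟨ ∑-mono V pointwise ⟩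
          ∑ V (λ q → n * T q π * K₂ * Φq q + X) ≡⟨ trans (∑-+ V _ _) (cong (∑ V (λ q → n * T q π * K₂ * Φq q) +_) (∑-allFin-const n X)) ⟩
          ∑ V (λ q → n * T q π * K₂ * Φq q) + n * X ≤⟨ +-monoˡ-≤ (n * X) drift ⟩
          ∑ V (λ q → (N + T q π) * K₁ * Φq q) + n * X ∎)
          where
          pointwise : ∀ q → (N + T q π) * K₁ * Φq q + weight q ≤ n * T q π * K₂ * Φq q + X
          pointwise q with T₀ ≤? T q π
          ... | yes T₀≤t with m≤n⇒∃[o]m+o≡n T₀≤t
          ...   | e , eq = ≤-trans (+-monoʳ-≤ ((N + T q π) * K₁ * Φq q) w≤) (≤-trans
              (≤-reflexive (trans (sym (*-distribʳ-+ (Φq q) ((N + T q π) * K₁) e)) (cong (λ z → ((N + z) * K₁ + e) * Φq q) (sym eq))))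
              (≤-trans (*-monoˡ-≤ (Φq q) main) (≤-trans (≤-reflexive (cong (λ z → n * z * K₂ * Φq q) eq)) (m≤m+n _ X))))
            where
            w≤ : weight q ≤ e * Φq q
            w≤ with q F.≟ q*
            ... | no _ = z≤n
            ... | yes refl = ≤-trans (≤-reflexive (+-identityʳ _)) (*-monoˡ-≤ (Φq q) (+-cancelˡ-≤ T₀ m e (subst (T₀ + m ≤_) (sym eq) big)))
            -- The level `T₀` is balanced by `T₀-large`. Each unit of excess costs K₁ and gains nK₂,
            -- and strictness of K₁ < nK₂ leaves one unit over, which is the added `e`.
            main : (N + (T₀ + e)) * K₁ + e ≤ n * (T₀ + e) * K₂
            main = begin
              (N + (T₀ + e)) * K₁ + e ≡⟨ c1 N T₀ e K₁ ⟩
              K₁ * (N + T₀) + suc K₁ * e ≤⟨ +-mono-≤ T₀-large (*-monoˡ-≤ e K₁<nK₂) ⟩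
              n * K₂ * T₀ + n * K₂ * e ≡⟨ c2 n K₂ T₀ e ⟩
              n * (T₀ + e) * K₂ ∎
              where
              c1 : ∀ N t e k → (N + (t + e)) * k + e ≡ k * (N + t) + (1 + k) * e
              c1 = solve-∀
              c2 : ∀ n k t e → n * k * t + n * k * e ≡ n * (t + e) * k
              c2 = solve-∀
          pointwise q | no T₀≰t = begin
              (N + T q π) * K₁ * Φq q + weight q ≡⟨ cong ((N + T q π) * K₁ * Φq q +_) (cong (_* (m * Φq q)) (𝟙-no (q F.≟ q*) (λ { refl → T₀≰t (≤-trans (m≤m+n T₀ m) big) }))) ⟩
              (N + T q π) * K₁ * Φq q + 0 ≡⟨ c1 N (T q π) K₁ (Φq q) ⟩
              K₁ * T q π * Φq q + K₁ * N * Φq q ≤⟨ +-mono-≤ (*-monoˡ-≤ (Φq q) (*-monoˡ-≤ (T q π) (<⇒≤ K₁<nK₂))) (*-monoʳ-≤ (K₁ * N) (Φ-mono (<⇒≤ (≰⇒> T₀≰t)) T₀≤U)) ⟩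
              n * K₂ * T q π * Φq q + X ≡⟨ cong (_+ X) (c2 n K₂ (T q π) (Φq q)) ⟩
              n * T q π * K₂ * Φq q + X ∎
            where
            c1 : ∀ N t k p → (N + t) * k * p + 0 ≡ k * t * p + k * N * p
            c1 = solve-∀
            c2 : ∀ n k t p → n * k * t * p ≡ n * t * k * p
            c2 = solve-∀
            T₀≤U : T₀ ≤ U
            T₀≤U = ≤-trans (m≤n+m T₀ (n * ρ + c)) (m≤m+n _ m)
        T₀m≤U : T₀ + m ≤ U
        T₀m≤U = ≤-trans (m≤n+m (T₀ + m) (n * ρ + c)) (≤-reflexive (sym (+-assoc (n * ρ + c) T₀ m)))
        T₀jZ≤ : T₀ + j * Z ≤ T₀ + m
        T₀jZ≤ = +-monoʳ-≤ T₀ (n≤1+n (j * Z))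
        0<Φ : NonZero (Φ T₀)
        0<Φ = m*n≢0 (suc Z ^ T₀) (Z ^ (U ∸ T₀)) {{m^n≢0 (suc Z) T₀}} {{m^n≢0 Z (U ∸ T₀) {{>-nonZero 0<Z}}}}
        exceeds : n * X < m * Φq q*
        exceeds = begin-strict
          n * X ≡⟨ *-assoc n (K₁ * N) (Φ T₀) ⟨
          n * (K₁ * N) * Φ T₀ <⟨ *-monoˡ-< (Φ T₀) {{0<Φ}} j-large ⟩
          2 ^ j * Φ T₀ ≤⟨ Φ-exp T₀ j (≤-trans T₀jZ≤ T₀m≤U) ⟩
          Φ (T₀ + j * Z) ≤⟨ Φ-mono (≤-trans T₀jZ≤ big) (T≤U q* π) ⟩
          Φq q* ≤⟨ m≤n*m (Φq q*) m ⟩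
          m * Φq q* ∎

-- Packings of complete graphs

-- Empty blocks are placeholders: they cover nothing.
record Packing (r n : ℕ) : Set where
  field
    #blocks  : ℕ
    block    : Fin #blocks → List (Fin n)
    distinct : ∀ b → Unique (block b)
    size-r   : ∀ b → block b ≡ [] ⊎ length (block b) ≡ r
    linear   : ∀ {b b′ x y} → x ≢ y → x ∈ block b → y ∈ block b → x ∈ block b′ → y ∈ block b′ → b ≡ b′

  Covers : Fin #blocks → Fin n → Fin n → Set
  Covers b x y = x ∈ block b × y ∈ block b

  Covered : Fin n → Fin n → Set
  Covered x y = ∃ λ b → Covers b x y

  covered? : ∀ x y → Dec (Covered x y)
  covered? x y = F.any? (λ b → Any.any? (x F.≟_) (block b) ×-dec Any.any? (y F.≟_) (block b))

  covered-sym : ∀ {x y} → Covered x y → Covered y x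
  covered-sym (b , p , q) = b , q , p

  length-block : ∀ b → length (block b) ≤ r
  length-block b with size-r b
  ... | inj₁ e rewrite e = z≤n
  ... | inj₂ e = ≤-reflexive e

  Leftover : ℕ → Set
  Leftover l = ∀ x → Σ (List (Fin n)) λ us → length us ≤ l × (∀ y → y ≢ x → Covered x y ⊎ y ∈ us)

module AlmostDecomposition where
  open Packing

  empty-packing : ∀ r n → Packing r n
  empty-packing r n = record
    { #blocks = 0 ; block = λ () ; distinct = λ () ; size-r = λ () ; linear = λ { {()} } }

  empty-leftover : ∀ r n → Leftover (empty-packing r n) n
  empty-leftover r n x = allFin n , ≤-reflexive (length-allFin n) , λ y _ → inj₂ (∈-allFin y)

  module Lower (n e : ℕ) where

    lower : List (Fin (n + e)) → List (Fin n)
    lower [] = []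
    lower (x ∷ xs) with splitAt n x
    ... | inj₁ y = y ∷ lower xs
    ... | inj₂ _ = lower xs

    length-lower : ∀ xs → length (lower xs) ≤ length xs
    length-lower [] = z≤n
    length-lower (x ∷ xs) with splitAt n x
    ... | inj₁ y = s≤s (length-lower xs)
    ... | inj₂ _ = m≤n⇒m≤1+n (length-lower xs)

    ∈-lower : ∀ {y xs} → y ↑ˡ e ∈ xs → y ∈ lower xs
    ∈-lower {y} {x ∷ xs} (here refl) rewrite F.splitAt-↑ˡ n y e = here refl
    ∈-lower {y} {x ∷ xs} (there p) with splitAt n x
    ... | inj₁ _ = there (∈-lower p)
    ... | inj₂ _ = ∈-lower p

    all-low? : ∀ xs → (Σ (List (Fin n)) λ ys → xs ≡ map (_↑ˡ e) ys) ⊎ (∃ λ z → n ↑ʳ z ∈ xs)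
    all-low? [] = inj₁ ([] , refl)
    all-low? (x ∷ xs) with splitAt n x in eq
    ... | inj₂ z = inj₂ (z , here (trans (cong (F.join n e) (sym eq)) (F.join-splitAt n e x)))
    ... | inj₁ y with all-low? xs
    ...   | inj₂ (z , z∈) = inj₂ (z , there z∈)
    ...   | inj₁ (ys , e′) = inj₁ (y ∷ ys , cong₂ _∷_ (trans (sym (F.join-splitAt n e x)) (cong (F.join n e) eq)) e′)

    -- A block that meets the last `e` points is emptied rather than shortened, so nonempty blocks
    -- keep their size.
    low-part : List (Fin (n + e)) → List (Fin n)
    low-part xs = [ proj₁ , const [] ] (all-low? xs)

    low-part-spec : ∀ xs → low-part xs ≡ [] ⊎ xs ≡ map (_↑ˡ e) (low-part xs)
    low-part-spec xs with all-low? xs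
    ... | inj₁ (ys , eq) = inj₂ eq
    ... | inj₂ _ = inj₁ refl

    low-part-∈ : ∀ {y} xs → y ∈ low-part xs → y ↑ˡ e ∈ xs
    low-part-∈ {y} xs p with all-low? xs
    ... | inj₁ (ys , refl) = ∈-map⁺ (_↑ˡ e) p

    ∈-low-part : ∀ {y} xs → y ↑ˡ e ∈ xs → y ∈ low-part xs ⊎ (∃ λ z → n ↑ʳ z ∈ xs)
    ∈-low-part {y} xs p with all-low? xs
    ... | inj₂ h = inj₂ h
    ... | inj₁ (ys , refl) with ∈-map⁻ (_↑ˡ e) p
    ...   | y′ , q , eq = inj₁ (subst (_∈ ys) (sym (F.↑ˡ-injective e y y′ eq)) q)

  module _ {r : ℕ} (n e : ℕ) where
    open Lower n e

    restrict : Packing r (n + e) → Packing r n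
    restrict P = record
      { #blocks = #blocks P ; block = λ b → low-part (block P b) ; distinct = dis ; size-r = siz
      ; linear = λ {b} {b′} ne p q p′ q′ → linear P (ne ∘ F.↑ˡ-injective e _ _) (low-part-∈ (block P b) p) (low-part-∈ (block P b) q) (low-part-∈ (block P b′) p′) (low-part-∈ (block P b′) q′) }
      where
      dis : ∀ b → Unique (low-part (block P b))
      dis b with low-part-spec (block P b)
      ... | inj₁ eq = subst Unique (sym eq) []
      ... | inj₂ eq = Unique.map⁻ (subst Unique eq (distinct P b))
      siz : ∀ b → low-part (block P b) ≡ [] ⊎ length (low-part (block P b)) ≡ r
      siz b with low-part-spec (block P b) | size-r P b
      ... | inj₁ eq | _ = inj₁ eq
      ... | inj₂ eq | inj₂ l = inj₂ (trans (sym (L.length-map {A = Fin n} {B = Fin (n + e)} (_↑ˡ e) (low-part (block P b)))) (trans (cong length (sym eq)) l))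
      ... | inj₂ eq | inj₁ l = inj₁ (map-[] (trans (sym eq) l))
        where
        map-[] : ∀ {ys : List (Fin n)} → map (_↑ˡ e) ys ≡ [] → ys ≡ []
        map-[] {[]} _ = refl

    -- By linearity at most one block passes through `x` and a given deleted point, so emptying
    -- blocks costs `x` at most `r` partners per deleted point.
    restrict-leftover : ∀ (P : Packing r (n + e)) {l} → Leftover P l → Leftover (restrict P) (l + e * r)
    restrict-leftover P {l} left x = us′ , len , cov
      where
      us = proj₁ (left (x ↑ˡ e))
      through : Fin e → List (Fin n)
      through z with covered? P (x ↑ˡ e) (n ↑ʳ z)
      ... | yes (b , _) = lower (block P b)
      ... | no _ = []
      us′ = lower us ++ concatMap through (allFin e)
      through-length : ∀ z → length (through z) ≤ r
      through-length z with covered? P (x ↑ˡ e) (n ↑ʳ z)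
      ... | yes (b , _) = ≤-trans (length-lower (block P b)) (length-block P b)
      ... | no _ = z≤n
      len : length us′ ≤ l + e * r
      len = begin
        length us′ ≡⟨ L.length-++ (lower us) ⟩
        length (lower us) + length (concatMap through (allFin e)) ≡⟨ cong (length (lower us) +_) (length-concatMap through (allFin e)) ⟩
        length (lower us) + ∑ (allFin e) (length ∘ through) ≤⟨ +-mono-≤ (≤-trans (length-lower us) (proj₁ (proj₂ (left (x ↑ˡ e))))) (∑-≤const (allFin e) r through-length) ⟩
        l + length (allFin e) * r ≡⟨ cong (λ z → l + z * r) (length-allFin e) ⟩
        l + e * r ∎
        where open ≤-Reasoning
      high≢low : ∀ z → n ↑ʳ z ≢ x ↑ˡ e
      high≢low z eq with trans (sym (F.splitAt-↑ʳ n e z)) (trans (cong (splitAt n) eq) (F.splitAt-↑ˡ n x e))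
      ... | ()
      cov : ∀ y → y ≢ x → Covered (restrict P) x y ⊎ y ∈ us′
      cov y y≢x with proj₂ (proj₂ (left (x ↑ˡ e))) (y ↑ˡ e) (y≢x ∘ F.↑ˡ-injective e y x)
      ... | inj₂ y∈us = inj₂ (∈-++⁺ˡ (∈-lower y∈us))
      ... | inj₁ (b , x∈b , y∈b) with ∈-low-part (block P b) x∈b | ∈-low-part (block P b) y∈b
      ...   | inj₁ p | inj₁ q = inj₁ (b , p , q)
      ...   | inj₁ _ | inj₂ (z , z∈b) = inj₂ (∈-++⁺ʳ (lower us) (∈-concatMap through (∈-allFin z) hit))
        where
        hit : y ∈ through z
        hit with covered? P (x ↑ˡ e) (n ↑ʳ z)
        ... | no ¬c = contradiction (b , x∈b , z∈b) ¬c
        ... | yes (b′ , x∈b′ , z∈b′) = ∈-lower (subst (λ b → y ↑ˡ e ∈ block P b) (linear P (high≢low z ∘ sym) x∈b z∈b x∈b′ z∈b′) y∈b)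
      ...   | inj₂ (z , z∈b) | _ = inj₂ (∈-++⁺ʳ (lower us) (∈-concatMap through (∈-allFin z) hit))
        where
        hit : y ∈ through z
        hit with covered? P (x ↑ˡ e) (n ↑ʳ z)
        ... | no ¬c = contradiction (b , x∈b , z∈b) ¬c
        ... | yes (b′ , x∈b′ , z∈b′) = ∈-lower (subst (λ b → y ↑ˡ e ∈ block P b) (linear P (high≢low z ∘ sym) x∈b z∈b x∈b′ z∈b′) y∈b)

  -- r copies of a packing on p points, joined by the transversal design whose blocks are the lines i ↦ a i + b.
  module _ {r p : ℕ} (line : Fin p → Fin p → Fin r → Fin p)
    (line-unique : ∀ {a b a′ b′ i j} → i ≢ j → line a b i ≡ line a′ b′ i → line a b j ≡ line a′ b′ j → a ≡ a′ × b ≡ b′)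
    (line-exists : ∀ {i j} → i ≢ j → ∀ x y → Σ (Fin p) λ a → Σ (Fin p) λ b → line a b i ≡ x × line a b j ≡ y)
    (P : Packing r p) where
    private
      Index : Set
      Index = (Fin r × Fin (#blocks P)) ⊎ (Fin p × Fin p)

      #I = r * #blocks P + p * p

      decode↔ : Fin #I ↔ Index
      decode↔ = (F.*↔× {r} {#blocks P} ⊎-↔ F.*↔× {p} {p}) ↔-∘ F.+↔⊎ {r * #blocks P} {p * p}

      decode : Fin #I → Index
      decode = Inverse.to decode↔

      encode : Index → Fin #I
      encode = Inverse.from decode↔

      decode-encode : ∀ i → decode (encode i) ≡ i
      decode-encode i = Inverse.inverseˡ decode↔ refl

      decode-injective : ∀ {b b′} → decode b ≡ decode b′ → b ≡ b′
      decode-injective {b} {b′} eq = trans (sym (Inverse.inverseʳ decode↔ refl)) (trans (cong encode eq) (Inverse.inverseʳ decode↔ refl))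

      point : Fin p → Fin p → Fin r → Fin (r * p)
      point a b i = combine i (line a b i)

      blk : Index → List (Fin (r * p))
      blk (inj₁ (c , b)) = map (combine c) (block P b)
      blk (inj₂ (a , b)) = map (point a b) (allFin r)

      combine-injʳ : ∀ (c : Fin r) {x y : Fin p} → combine c x ≡ combine c y → x ≡ y
      combine-injʳ c {x} {y} = F.combine-injectiveʳ c x c y

      dis : ∀ i → Unique (blk i)
      dis (inj₁ (c , b)) = Unique.map⁺ (combine-injʳ c) (distinct P b)
      dis (inj₂ (a , b)) = Unique.map⁺ (λ {i} {j} → F.combine-injectiveˡ i _ j _) (Unique.allFin⁺ r)

      siz : ∀ i → blk i ≡ [] ⊎ length (blk i) ≡ r
      siz (inj₁ (c , b)) with size-r P b
      ... | inj₁ eq rewrite eq = inj₁ refl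
      ... | inj₂ eq = inj₂ (trans (L.length-map (combine {r} c) (block P b)) eq)
      siz (inj₂ (a , b)) = inj₂ (trans (L.length-map (point a b) (allFin r)) (length-allFin r))

      copy∩line : ∀ {c b a b′ x y} → x ≢ y → x ∈ blk (inj₁ (c , b)) → y ∈ blk (inj₁ (c , b)) → x ∈ blk (inj₂ (a , b′)) → y ∈ blk (inj₂ (a , b′)) → ⊥
      copy∩line {c} {b} {a} {b′} ne p q p′ q′ with ∈-map⁻ (combine c) p | ∈-map⁻ (combine c) q | ∈-map⁻ (point a b′) p′ | ∈-map⁻ (point a b′) q′
      ... | x₁ , _ , refl | y₁ , _ , refl | i , _ , e | j , _ , e′ =
        ne (trans e (trans (cong (point a b′) (trans (sym (F.combine-injectiveˡ c x₁ i _ e)) (F.combine-injectiveˡ c y₁ j _ e′))) (sym e′)))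

      lin : ∀ i i′ {x y} → x ≢ y → x ∈ blk i → y ∈ blk i → x ∈ blk i′ → y ∈ blk i′ → i ≡ i′
      lin (inj₁ (c , b)) (inj₁ (c′ , b′)) ne p q p′ q′ with ∈-map⁻ (combine c) p | ∈-map⁻ (combine c) q | ∈-map⁻ (combine c′) p′ | ∈-map⁻ (combine c′) q′
      ... | x₁ , x₁∈ , refl | y₁ , y₁∈ , refl | x₂ , x₂∈ , e | y₂ , y₂∈ , e′ with F.combine-injective c x₁ c′ x₂ e | F.combine-injective c y₁ c′ y₂ e′
      ... | refl , refl | _ , refl = cong (λ b → inj₁ (c , b)) (linear P (ne ∘ cong (combine c)) x₁∈ y₁∈ x₂∈ y₂∈)
      lin (inj₁ _) (inj₂ _) ne p q p′ q′ = ⊥-elim (copy∩line ne p q p′ q′)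
      lin (inj₂ _) (inj₁ _) ne p q p′ q′ = ⊥-elim (copy∩line ne p′ q′ p q)
      lin (inj₂ (a , b)) (inj₂ (a′ , b′)) ne p q p′ q′ with ∈-map⁻ (point a b) p | ∈-map⁻ (point a b) q | ∈-map⁻ (point a′ b′) p′ | ∈-map⁻ (point a′ b′) q′
      ... | i , _ , refl | j , _ , refl | i′ , _ , e | j′ , _ , e′ with F.combine-injective i (line a b i) i′ (line a′ b′ i′) e | F.combine-injective j (line a b j) j′ (line a′ b′ j′) e′
      ... | refl , ei | refl , ej with line-unique (ne ∘ cong (point a b)) ei ej
      ...   | refl , refl = refl

    joined : Packing r (r * p)
    joined = record
      { #blocks = #I ; block = blk ∘ decode ; distinct = dis ∘ decode ; size-r = siz ∘ decode
      ; linear = λ {b} {b′} ne p q p′ q′ → decode-injective (lin (decode b) (decode b′) ne p q p′ q′) }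

    -- Points of different copies always share a line, so a point misses only partners inside its
    -- own copy: the order grows by the factor `r` while the leftover stays the same.
    joined-leftover : ∀ {l} → Leftover P l → Leftover joined l
    joined-leftover {l} left X with F.combine-surjective {r} {p} X
    ... | c , x , refl = map (combine c) (proj₁ (left x)) , ≤-trans (≤-reflexive (L.length-map (combine {r} c) (proj₁ (left x)))) (proj₁ (proj₂ (left x))) , cov
      where
      by : ∀ i {x y} → x ∈ blk i → y ∈ blk i → Covered joined x y
      by i p q = encode i , subst (λ i → _ ∈ blk i) (sym (decode-encode i)) p , subst (λ i → _ ∈ blk i) (sym (decode-encode i)) q
      cov : ∀ Y → Y ≢ combine c x → Covered joined (combine c x) Y ⊎ Y ∈ map (combine c) (proj₁ (left x))
      cov Y ne with F.combine-surjective {r} {p} Y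
      ... | c′ , y , refl with c F.≟ c′
      ... | yes refl with proj₂ (proj₂ (left x)) y (ne ∘ cong (combine c))
      ...   | inj₁ (b , p , q) = inj₁ (by (inj₁ (c , b)) (∈-map⁺ (combine c) p) (∈-map⁺ (combine c) q))
      ...   | inj₂ y∈ = inj₂ (∈-map⁺ (combine c) y∈)
      cov Y ne | c′ , y , refl | no c≢c′ with line-exists c≢c′ x y
      ...   | a , b , ex , ey = inj₁ (by (inj₂ (a , b))
              (subst (λ z → combine c z ∈ map (point a b) (allFin r)) ex (∈-map⁺ (point a b) (∈-allFin c)))
              (subst (λ z → combine c′ z ∈ map (point a b) (allFin r)) ey (∈-map⁺ (point a b) (∈-allFin c′))))

  -- Every level of the recursion divides the leftover fraction by `r`. The constant `C` absorbs the
  -- rounding at all levels and does not depend on `n`.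
  almost-decomposition : ∀ w depth → Σ ℕ λ C → ∀ n →
    Σ (Packing (suc w) n) λ P → Σ ℕ λ l → Leftover P l × l * suc w ^ depth ≤ n + C
  almost-decomposition w zero = 0 , λ n → empty-packing (suc w) n , n , empty-leftover (suc w) n , ≤-reflexive (trans (*-identityʳ n) (sym (+-identityʳ n)))
  almost-decomposition w (suc depth) with almost-decomposition w depth
  ... | C , ih = K + r * C + K * r * r ^ suc depth , step
    where
    r = suc w
    K = r + r * w !
    instance
      nz : NonZero (r * w !)
      nz = m*n≢0 r (w !) {{_}} {{w !≢0}}
    step : ∀ n → Σ (Packing r n) λ P → Σ ℕ λ l → Leftover P l × l * r ^ suc depth ≤ n + (K + r * C + K * r * r ^ suc depth)
    step n = restrict n e P′ , l + e * r , restrict-leftover n e P′ left′ , bound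
      where
      q = n / (r * w !)
      -- The number of points per group has to be 1 modulo `w !`. With `suc q` the order r·p reaches
      -- `n` and exceeds it by at most `K`; the surplus points are deleted by `restrict`.
      open Lines w (suc q) using (p; line; line-unique; line-exists)
      n≤rp : n ≤ r * p
      n≤rp = begin
        n ≡⟨ m≡m%n+[m/n]*n n (r * w !) ⟩
        n % (r * w !) + q * (r * w !) ≤⟨ +-monoˡ-≤ _ (<⇒≤ (m%n<n n (r * w !))) ⟩
        r * w ! + q * (r * w !) ≤⟨ m≤n+m _ r ⟩
        r + (r * w ! + q * (r * w !)) ≡⟨ c1 r (w !) q ⟩
        r * suc (w ! * suc q) ∎
        where
        open ≤-Reasoning
        c1 : ∀ r f q → r + (r * f + q * (r * f)) ≡ r * (1 + f * (1 + q))
        c1 = solve-∀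
      rp≤ : r * p ≤ n + K
      rp≤ = begin
        r * suc (w ! * suc q) ≡⟨ c1 r (w !) q ⟩
        q * (r * w !) + (r + r * w !) ≤⟨ +-monoˡ-≤ K (m/n*n≤m n (r * w !)) ⟩
        n + K ∎
        where
        open ≤-Reasoning
        c1 : ∀ r f q → r * (1 + f * (1 + q)) ≡ q * (r * f) + (r + r * f)
        c1 = solve-∀
      e = proj₁ (m≤n⇒∃[o]m+o≡n n≤rp)
      e≡ : n + e ≡ r * p
      e≡ = proj₂ (m≤n⇒∃[o]m+o≡n n≤rp)
      e≤K : e ≤ K
      e≤K = +-cancelˡ-≤ n e K (subst (_≤ n + K) (sym e≡) rp≤)
      l = proj₁ (proj₂ (ih p))
      transport : ∀ {m m′} (eq : m ≡ m′) (P : Packing r m) → Leftover P l → Σ (Packing r m′) λ P → Leftover P l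
      transport refl P left = P , left
      P′,left = transport (sym e≡) (joined line line-unique line-exists (proj₁ (ih p))) (joined-leftover line line-unique line-exists (proj₁ (ih p)) (proj₁ (proj₂ (proj₂ (ih p)))))
      P′ = proj₁ P′,left
      left′ : Leftover P′ l
      left′ = proj₂ P′,left
      R = r ^ depth
      bound : (l + e * r) * (r * R) ≤ n + (K + r * C + K * r * (r * R))
      bound = begin
        (l + e * r) * (r * R) ≡⟨ c1 l e r R ⟩
        r * (l * R) + e * r * (r * R) ≤⟨ +-mono-≤ (*-monoʳ-≤ r (proj₂ (proj₂ (proj₂ (ih p))))) (*-monoˡ-≤ (r * R) (*-monoˡ-≤ r e≤K)) ⟩
        r * (p + C) + K * r * (r * R) ≡⟨ cong (_+ K * r * (r * R)) (*-distribˡ-+ r p C) ⟩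
        r * p + r * C + K * r * (r * R) ≤⟨ +-monoˡ-≤ _ (+-monoˡ-≤ (r * C) rp≤) ⟩
        n + K + r * C + K * r * (r * R) ≡⟨ c2 n K (r * C) (K * r * (r * R)) ⟩
        n + (K + r * C + K * r * (r * R)) ∎
        where
        open ≤-Reasoning
        c1 : ∀ l e r R → (l + e * r) * (r * R) ≡ r * (l * R) + e * r * (r * R)
        c1 = solve-∀
        c2 : ∀ a b c d → a + b + c + d ≡ a + (b + c + d)
        c2 = solve-∀

open AlmostDecomposition using (almost-decomposition)

-- Packings of dense graphs

others : ∀ {n} → Fin n → List (Fin n) → List (Fin n)
others x = filter (λ y → ¬? (y F.≟ x))

∈-others : ∀ {n} {x y : Fin n} {ys} → y ∈ ys → y ≢ x → y ∈ others x ys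
∈-others {x = x} = ∈-filter⁺ (λ y → ¬? (y F.≟ x))

length-others : ∀ {n} {x : Fin n} {ys} → x ∈ ys → length (others x ys) < length ys
length-others {x = x} x∈ = L.filter-notAll (λ y → ¬? (y F.≟ x)) _ (lose x∈ (λ ¬e → ¬e refl))

module Complement {n : ℕ} (G : Graph n) where

  NonEdge : Fin n → Fin n → Set
  NonEdge u v = u ≢ v × adj G u v ≡ false

  nonEdge? : ∀ u v → Dec (NonEdge u v)
  nonEdge? u v = ¬? (u F.≟ v) ×-dec (adj G u v Bool.≟ false)

  h : Fin n → Fin n → ℕ
  h u v = 𝟙 (nonEdge? u v)

  h-sym : ∀ u v → h u v ≡ h v u
  h-sym u v = 𝟙-cong (nonEdge? u v) (nonEdge? v u) flip flip
    where
    flip : ∀ {u v} → NonEdge u v → NonEdge v u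
    flip (ne , e) = ne ∘ sym , trans (adj-sym G _ _) e

  h-diag : ∀ u → h u u ≡ 0
  h-diag u = 𝟙-no (nonEdge? u u) (λ p → proj₁ p refl)

  h≤1 : ∀ u v → h u v ≤ 1
  h≤1 u v = 𝟙≤1 (nonEdge? u v)

  edge : ∀ {u v} → u ≢ v → ¬ NonEdge u v → Edge G u v
  edge ne ¬p = Bool.¬-not (λ e → ¬p (ne , e))

module Cohabitation {ρ n : ℕ} (P : Packing (suc (suc ρ)) n) where
  open Packing P

  -- The link of `q`: two points are joined when they share a block with `q`. An edge of the link
  -- that lands on a non-edge of `G` spoils a block through `q`, which is why the overlaps of links
  -- are what the placement must keep small.
  Together : Fin n → Fin n → Fin n → Set
  Together q u a = u ≢ a × q ≢ u × q ≢ a × ∃ λ b → q ∈ block b × u ∈ block b × a ∈ block b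

  together? : ∀ q u a → Dec (Together q u a)
  together? q u a = ¬? (u F.≟ a) ×-dec ¬? (q F.≟ u) ×-dec ¬? (q F.≟ a) ×-dec
    F.any? (λ b → Any.any? (q F.≟_) (block b) ×-dec Any.any? (u F.≟_) (block b) ×-dec Any.any? (a F.≟_) (block b))

  S : Fin n → Fin n → Fin n → ℕ
  S q u a = 𝟙 (together? q u a)

  S-sym : ∀ q u v → S q u v ≡ S q v u
  S-sym q u v = 𝟙-cong (together? q u v) (together? q v u) flip flip
    where
    flip : ∀ {u v} → Together q u v → Together q v u
    flip (a , b , c , B , x , y , z) = a ∘ sym , c , b , B , x , z , y

  S-diag : ∀ q u → S q u u ≡ 0
  S-diag q u = 𝟙-no (together? q u u) (λ p → proj₁ p refl)

  S≤1 : ∀ q u v → S q u v ≤ 1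
  S≤1 q u v = 𝟙≤1 (together? q u v)

  -- By linearity all neighbours of `u` in the link lie in the one block through `q` and `u`, which
  -- has `ρ` further points.
  S-deg : ∀ q u → ∑ (allFin n) (S q u) ≤ ρ
  S-deg q u = go (q F.≟ u) (covered? q u)
    where
    none : (∀ a → ¬ Together q u a) → ∑ (allFin n) (S q u) ≤ ρ
    none ¬t = ≤-trans (∑-list (together? q u) [] (λ {a} p → ⊥-elim (¬t a p))) z≤n
    go : Dec (q ≡ u) → Dec (Covered q u) → ∑ (allFin n) (S q u) ≤ ρ
    go (yes q≡u) _ = none (λ { a (_ , q≢u , _) → q≢u q≡u })
    go (no _) (no ¬c) = none (λ { a (_ , _ , _ , b , x , y , _) → ¬c (b , x , y) })
    go (no q≢u) (yes (b , q∈ , u∈)) = ≤-trans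
      (∑-list (together? q u) (others q (others u (block b))) λ { {a} (u≢a , _ , q≢a , b′ , q∈′ , u∈′ , a∈′) →
        ∈-others (∈-others (subst (λ b → a ∈ block b) (linear q≢u q∈′ u∈′ q∈ u∈) a∈′) (u≢a ∘ sym)) (q≢a ∘ sym) })
      (s≤s⁻¹ (≤-trans (length-others (∈-others q∈ q≢u)) (s≤s⁻¹ (≤-trans (length-others u∈) (length-block b)))))

module CleanBlocks {ρ n : ℕ} (G : Graph n) (P : Packing (suc (suc ρ)) n) (π : Permutation′ n) where
  open Packing P
  open Complement G
  open Cohabitation P
  open Overlap h h-sym h-diag

  private
    r = suc (suc ρ)
    to = π ⟨$⟩ʳ_
    from = π ⟨$⟩ˡ_
    to-from : ∀ x → to (from x) ≡ x
    to-from x = inverseʳ π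
    to-injective : ∀ {x y} → to x ≡ to y → x ≡ y
    to-injective {x} {y} e = trans (sym (inverseˡ π)) (trans (cong from e) (inverseˡ π))

    Spoiled : List (Fin n) → Set
    Spoiled xs = Any (λ x → Any (NonEdge x) xs) xs

    spoiled? : ∀ xs → Dec (Spoiled xs)
    spoiled? xs = Any.any? (λ x → Any.any? (nonEdge? x) xs) xs

    keep : List (Fin n) → List (Fin n)
    keep xs with spoiled? xs
    ... | yes _ = []
    ... | no _ = xs

    keep-spec : ∀ xs → keep xs ≡ [] ⊎ keep xs ≡ xs
    keep-spec xs with spoiled? xs
    ... | yes _ = inj₁ refl
    ... | no _ = inj₂ refl

    ∈-keep⁻ : ∀ {x} xs → x ∈ keep xs → x ∈ xs × ¬ Spoiled xs
    ∈-keep⁻ xs p with spoiled? xs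
    ... | no ¬s = p , ¬s

    ∈-keep⁺ : ∀ xs → Spoiled xs ⊎ (∀ {x} → x ∈ xs → x ∈ keep xs)
    ∈-keep⁺ xs with spoiled? xs
    ... | yes s = inj₁ s
    ... | no _ = inj₂ id

    blk : Fin #blocks → List (Fin n)
    blk b = keep (map to (block b))

    ∈-blk⁻ : ∀ {x} b → x ∈ blk b → from x ∈ block b
    ∈-blk⁻ b p with ∈-map⁻ to (proj₁ (∈-keep⁻ (map to (block b)) p))
    ... | y , y∈ , refl = subst (_∈ block b) (sym (inverseˡ π)) y∈

    from-injective : ∀ {x y} → from x ≡ from y → x ≡ y
    from-injective e = trans (sym (to-from _)) (trans (cong to e) (to-from _))

  clean : Packing r n
  clean = record
    { #blocks = #blocks ; block = blk ; distinct = dis ; size-r = siz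
    ; linear = λ {b} {b′} ne p q p′ q′ → linear (ne ∘ from-injective) (∈-blk⁻ b p) (∈-blk⁻ b q) (∈-blk⁻ b′ p′) (∈-blk⁻ b′ q′) }
    where
    dis : ∀ b → Unique (blk b)
    dis b with keep-spec (map to (block b))
    ... | inj₁ e = subst Unique (sym e) []
    ... | inj₂ e = subst Unique (sym e) (Unique.map⁺ to-injective (distinct b))
    siz : ∀ b → blk b ≡ [] ⊎ length (blk b) ≡ r
    siz b with keep-spec (map to (block b)) | size-r b
    ... | inj₁ e | _ = inj₁ e
    ... | inj₂ e | inj₁ e′ = inj₁ (trans e (cong (map to) e′))
    ... | inj₂ e | inj₂ l = inj₂ (trans (cong length e) (trans (L.length-map to (block b)) l))

  clean-edges : ∀ b {x y} → x ∈ Packing.block clean b → y ∈ Packing.block clean b → x ≢ y → Edge G x y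
  clean-edges b {x} {y} p q ne with ∈-keep⁻ (map to (block b)) p | ∈-keep⁻ (map to (block b)) q
  ... | x∈ , ¬s | y∈ , _ = edge ne (λ e → ¬s (lose x∈ (lose y∈ e)))

  module _ {l d t} (left : Leftover l) (h-deg : ∀ u → ∑ (allFin n) (h u) ≤ d) (small : ∀ q → total (S q) to ≤ t) where
    private
      -- A spoiled block through `q` contains a non-edge at `q` or one between two other points. The
      -- other end in the first case, either end in the second, is a bad `z`, and linearity recovers
      -- the block from `q` and `z`.
      Bad : Fin n → Fin n → Set
      Bad q z = NonEdge (to q) (to z) ⊎ 1 ≤ row (S q) to z (to z)

      bad? : ∀ q z → Dec (Bad q z)
      bad? q z = nonEdge? (to q) (to z) ⊎-dec (1 ≤? row (S q) to z (to z))

      bads : Fin n → List (Fin n)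
      bads q = filter (bad? q) (allFin n)

      #bads : ∀ q → length (bads q) ≤ d + t
      #bads q = begin
        length (bads q) ≡⟨ length-filter-∑ (bad? q) (allFin n) ⟩
        ∑ (allFin n) (𝟙 ∘ bad? q) ≤⟨ ∑-mono (allFin n) (λ z → 𝟙-≤ (bad? q z) [ (λ e → ≤-trans (≤-reflexive (sym (𝟙-yes (nonEdge? (to q) (to z)) e))) (m≤m+n _ _)) , (λ e → ≤-trans e (m≤n+m _ (h (to q) (to z)))) ]) ⟩
        ∑ (allFin n) (λ z → h (to q) (to z) + row (S q) to z (to z)) ≡⟨ ∑-+ (allFin n) _ _ ⟩
        ∑ (allFin n) (λ z → h (to q) (to z)) + total (S q) to ≤⟨ +-mono-≤ (≤-trans (≤-reflexive (∑-perm π (h (to q)))) (h-deg (to q))) (small q) ⟩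
        d + t ∎
        where open ≤-Reasoning

      through : Fin n → Fin n → List (Fin n)
      through q z with covered? q z
      ... | yes (b , _) = others (to q) (map to (block b))
      ... | no _ = []

      length-through : ∀ q z → length (through q z) ≤ suc ρ
      length-through q z with covered? q z
      ... | yes (b , q∈ , _) = s≤s⁻¹ (≤-trans (length-others (∈-map⁺ to q∈)) (≤-trans (≤-reflexive (L.length-map to (block b))) (length-block b)))
      ... | no _ = z≤n

      ∈-through : ∀ {q z y b} → q ≢ z → y ≢ q → q ∈ block b → z ∈ block b → y ∈ block b → to y ∈ through q z
      ∈-through {q} {z} {y} {b} q≢z y≢q q∈ z∈ y∈ with covered? q z
      ... | no ¬c = contradiction (b , q∈ , z∈) ¬c
      ... | yes (b′ , q∈′ , z∈′) = ∈-others (∈-map⁺ to (subst (λ b → y ∈ block b) (linear q≢z q∈ z∈ q∈′ z∈′) y∈)) (y≢q ∘ to-injective)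

      spoiler : ∀ {q b} → q ∈ block b → Spoiled (map to (block b)) → ∃ λ z → z ∈ block b × q ≢ z × Bad q z
      spoiler {q} {b} q∈ s with find s
      ... | x , x∈ , s′ with find s′
      ... | y , y∈ , ne with ∈-map⁻ to x∈ | ∈-map⁻ to y∈
      ... | x₀ , x₀∈ , refl | y₀ , y₀∈ , refl with q F.≟ x₀
      ... | yes refl = y₀ , y₀∈ , (λ e → proj₁ ne (cong to e)) , inj₁ ne
      ... | no q≢x with q F.≟ y₀
      ...   | yes refl = x₀ , x₀∈ , q≢x , inj₁ (proj₁ ne ∘ sym , trans (adj-sym G _ _) (proj₂ ne))
      ...   | no q≢y = x₀ , x₀∈ , q≢x , inj₂ (≤-trans (≤-reflexive (sym one)) (∑-∈ (λ a → S q x₀ a * h (to x₀) (to a)) (∈-allFin y₀)))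
        where
        one : S q x₀ y₀ * h (to x₀) (to y₀) ≡ 1
        one = cong₂ _*_ (𝟙-yes (together? q x₀ y₀) ((λ e → proj₁ ne (cong to e)) , q≢x , q≢y , b , q∈ , x₀∈ , y₀∈)) (𝟙-yes (nonEdge? (to x₀) (to y₀)) ne)

    -- At most `d` points are bad because of non-edges at `v`, and at most `t` because of the
    -- overlap of the link. Each accounts for at most one lost block, with `suc ρ` partners.
    clean-leftover : Packing.Leftover clean (l + (d + t) * suc ρ)
    clean-leftover v = us′ , len , cov
      where
      q = from v
      us′ = map to (proj₁ (left q)) ++ concatMap (through q) (bads q)
      len : length us′ ≤ l + (d + t) * suc ρ
      len = begin
        length us′ ≡⟨ L.length-++ (map to (proj₁ (left q))) ⟩
        length (map to (proj₁ (left q))) + length (concatMap (through q) (bads q)) ≡⟨ cong₂ _+_ (L.length-map to (proj₁ (left q))) (length-concatMap (through q) (bads q)) ⟩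
        length (proj₁ (left q)) + ∑ (bads q) (length ∘ through q) ≤⟨ +-mono-≤ (proj₁ (proj₂ (left q))) (≤-trans (∑-≤const (bads q) (suc ρ) (length-through q)) (*-monoˡ-≤ (suc ρ) (#bads q))) ⟩
        l + (d + t) * suc ρ ∎
        where open ≤-Reasoning
      cov : ∀ w → w ≢ v → Packing.Covered clean v w ⊎ w ∈ us′
      cov w w≢v with proj₂ (proj₂ (left q)) (from w) (w≢v ∘ from-injective)
      ... | inj₂ w∈ = inj₂ (∈-++⁺ˡ (subst (_∈ map to (proj₁ (left q))) (to-from w) (∈-map⁺ to w∈)))
      ... | inj₁ (b , q∈ , w∈) with ∈-keep⁺ (map to (block b))
      ...   | inj₂ kept = inj₁ (b , kept (subst (_∈ map to (block b)) (to-from v) (∈-map⁺ to q∈)) , kept (subst (_∈ map to (block b)) (to-from w) (∈-map⁺ to w∈)))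
      ...   | inj₁ s with spoiler q∈ s
      ...     | z , z∈ , q≢z , bz = inj₂ (∈-++⁺ʳ (map to (proj₁ (left q))) (∈-concatMap (through q) (∈-filter⁺ (bad? q) (∈-allFin z) bz)
                (subst (_∈ through q z) (to-from w) (∈-through q≢z (w≢v ∘ from-injective) q∈ z∈ w∈))))

-- Covering the leftover edges

SamePair : ∀ {n} → Fin n → Fin n → Fin n → Fin n → Set
SamePair x y x′ y′ = (x ≡ x′ × y ≡ y′) ⊎ (x ≡ y′ × y ≡ x′)

-- Edges gained when an edge grows into a larger clique: the i-th new vertex is joined to i + 1
-- earlier ones. With k - 2 new vertices this is C(k,2) - 1.
#new : ℕ → ℕ
#new zero = 0
#new (suc i) = suc (suc i) + #new i

#new-mono : ∀ {i j} → i ≤ j → #new i ≤ #new j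
#new-mono z≤n = z≤n
#new-mono (s≤s {i} {j} le) = +-mono-≤ (s≤s (s≤s le)) (#new-mono le)

-- load x counts the touched blocks through x. Vertices with load at least cap are saturated: a newly touched block
-- may contain one only as an end of the uncovered edge being processed, which bounds all loads by Λ.
module Greedy {n w : ℕ} (G : Graph n) (P : Packing (suc w) n)
  (edges : ∀ b {x y} → x ∈ Packing.block P b → y ∈ Packing.block P b → x ≢ y → Edge G x y)
  {M : ℕ} (left : Packing.Leftover P M) (m cap σ : ℕ)
  (σ-large : ∀ y → y * cap ≤ suc w * (#new m * (n * M)) → y ≤ σ)
  (room : suc m * (suc M + w * (cap + #new m + m * (M + M) + #new m) + w * σ) < n)
  where
  open Packing P

  k = suc (suc m)
  s = #new m
  -- A load below `cap` grows by at most `s` with one clique. From `cap` on, it grows only when the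
  -- vertex is an end of the processed pair, by at most `m` each time, and a vertex is an end of at
  -- most M + M ordered uncovered pairs.
  Λ = cap + s + m * (M + M)

  mem? : ∀ (x : Fin n) b → Dec (x ∈ block b)
  mem? x b = Any.any? (x F.≟_) (block b)

  mem : Fin n → Fin #blocks → ℕ
  mem x b = 𝟙 (mem? x b)

  load : List (Fin #blocks) → Fin n → ℕ
  load cl x = ∑ cl (mem x)

  uncovered? : ∀ u v → Dec (u ≢ v × ¬ Covered u v)
  uncovered? u v = ¬? (u F.≟ v) ×-dec ¬? (covered? u v)

  unc : Fin n → Fin n → ℕ
  unc u v = 𝟙 (uncovered? u v)

  occ : Fin n → Fin n → Fin n → ℕ
  occ u v x = 𝟙 (u F.≟ x) + 𝟙 (v F.≟ x)

  module Extend (cl : List (Fin #blocks)) (load≤ : ∀ x → load cl x ≤ Λ)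
    (satL : List (Fin n)) (satL-spec : ∀ x → cap ≤ load cl x → x ∈ satL) (#satL : length satL ≤ σ)
    {u v : Fin n} (u≢v : u ≢ v) (uv : Edge G u v) (¬uv : ¬ Covered u v) where

    Sat : Fin n → Set
    Sat x = cap ≤ load cl x

    -- A clique on `u`, `v` and `i` further vertices, with `nb` the blocks of its edges. By
    -- `sat-occ` its saturated vertices are among `u` and `v`. The field `separate`, one clique edge
    -- per block, is what later allows a touched block to become a `K_r⁻`.
    record Partial (i : ℕ) : Set where
      field
        vs : List (Fin n)
        nb : List (Fin #blocks)
        #vs : length vs ≡ suc (suc i)
        #nb : length nb ≤ #new i
        distinct-vs : Unique vs
        clique : ∀ {x y} → x ∈ vs → y ∈ vs → x ≢ y → Edge G x y
        u∈ : u ∈ vs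
        v∈ : v ∈ vs
        base-or-covered : ∀ {x y} → x ∈ vs → y ∈ vs → x ≢ y → SamePair x y u v ⊎ Covered x y
        in-nb : ∀ {x y b} → x ∈ vs → y ∈ vs → x ≢ y → Covers b x y → b ∈ nb
        fresh-nb : ∀ {b} → b ∈ nb → b ∉ cl
        separate : ∀ {x y x′ y′ b} → x ∈ vs → y ∈ vs → x ≢ y → x′ ∈ vs → y′ ∈ vs → x′ ≢ y′ →
          Covers b x y → Covers b x′ y′ → SamePair x y x′ y′
        sat-occ : ∀ x → Sat x → ∑ vs (λ p → 𝟙 (p F.≟ x)) ≤ occ u v x
        sat-load : ∀ x → Sat x → load nb x ≤ i * occ u v x

    start : Partial 0
    start = record
      { vs = u ∷ v ∷ [] ; nb = [] ; #vs = refl ; #nb = z≤n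
      ; distinct-vs = (u≢v ∷ []) ∷ ([] ∷ [])
      ; clique = λ { (here refl) (here refl) ne → contradiction refl ne
                   ; (here refl) (there (here refl)) _ → uv
                   ; (there (here refl)) (here refl) _ → trans (adj-sym G _ _) uv
                   ; (there (here refl)) (there (here refl)) ne → contradiction refl ne }
      ; u∈ = here refl ; v∈ = there (here refl)
      ; base-or-covered = λ p q ne → inj₁ (base p q ne)
      ; in-nb = λ p q ne c → ⊥-elim (no-cover p q ne c)
      ; fresh-nb = λ ()
      ; separate = λ p q ne _ _ _ c _ → ⊥-elim (no-cover p q ne c)
      ; sat-occ = λ x _ → ≤-reflexive (cong (𝟙 (u F.≟ x) +_) (+-identityʳ _))
      ; sat-load = λ _ _ → z≤n }
      where
      base : ∀ {x y} → x ∈ u ∷ v ∷ [] → y ∈ u ∷ v ∷ [] → x ≢ y → SamePair x y u v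
      base (here refl) (here refl) ne = contradiction refl ne
      base (here refl) (there (here refl)) _ = inj₁ (refl , refl)
      base (there (here refl)) (here refl) _ = inj₂ (refl , refl)
      base (there (here refl)) (there (here refl)) ne = contradiction refl ne
      no-cover : ∀ {x y b} → x ∈ u ∷ v ∷ [] → y ∈ u ∷ v ∷ [] → x ≢ y → Covers b x y → ⊥
      no-cover p q ne c with base p q ne
      ... | inj₁ (refl , refl) = ¬uv (_ , c)
      ... | inj₂ (refl , refl) = ¬uv (covered-sym (_ , c))

    module _ {i : ℕ} (i<m : suc i ≤ m) (C : Partial i) where
      open Partial C

      private
        hit : Fin n → Fin #blocks → List (Fin n)
        hit p b with mem? p b
        ... | yes _ = others p (block b)
        ... | no _ = []

        length-hit : ∀ p b → length (hit p b) ≤ w * mem p b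
        length-hit p b with mem? p b
        ... | yes p∈ = ≤-trans (s≤s⁻¹ (≤-trans (length-others p∈) (length-block b))) (≤-reflexive (sym (*-identityʳ w)))
        ... | no _ = z≤n

        ∈-hit : ∀ {p x b} → p ∈ block b → x ∈ block b → x ≢ p → x ∈ hit p b
        ∈-hit {p} {x} {b} p∈ x∈ ne with mem? p b
        ... | yes _ = ∈-others x∈ ne
        ... | no ¬p = contradiction p∈ ¬p

        hit-sat : Fin n → Fin n → List (Fin n)
        hit-sat p z with covered? p z
        ... | yes (b , _) = others p (block b)
        ... | no _ = []

        length-hit-sat : ∀ p z → length (hit-sat p z) ≤ w
        length-hit-sat p z with covered? p z
        ... | yes (b , p∈ , _) = s≤s⁻¹ (≤-trans (length-others p∈) (length-block b))
        ... | no _ = z≤n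

        ∈-hit-sat : ∀ {p x z b} → p ≢ z → p ∈ block b → z ∈ block b → x ∈ block b → x ≢ p → x ∈ hit-sat p z
        ∈-hit-sat {p} {x} {z} {b} p≢z p∈ z∈ x∈ ne with covered? p z
        ... | no ¬c = contradiction (b , p∈ , z∈) ¬c
        ... | yes (b′ , p∈′ , z∈′) = ∈-others (subst (λ b → x ∈ block b) (linear p≢z p∈ z∈ p∈′ z∈′) x∈) ne

        us : Fin n → List (Fin n)
        us p = proj₁ (left p)

        -- Outside this list, `x` differs from `p` and shares with it a block that is untouched and
        -- has no saturated vertex except possibly `p`. The three parts of the list answer to these
        -- demands.
        blocked : Fin n → List (Fin n)
        blocked p = (p ∷ us p) ++ concatMap (hit p) (nb ++ cl) ++ concatMap (hit-sat p) satL

        length-blocked : ∀ p → length (blocked p) ≤ suc M + w * (Λ + s) + w * σ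
        length-blocked p = begin
          length (blocked p) ≡⟨ L.length-++ (p ∷ us p) ⟩
          suc (length (us p)) + length (concatMap (hit p) (nb ++ cl) ++ concatMap (hit-sat p) satL)
            ≤⟨ +-mono-≤ (s≤s (proj₁ (proj₂ (left p)))) (≤-trans (≤-reflexive (L.length-++ (concatMap (hit p) (nb ++ cl)))) (+-mono-≤ hits sats)) ⟩
          suc M + (w * (Λ + s) + w * σ) ≡⟨ +-assoc (suc M) _ _ ⟨
          suc M + w * (Λ + s) + w * σ ∎
          where
          open ≤-Reasoning
          hits : length (concatMap (hit p) (nb ++ cl)) ≤ w * (Λ + s)
          hits = begin
            length (concatMap (hit p) (nb ++ cl)) ≡⟨ length-concatMap (hit p) (nb ++ cl) ⟩
            ∑ (nb ++ cl) (length ∘ hit p) ≤⟨ ∑-mono (nb ++ cl) (length-hit p) ⟩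
            ∑ (nb ++ cl) (λ b → w * mem p b) ≡⟨ ∑-*ˡ (nb ++ cl) w (mem p) ⟩
            w * ∑ (nb ++ cl) (mem p) ≡⟨ cong (w *_) (trans (∑-++ nb cl (mem p)) (+-comm (load nb p) (load cl p))) ⟩
            w * (load cl p + load nb p) ≤⟨ *-monoʳ-≤ w (+-mono-≤ (load≤ p) (≤-trans (≤-trans (∑-≤const nb 1 (λ b → 𝟙≤1 (mem? p b))) (≤-reflexive (*-identityʳ _))) (≤-trans #nb (#new-mono (<⇒≤ i<m))))) ⟩
            w * (Λ + s) ∎
          sats : length (concatMap (hit-sat p) satL) ≤ w * σ
          sats = begin
            length (concatMap (hit-sat p) satL) ≡⟨ length-concatMap (hit-sat p) satL ⟩
            ∑ satL (length ∘ hit-sat p) ≤⟨ ∑-≤const satL w (length-hit-sat p) ⟩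
            length satL * w ≤⟨ *-monoˡ-≤ w #satL ⟩
            σ * w ≡⟨ *-comm σ w ⟩
            w * σ ∎

      choice : Σ (Fin n) λ x → x ∉ concatMap blocked vs
      choice = fresh (concatMap blocked vs) (≤-<-trans (begin
        length (concatMap blocked vs) ≡⟨ length-concatMap blocked vs ⟩
        ∑ vs (length ∘ blocked) ≤⟨ ∑-≤const vs _ length-blocked ⟩
        length vs * (suc M + w * (Λ + s) + w * σ) ≤⟨ *-monoˡ-≤ (suc M + w * (Λ + s) + w * σ) (≤-trans (≤-reflexive #vs) (s≤s i<m)) ⟩
        suc m * (suc M + w * (Λ + s) + w * σ) ∎) room)
        where open ≤-Reasoning

      module _ (x : Fin n) (x∉ : x ∉ concatMap blocked vs) where
        private
          free : ∀ {p} → p ∈ vs → x ∉ blocked p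
          free p∈ x∈ = x∉ (∈-concatMap blocked p∈ x∈)

          x≢ : ∀ {p} → p ∈ vs → x ≢ p
          x≢ p∈ refl = free p∈ (here refl)

          covers : ∀ {p} → p ∈ vs → Covered p x
          covers {p} p∈ with proj₂ (proj₂ (left p)) x (x≢ p∈)
          ... | inj₁ c = c
          ... | inj₂ x∈ = ⊥-elim (free p∈ (∈-++⁺ˡ {ys = _} (there x∈)))

          untouched : ∀ {p b} → p ∈ vs → Covers b p x → b ∉ nb ++ cl
          untouched {p} p∈ (p∈b , x∈b) b∈ = free p∈ (∈-++⁺ʳ (p ∷ us p) (∈-++⁺ˡ (∈-concatMap (hit p) b∈ (∈-hit p∈b x∈b (x≢ p∈)))))

          sat-free : ∀ {p b z} → p ∈ vs → Covers b p x → Sat z → z ∈ block b → z ≡ p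
          sat-free {p} {b} {z} p∈ (p∈b , x∈b) sat z∈ with z F.≟ p
          ... | yes e = e
          ... | no ne = ⊥-elim (free p∈ (∈-++⁺ʳ (p ∷ us p) (∈-++⁺ʳ (concatMap (hit p) (nb ++ cl))
                          (∈-concatMap (hit-sat p) (satL-spec z sat) (∈-hit-sat (ne ∘ sym) p∈b z∈ x∈b (x≢ p∈))))))

          -- A saturated `x` would lie in the block through `u` and `x`, in which only `u` may be
          -- saturated.
          ¬sat-x : ¬ Sat x
          ¬sat-x sat with covers u∈
          ... | b , c = x≢ u∈ (sat-free u∈ c sat (proj₂ c))

          joins : Fin n → List (Fin #blocks)
          joins p with covered? p x
          ... | yes (b , _) = b ∷ []
          ... | no _ = []

          length-joins : ∀ p → length (joins p) ≤ 1
          length-joins p with covered? p x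
          ... | yes _ = ≤-refl
          ... | no _ = z≤n

          ∈-joins⁺ : ∀ {p b} → p ∈ vs → Covers b p x → b ∈ joins p
          ∈-joins⁺ {p} {b} p∈ c with covered? p x
          ... | no ¬c = contradiction (b , c) ¬c
          ... | yes (b′ , c′) = here (linear (x≢ p∈ ∘ sym) (proj₁ c) (proj₂ c) (proj₁ c′) (proj₂ c′))

          ∈-joins⁻ : ∀ {p b} → b ∈ joins p → Covers b p x
          ∈-joins⁻ {p} b∈ with covered? p x
          ∈-joins⁻ {p} (here refl) | yes (b , c) = c

          nb′ = concatMap joins vs ++ nb

          ∈-nb′⁻ : ∀ {b} → b ∈ concatMap joins vs → ∃ λ p → p ∈ vs × Covers b p x
          ∈-nb′⁻ = go vs id
            where
            go : ∀ ps → (∀ {p} → p ∈ ps → p ∈ vs) → ∀ {b} → b ∈ concatMap joins ps → ∃ λ p → p ∈ vs × Covers b p x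
            go (p ∷ ps) sub b∈ with ∈-++⁻ (joins p) b∈
            ... | inj₁ q = p , sub (here refl) , ∈-joins⁻ q
            ... | inj₂ q = go ps (sub ∘ there) q

          cover-flip : ∀ {b x y} → Covers b x y → Covers b y x
          cover-flip (p , q) = q , p

          no-mix : ∀ {b p y z} → p ∈ vs → Covers b p x → y ∈ vs → z ∈ vs → y ≢ z → Covers b y z → ⊥
          no-mix p∈ c y∈ z∈ ne c′ = untouched p∈ c (∈-++⁺ˡ (in-nb y∈ z∈ ne c′))

          -- If the edges from `x` to `p` and to `q` shared a block, that block would contain the
          -- pair `p`, `q` as well and hence be in `nb` already, whereas blocks through `x` are
          -- untouched.
          same-end : ∀ {b p q} → p ∈ vs → q ∈ vs → Covers b p x → Covers b q x → p ≡ q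
          same-end {b} {p} {q} p∈ q∈ c c′ with p F.≟ q
          ... | yes e = e
          ... | no ne = ⊥-elim (no-mix p∈ c p∈ q∈ ne (proj₁ c , proj₁ c′))

          separate′ : ∀ {a b c d B} → a ∈ x ∷ vs → b ∈ x ∷ vs → a ≢ b → c ∈ x ∷ vs → d ∈ x ∷ vs → c ≢ d →
            Covers B a b → Covers B c d → SamePair a b c d
          separate′ (here refl) (here refl) ne _ _ _ _ _ = contradiction refl ne
          separate′ _ _ _ (here refl) (here refl) ne _ _ = contradiction refl ne
          separate′ (here refl) (there b∈) _ (here refl) (there d∈) _ q q′ = inj₁ (refl , same-end b∈ d∈ (cover-flip q) (cover-flip q′))
          separate′ (here refl) (there b∈) _ (there c∈) (here refl) _ q q′ = inj₂ (refl , same-end b∈ c∈ (cover-flip q) q′)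
          separate′ (there a∈) (here refl) _ (here refl) (there d∈) _ q q′ = inj₂ (same-end a∈ d∈ q (cover-flip q′) , refl)
          separate′ (there a∈) (here refl) _ (there c∈) (here refl) _ q q′ = inj₁ (same-end a∈ c∈ q q′ , refl)
          separate′ (here refl) (there b∈) _ (there c∈) (there d∈) ne q q′ = ⊥-elim (no-mix b∈ (cover-flip q) c∈ d∈ ne q′)
          separate′ (there a∈) (here refl) _ (there c∈) (there d∈) ne q q′ = ⊥-elim (no-mix a∈ q c∈ d∈ ne q′)
          separate′ (there a∈) (there b∈) ne (here refl) (there d∈) _ q q′ = ⊥-elim (no-mix d∈ (cover-flip q′) a∈ b∈ ne q)
          separate′ (there a∈) (there b∈) ne (there c∈) (here refl) _ q q′ = ⊥-elim (no-mix c∈ q′ a∈ b∈ ne q)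
          separate′ (there a∈) (there b∈) ne (there c∈) (there d∈) ne′ q q′ = separate a∈ b∈ ne c∈ d∈ ne′ q q′

        extend : Partial (suc i)
        extend = record
          { vs = x ∷ vs ; nb = nb′ ; #vs = cong suc #vs
          ; #nb = ≤-trans (≤-reflexive (L.length-++ (concatMap joins vs))) (+-mono-≤
              (≤-trans (≤-reflexive (length-concatMap joins vs)) (≤-trans (∑-≤const vs 1 length-joins) (≤-reflexive (trans (*-identityʳ _) #vs)))) #nb)
          ; distinct-vs = All.tabulate x≢ ∷ distinct-vs
          ; clique = λ { (here refl) (here refl) ne → contradiction refl ne
                       ; (here refl) (there q) ne → edge′ q
                       ; (there p) (here refl) ne → trans (adj-sym G _ _) (edge′ p)
                       ; (there p) (there q) ne → clique p q ne }
          ; u∈ = there u∈ ; v∈ = there v∈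
          ; base-or-covered = λ { (here refl) (here refl) ne → contradiction refl ne
                       ; (here refl) (there q) ne → inj₂ (covered-sym (covers q))
                       ; (there p) (here refl) ne → inj₂ (covers p)
                       ; (there p) (there q) ne → base-or-covered p q ne }
          ; in-nb = λ { (here refl) (here refl) ne _ → contradiction refl ne
                       ; (here refl) (there q) ne c → ∈-++⁺ˡ (∈-concatMap joins q (∈-joins⁺ q (cover-flip c)))
                       ; (there p) (here refl) ne c → ∈-++⁺ˡ (∈-concatMap joins p (∈-joins⁺ p c))
                       ; (there p) (there q) ne c → ∈-++⁺ʳ (concatMap joins vs) (in-nb p q ne c) }
          ; fresh-nb = λ b∈ → [ (λ q → let (_ , p∈ , c) = ∈-nb′⁻ q in λ r → untouched p∈ c (∈-++⁺ʳ nb r)) , fresh-nb ] (∈-++⁻ (concatMap joins vs) b∈)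
          ; separate = separate′
          ; sat-occ = λ z sat → ≤-trans (≤-reflexive (cong (_+ ∑ vs (λ p → 𝟙 (p F.≟ z))) (𝟙-no (x F.≟ z) (λ { refl → ¬sat-x sat })))) (sat-occ z sat)
          -- A new block meets a saturated `z` only in its old end, so the new blocks through `z`
          -- number at most the occurrences of `z` in `vs`, which `sat-occ` bounds.
          ; sat-load = λ z sat → ≤-trans (≤-reflexive (∑-++ (concatMap joins vs) nb (mem z))) (+-mono-≤
              (≤-trans (≤-reflexive (∑-concatMap joins vs (mem z))) (≤-trans (∑-mono∈ vs (λ {p} → joins-load sat {p})) (sat-occ z sat)))
              (sat-load z sat)) }
          where
          edge′ : ∀ {p} → p ∈ vs → Edge G x p
          edge′ p∈ with covers p∈
          ... | b , p∈b , x∈b = edges b x∈b p∈b (x≢ p∈)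
          joins-load : ∀ {z} → Sat z → ∀ {p} → p ∈ vs → ∑ (joins p) (mem z) ≤ 𝟙 (p F.≟ z)
          joins-load {z} sat {p} p∈ with covered? p x
          ... | no _ = z≤n
          ... | yes (b , c) = ≤-trans (≤-reflexive (+-identityʳ _)) (𝟙-mono (mem? z b) (p F.≟ z) (λ z∈ → sym (sat-free p∈ c sat z∈)))

    build : ∀ i → i ≤ m → Partial i
    build zero _ = start
    build (suc i) le = let C = build i (<⇒≤ le) in extend le C (proj₁ (choice le C)) (proj₂ (choice le C))

  -- Both bounds charge every uncovered ordered pair, edge of `G` or not, and whether or not it
  -- produced a clique. Hence an uncovered pair counts in both orders, which gives M + M instead of
  -- M.
  record State (es : List (Fin n × Fin n)) : Set where
    field
      Qs : List (List (Fin n))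
      cl : List (Fin #blocks)
      #Q : ∀ {Q} → Q ∈ Qs → length Q ≡ k
      distinct-Q : ∀ {Q} → Q ∈ Qs → Unique Q
      clique : ∀ {Q x y} → Q ∈ Qs → x ∈ Q → y ∈ Q → x ≢ y → Edge G x y
      edge-disjoint : AllPairs (λ Q Q′ → ∀ {x y} → x ≢ y → x ∈ Q → y ∈ Q → x ∈ Q′ → y ∈ Q′ → ⊥) Qs
      separate : ∀ {Q Q′ x y x′ y′ b} → Q ∈ Qs → Q′ ∈ Qs → x ∈ Q → y ∈ Q → x ≢ y → x′ ∈ Q′ → y′ ∈ Q′ → x′ ≢ y′ →
        Covers b x y → Covers b x′ y′ → SamePair x y x′ y′
      in-cl : ∀ {Q x y b} → Q ∈ Qs → x ∈ Q → y ∈ Q → x ≢ y → Covers b x y → b ∈ cl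
      done : ∀ {u v} → (u , v) ∈ es → u ≢ v → Edge G u v → ¬ Covered u v → ∃ λ Q → Q ∈ Qs × u ∈ Q × v ∈ Q
      #cl : length cl ≤ s * ∑ es (λ (u , v) → unc u v)
      cl-load : ∀ x → load cl x ≤ cap + s + m * ∑ es (λ (u , v) → unc u v * occ u v x)

  module _ (u v : Fin n) (es : List (Fin n × Fin n)) (before : State es)
    (few : unc u v + ∑ es (λ (u , v) → unc u v) ≤ n * M)
    (bal : ∀ x → unc u v * occ u v x + ∑ es (λ (u , v) → unc u v * occ u v x) ≤ M + M) where
    open State before

    skip : (u ≢ v → Edge G u v → ¬ Covered u v → ∃ λ Q → Q ∈ Qs × u ∈ Q × v ∈ Q) → State ((u , v) ∷ es)
    skip found = record
      { Qs = Qs ; cl = cl ; #Q = #Q ; distinct-Q = distinct-Q ; clique = clique ; edge-disjoint = edge-disjoint ; separate = separate ; in-cl = in-cl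
      ; done = λ { (here refl) → found ; (there p) → done p }
      ; #cl = ≤-trans #cl (*-monoʳ-≤ s (m≤n+m _ (unc u v)))
      ; cl-load = λ x → ≤-trans (cl-load x) (+-monoʳ-≤ (cap + s) (*-monoʳ-≤ m (m≤n+m _ (unc u v * occ u v x)))) }
    step : Dec ((u ≢ v × ¬ Covered u v) × Edge G u v) → Dec (Any (λ Q → u ∈ Q × v ∈ Q) Qs) → State ((u , v) ∷ es)
    step (no ¬p) _ = skip (λ ne e ¬c → contradiction ((ne , ¬c) , e) ¬p)
    -- Every edge is listed in both orders; the order met second finds the clique built for the
    -- first.
    step (yes _) (yes old) = skip (λ _ _ _ → find old)
    step (yes ((u≢v , ¬c) , uv)) (no ¬old) = record
      { Qs = vs ∷ Qs ; cl = nb ++ cl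
      ; #Q = λ { (here refl) → #vs ; (there p) → #Q p }
      ; distinct-Q = λ { (here refl) → distinct-vs ; (there p) → distinct-Q p }
      ; clique = λ { (here refl) → E.Partial.clique C ; (there p) → clique p }
      ; edge-disjoint = All.tabulate new-disjoint ∷ edge-disjoint
      ; separate = separate′
      ; in-cl = λ { (here refl) x∈ y∈ ne c → ∈-++⁺ˡ (in-nb x∈ y∈ ne c) ; (there p) x∈ y∈ ne c → ∈-++⁺ʳ nb (in-cl p x∈ y∈ ne c) }
      ; done = λ { (here refl) _ _ _ → vs , here refl , u∈ , v∈ ; (there p) ne e ¬c → let (Q , Q∈ , r) = done p ne e ¬c in Q , there Q∈ , r }
      ; #cl = ≤-trans (≤-reflexive (L.length-++ nb)) (≤-trans (+-mono-≤ #nb #cl) (≤-reflexive (trans (sym (*-suc s _)) (cong (λ z → s * (z + ∑ es (λ (u , v) → unc u v))) (sym unc1)))))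
      ; cl-load = cl-load′ }
      where
      satL = filter (λ x → cap ≤? load cl x) (allFin n)
      -- Double counting of incidences: a saturated vertex lies in at least `cap` touched blocks,
      -- and a block has at most `suc w` points.
      #satL : length satL ≤ σ
      #satL = σ-large (length satL) (begin
        length satL * cap ≡⟨ cong (_* cap) (length-filter-∑ (λ x → cap ≤? load cl x) (allFin n)) ⟩
        ∑ (allFin n) (λ x → 𝟙 (cap ≤? load cl x)) * cap ≡⟨ ∑-*ʳ (allFin n) cap _ ⟨
        ∑ (allFin n) (λ x → 𝟙 (cap ≤? load cl x) * cap) ≤⟨ ∑-mono (allFin n) heavy ⟩
        ∑ (allFin n) (load cl) ≡⟨ ∑-swap (allFin n) cl mem ⟩
        ∑ cl (λ b → ∑ (allFin n) (λ x → mem x b)) ≤⟨ ∑-≤const cl (suc w) (λ b → ≤-trans (∑-list (λ x → mem? x b) (block b) id) (length-block b)) ⟩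
        length cl * suc w ≤⟨ *-monoˡ-≤ (suc w) (≤-trans #cl (*-monoʳ-≤ s (m+n≤o⇒n≤o (unc u v) few))) ⟩
        s * (n * M) * suc w ≡⟨ *-comm (s * (n * M)) (suc w) ⟩
        suc w * (s * (n * M)) ∎)
        where
        open ≤-Reasoning
        heavy : ∀ x → 𝟙 (cap ≤? load cl x) * cap ≤ load cl x
        heavy x = 𝟙*-≤ (cap ≤? load cl x) id
      module E = Extend cl (λ x → ≤-trans (cl-load x) (+-monoʳ-≤ (cap + s) (*-monoʳ-≤ m (m+n≤o⇒n≤o (unc u v * occ u v x) (bal x)))))
        satL (λ x p → ∈-filter⁺ (λ x → cap ≤? load cl x) (∈-allFin x) p) #satL u≢v uv ¬c
      C = E.build m ≤-refl
      open E.Partial C using (vs; nb; #vs; #nb; distinct-vs; in-nb; u∈; v∈; base-or-covered; fresh-nb; sat-load)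
      unc1 : unc u v ≡ 1
      unc1 = 𝟙-yes (uncovered? u v) (u≢v , ¬c)
      -- The base edge is in no earlier clique by `¬old`; any other edge has a block in `nb`, and
      -- those were untouched so far.
      new-disjoint : ∀ {Q} → Q ∈ Qs → ∀ {x y} → x ≢ y → x ∈ vs → y ∈ vs → x ∈ Q → y ∈ Q → ⊥
      new-disjoint Q∈ ne x∈ y∈ x∈Q y∈Q with base-or-covered x∈ y∈ ne
      ... | inj₁ (inj₁ (refl , refl)) = ¬old (lose Q∈ (x∈Q , y∈Q))
      ... | inj₁ (inj₂ (refl , refl)) = ¬old (lose Q∈ (y∈Q , x∈Q))
      ... | inj₂ (b , c) = fresh-nb (in-nb x∈ y∈ ne c) (in-cl Q∈ x∈Q y∈Q ne c)
      separate′ : ∀ {Q Q′ x y x′ y′ b} → Q ∈ vs ∷ Qs → Q′ ∈ vs ∷ Qs → x ∈ Q → y ∈ Q → x ≢ y → x′ ∈ Q′ → y′ ∈ Q′ → x′ ≢ y′ →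
        Covers b x y → Covers b x′ y′ → SamePair x y x′ y′
      separate′ (here refl) (here refl) = E.Partial.separate C
      separate′ (here refl) (there q) x∈ y∈ ne x′∈ y′∈ ne′ c c′ = ⊥-elim (fresh-nb (in-nb x∈ y∈ ne c) (in-cl q x′∈ y′∈ ne′ c′))
      separate′ (there q) (here refl) x∈ y∈ ne x′∈ y′∈ ne′ c c′ = ⊥-elim (fresh-nb (in-nb x′∈ y′∈ ne′ c′) (in-cl q x∈ y∈ ne c))
      separate′ (there q) (there q′) = separate q q′
      cl-load′ : ∀ x → load (nb ++ cl) x ≤ cap + s + m * (unc u v * occ u v x + ∑ es (λ (u , v) → unc u v * occ u v x))
      cl-load′ x = ≤-trans (≤-reflexive (∑-++ nb cl (mem x))) (go (cap ≤? load cl x))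
        where
        old = ∑ es (λ (u , v) → unc u v * occ u v x)
        go : Dec (cap ≤ load cl x) → load nb x + load cl x ≤ cap + s + m * (unc u v * occ u v x + old)
        go (yes sat) = ≤-trans (+-mono-≤ (sat-load x sat) (cl-load x)) (≤-reflexive (trans (c1 m (occ u v x) (cap + s) old)
            (cong (λ z → cap + s + m * (z * occ u v x + old)) (sym unc1))))
          where
          c1 : ∀ m o c z → m * o + (c + m * z) ≡ c + m * (1 * o + z)
          c1 = solve-∀
        go (no ¬sat) = ≤-trans (+-mono-≤ (≤-trans (≤-trans (∑-≤const nb 1 (λ b → 𝟙≤1 (mem? x b))) (≤-reflexive (*-identityʳ _))) #nb) (<⇒≤ (≰⇒> ¬sat)))
          (≤-trans (≤-reflexive (+-comm s cap)) (m≤m+n (cap + s) _))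

    add-pair : State ((u , v) ∷ es)
    add-pair = step (uncovered? u v ×-dec (adj G u v Bool.≟ true)) (Any.any? (λ Q → Any.any? (u F.≟_) Q ×-dec Any.any? (v F.≟_) Q) Qs)

  run : ∀ es → ∑ es (λ (u , v) → unc u v) ≤ n * M → (∀ x → ∑ es (λ (u , v) → unc u v * occ u v x) ≤ M + M) → State es
  run [] _ _ = record
    { Qs = [] ; cl = [] ; #Q = λ () ; distinct-Q = λ () ; clique = λ () ; edge-disjoint = [] ; separate = λ () ; in-cl = λ ()
    ; done = λ () ; #cl = z≤n ; cl-load = λ _ → z≤n }
  run ((u , v) ∷ es) few bal = add-pair u v es (run es (m+n≤o⇒n≤o (unc u v) few) (λ x → m+n≤o⇒n≤o (unc u v * occ u v x) (bal x))) few bal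

  all-pairs : List (Fin n × Fin n)
  all-pairs = concatMap (λ u → map (u ,_) (allFin n)) (allFin n)

  ∈-all-pairs : ∀ u v → (u , v) ∈ all-pairs
  ∈-all-pairs u v = ∈-concatMap (λ u → map (u ,_) (allFin n)) (∈-allFin u) (∈-map⁺ (u ,_) (∈-allFin v))

  ∑-all-pairs : ∀ f → ∑ all-pairs f ≡ ∑ (allFin n) (λ u → ∑ (allFin n) (λ v → f (u , v)))
  ∑-all-pairs f = trans (∑-concatMap (λ u → map (u ,_) (allFin n)) (allFin n) f) (∑-cong (allFin n) (λ u → ∑-map (u ,_) (allFin n) f))

  unc-deg : ∀ u → ∑ (allFin n) (unc u) ≤ M
  unc-deg u = ≤-trans (∑-list (uncovered? u) (proj₁ (left u)) (λ { {x} (ne , ¬c) → [ (λ c → contradiction c ¬c) , id ]′ (proj₂ (proj₂ (left u)) x (ne ∘ sym)) })) (proj₁ (proj₂ (left u)))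

  unc-sym : ∀ u v → unc u v ≡ unc v u
  unc-sym u v = 𝟙-cong (uncovered? u v) (uncovered? v u) flip flip
    where
    flip : ∀ {u v} → u ≢ v × ¬ Covered u v → v ≢ u × ¬ Covered v u
    flip (ne , ¬c) = ne ∘ sym , ¬c ∘ covered-sym

  cliques : State all-pairs
  cliques = run all-pairs
    (≤-trans (≤-reflexive (∑-all-pairs _)) (≤-trans (∑-≤const (allFin n) M unc-deg) (≤-reflexive (cong (_* M) (length-allFin n)))))
    (λ x → begin
      ∑ all-pairs (λ (u , v) → unc u v * occ u v x) ≡⟨ ∑-all-pairs _ ⟩
      ∑ V (λ u → ∑ V (λ v → unc u v * occ u v x)) ≡⟨ ∑-cong V (λ u → trans (∑-cong V (λ v → split u v x)) (∑-+ V _ _)) ⟩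
      ∑ V (λ u → ∑ V (λ v → 𝟙 (u F.≟ x) * unc u v) + ∑ V (λ v → 𝟙 (v F.≟ x) * unc u v)) ≡⟨ ∑-+ V _ _ ⟩
      ∑ V (λ u → ∑ V (λ v → 𝟙 (u F.≟ x) * unc u v)) + ∑ V (λ u → ∑ V (λ v → 𝟙 (v F.≟ x) * unc u v))
        ≡⟨ cong₂ _+_ (trans (∑-cong V (λ u → ∑-*ˡ V (𝟙 (u F.≟ x)) (unc u))) (∑-point x (λ u → ∑ V (unc u)))) (∑-cong V (λ u → trans (∑-point x (unc u)) (unc-sym u x))) ⟩
      ∑ V (unc x) + ∑ V (unc x) ≤⟨ +-mono-≤ (unc-deg x) (unc-deg x) ⟩
      M + M ∎)
    where
    open ≤-Reasoning
    V = allFin n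
    split : ∀ u v x → unc u v * occ u v x ≡ 𝟙 (u F.≟ x) * unc u v + 𝟙 (v F.≟ x) * unc u v
    split u v x = trans (*-distribˡ-+ (unc u v) (𝟙 (u F.≟ x)) (𝟙 (v F.≟ x))) (cong₂ _+_ (*-comm (unc u v) _) (*-comm (unc u v) _))

-- From packings to decompositions

-- Empty blocks give no copy and must go. The injection `ι` remembers original indices, so that
-- uniqueness of the copy through an edge survives the removal.
compress : ∀ {A : Set} N (c : Fin N → Maybe A) → Σ (List A) λ xs → Σ (Fin (length xs) → Fin N) λ ι →
  (∀ i → c (ι i) ≡ just (lookup xs i)) × Injective _≡_ _≡_ ι × (∀ j a → c j ≡ just a → ∃ λ i → ι i ≡ j)
compress zero c = [] , (λ ()) , (λ ()) , (λ { {()} }) , λ ()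
compress {A} (suc N) c with compress N (c ∘ F.suc)
... | xs , ι , spec , inj , onto = go (c F.zero) refl
  where
  Result = Σ (List A) λ xs → Σ (Fin (length xs) → Fin (suc N)) λ ι →
    (∀ i → c (ι i) ≡ just (lookup xs i)) × Injective _≡_ _≡_ ι × (∀ j a → c j ≡ just a → ∃ λ i → ι i ≡ j)
  go : ∀ m → c F.zero ≡ m → Result
  go nothing e = xs , F.suc ∘ ι , spec , inj ∘ F.suc-injective , λ
    { F.zero a e′ → contradiction (trans (sym e) e′) λ ()
    ; (F.suc j) a e′ → let (i , q) = onto j a e′ in i , cong F.suc q }
  go (just x) e = x ∷ xs , ι′ , spec′ , inj′ , λ
    { F.zero a e′ → F.zero , refl
    ; (F.suc j) a e′ → let (i , q) = onto j a e′ in F.suc i , cong F.suc q }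
    where
    ι′ : Fin (suc (length xs)) → Fin (suc N)
    ι′ F.zero = F.zero
    ι′ (F.suc i) = F.suc (ι i)
    spec′ : ∀ i → c (ι′ i) ≡ just (lookup (x ∷ xs) i)
    spec′ F.zero = e
    spec′ (F.suc i) = spec i
    inj′ : Injective _≡_ _≡_ ι′
    inj′ {F.zero} {F.zero} _ = refl
    inj′ {F.suc i} {F.suc j} q = cong F.suc (inj (F.suc-injective q))

decomposition : ∀ {k n} {G : Graph n} N (c : Fin N → Maybe (Copy k G)) →
  (∀ u v → Edge G u v → ∃ λ j → (∃ λ C → c j ≡ just C × InCopy C u v) × (∀ j′ C → c j′ ≡ just C → InCopy C u v → j′ ≡ j)) →
  Decomposition k G
decomposition N c cover with compress N c
... | xs , ι , spec , inj , onto = xs , λ u v e → go (cover u v e)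
  where
  go : ∀ {u v} → (∃ λ j → (∃ λ C → c j ≡ just C × InCopy C u v) × (∀ j′ C → c j′ ≡ just C → InCopy C u v → j′ ≡ j)) →
    Σ (Fin (length xs)) λ i → InCopy (lookup xs i) u v × (∀ j → InCopy (lookup xs j) u v → j ≡ i)
  go {u} {v} (j , (C , cj , inC) , uniq) with onto j C cj
  ... | i , refl = i , subst (λ C → InCopy C u v) (just-injective (trans (sym cj) (spec i))) inC ,
    λ i′ inC′ → inj (uniq (ι i′) (lookup xs i′) (spec i′) inC′)

module _ {A : Set} where
  AllPairs-lookup : ∀ {R : A → A → Set} → (∀ {x y} → R x y → R y x) → ∀ {xs} → AllPairs R xs → ∀ {i j} → i ≢ j → R (lookup xs i) (lookup xs j)
  AllPairs-lookup s (px ∷ pxs) {F.zero} {F.zero} ne = contradiction refl ne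
  AllPairs-lookup s (px ∷ pxs) {F.zero} {F.suc j} ne = All.lookup px (∈-lookup j)
  AllPairs-lookup s (px ∷ pxs) {F.suc i} {F.zero} ne = s (All.lookup px (∈-lookup i))
  AllPairs-lookup s (px ∷ pxs) {F.suc i} {F.suc j} ne = AllPairs-lookup s pxs (ne ∘ cong F.suc)

  enum : ∀ {t} (xs : List A) → length xs ≡ t → Fin t → A
  enum xs refl = lookup xs

  enum-∈ : ∀ {t} xs (e : length xs ≡ t) i → enum xs e i ∈ xs
  enum-∈ xs refl i = ∈-lookup i

  enum-surjective : ∀ {t xs} (e : length xs ≡ t) {x} → x ∈ xs → ∃ λ i → enum xs e i ≡ x
  enum-surjective refl x∈ = Any.index x∈ , sym (lookup-index x∈)

  enum-injective : ∀ {t xs} (e : length xs ≡ t) → Unique xs → Injective _≡_ _≡_ (enum xs e)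
  enum-injective refl u {i} {j} e with i F.≟ j
  ... | yes i≡j = i≡j
  ... | no i≢j = contradiction e (AllPairs-lookup (λ ne → ne ∘ sym) u i≢j)

  enum-0 : ∀ {t x y zs} (e : length (x ∷ y ∷ zs) ≡ suc (suc t)) → enum (x ∷ y ∷ zs) e F.zero ≡ x
  enum-0 refl = refl

  enum-1 : ∀ {t x y zs} (e : length (x ∷ y ∷ zs) ≡ suc (suc t)) → enum (x ∷ y ∷ zs) e (F.suc F.zero) ≡ y
  enum-1 refl = refl

others-unique : ∀ {n} {x : Fin n} {xs} → Unique xs → Unique (others x xs)
others-unique {x = x} = Unique.filter⁺ (λ y → ¬? (y F.≟ x))

∈-others⁻ : ∀ {n} {x y : Fin n} {xs} → y ∈ others x xs → y ∈ xs × y ≢ x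
∈-others⁻ {x = x} {xs = xs} = ∈-filter⁻ (λ y → ¬? (y F.≟ x)) {xs = xs}

length-others-unique : ∀ {n} {x : Fin n} {xs} → Unique xs → x ∈ xs → suc (length (others x xs)) ≡ length xs
length-others-unique {x = x} {y ∷ xs} (y∉ ∷ u) (here refl) = cong suc (cong length (trans
  (L.filter-reject (λ y → ¬? (y F.≟ x)) (λ ¬e → ¬e refl)) (L.filter-all (λ y → ¬? (y F.≟ x)) (All.map (λ ne e → ne (sym e)) y∉))))
length-others-unique {x = x} {y ∷ xs} (y∉ ∷ u) (there x∈) = cong suc (trans
  (cong length (L.filter-accept (λ y → ¬? (y F.≟ x)) (All.lookup y∉ x∈))) (length-others-unique u x∈))

module CliqueCopy {n k : ℕ} (G : Graph n) {xs : List (Fin n)} (u : Unique xs)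
  (clique : ∀ {x y} → x ∈ xs → y ∈ xs → x ≢ y → Edge G x y) where

  full : (sh : Shape) → length xs ≡ size k sh → (∀ {a b} → PatAdj k sh a b → a ≢ b) → Copy k G
  full sh e ne = record
    { shape = sh ; φ = enum xs e ; φ-inj = enum-injective e u
    ; φ-edges = λ a b ab → clique (enum-∈ xs e a) (enum-∈ xs e b) (ne ab ∘ enum-injective e u) }

  full⁻ : ∀ sh e (ne : ∀ {a b} → PatAdj k sh a b → a ≢ b) {x y} → InCopy (full sh e ne) x y → x ∈ xs × y ∈ xs × x ≢ y
  full⁻ sh e ne (a , b , ab , refl , refl) = enum-∈ xs e a , enum-∈ xs e b , ne ab ∘ enum-injective e u

  full⁺ : ∀ sh e (ne : ∀ {a b} → PatAdj k sh a b → a ≢ b) {x y} → (∀ {a b} → a ≢ b → PatAdj k sh a b) → x ∈ xs → y ∈ xs → x ≢ y → InCopy (full sh e ne) x y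
  full⁺ sh e ne all x∈ y∈ x≢y with enum-surjective e x∈ | enum-surjective e y∈
  ... | a , refl | b , refl = a , b , all (x≢y ∘ cong (enum xs e)) , refl , refl

-- The pattern lacks the edge between positions 0 and 1, so the block is listed with its missing
-- pair in front.
module MinusCopy {n m : ℕ} (G : Graph n) {x y : Fin n} {zs : List (Fin n)} (u : Unique (x ∷ y ∷ zs))
  (clique : ∀ {a b} → a ∈ x ∷ y ∷ zs → b ∈ x ∷ y ∷ zs → a ≢ b → Edge G a b) (e : length (x ∷ y ∷ zs) ≡ size (suc (suc m)) clique2k-1⁻) where
  open CliqueCopy {k = suc (suc m)} G u clique

  minus : Copy (suc (suc m)) G
  minus = full clique2k-1⁻ e proj₁

  private
    -- Exposes two successors in the size, so that positions 0 and 1 can be matched as elements of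
    -- `Fin`.
    shift : ∀ m → size (suc (suc m)) clique2k-1⁻ ≡ suc (suc (m + m + 1))
    shift m = cong suc (trans (+-suc m (suc (m + 0))) (cong suc (trans (cong (λ z → m + suc z) (+-identityʳ m)) (trans (+-suc m m) (sym (+-comm (m + m) 1))))))

    ends : ∀ {t} → t ≡ suc (suc (m + m + 1)) → (e : length (x ∷ y ∷ zs) ≡ t) → (a b : Fin t) →
      (toℕ a ≡ 0 × toℕ b ≡ 1) → enum (x ∷ y ∷ zs) e a ≡ x × enum (x ∷ y ∷ zs) e b ≡ y
    ends refl e F.zero (F.suc F.zero) _ = enum-0 {y = y} {zs = zs} e , enum-1 {x = x} {zs = zs} e

    starts : ∀ {t} → t ≡ suc (suc (m + m + 1)) → (e : length (x ∷ y ∷ zs) ≡ t) → (a b : Fin t) →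
      enum (x ∷ y ∷ zs) e a ≡ x → enum (x ∷ y ∷ zs) e b ≡ y → toℕ a ≡ 0 × toℕ b ≡ 1
    starts refl e a b p q = cong toℕ (enum-injective e u {a} {F.zero} (trans p (sym (enum-0 {y = y} {zs = zs} e)))) , cong toℕ (enum-injective e u {b} {F.suc F.zero} (trans q (sym (enum-1 {x = x} {zs = zs} e))))

  minus⁻ : ∀ {v w} → InCopy minus v w → v ∈ x ∷ y ∷ zs × w ∈ x ∷ y ∷ zs × v ≢ w × ¬ SamePair v w x y
  minus⁻ c@(a , b , (_ , ¬01) , refl , refl) with full⁻ clique2k-1⁻ e proj₁ c
  ... | v∈ , w∈ , ne = v∈ , w∈ , ne , λ
    { (inj₁ (p , q)) → ¬01 (inj₁ (starts (shift m) e a b p q))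
    ; (inj₂ (p , q)) → ¬01 (inj₂ (let (s , t) = starts (shift m) e b a q p in t , s)) }

  minus⁺ : ∀ {v w} → v ∈ x ∷ y ∷ zs → w ∈ x ∷ y ∷ zs → v ≢ w → ¬ SamePair v w x y → InCopy minus v w
  minus⁺ v∈ w∈ ne ¬same with enum-surjective e v∈ | enum-surjective e w∈
  ... | a , refl | b , refl = a , b , (ne ∘ cong (enum (x ∷ y ∷ zs) e) ,
    λ { (inj₁ ab) → ¬same (inj₁ (ends (shift m) e a b ab)) ; (inj₂ (p , q)) → let (s , t) = ends (shift m) e b a (q , p) in ¬same (inj₂ (t , s)) }) , refl , refl

module Assemble {n m : ℕ} (G : Graph n) (P : Packing (2 * suc (suc m) ∸ 1) n)
  (edges : ∀ b {x y} → x ∈ Packing.block P b → y ∈ Packing.block P b → x ≢ y → Edge G x y)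
  (Qs : List (List (Fin n)))
  (#Q : ∀ {Q} → Q ∈ Qs → length Q ≡ suc (suc m))
  (distinct-Q : ∀ {Q} → Q ∈ Qs → Unique Q)
  (clique : ∀ {Q x y} → Q ∈ Qs → x ∈ Q → y ∈ Q → x ≢ y → Edge G x y)
  (edge-disjoint : AllPairs (λ Q Q′ → ∀ {x y} → x ≢ y → x ∈ Q → y ∈ Q → x ∈ Q′ → y ∈ Q′ → ⊥) Qs)
  (separate : ∀ {Q Q′ x y x′ y′ b} → Q ∈ Qs → Q′ ∈ Qs → x ∈ Q → y ∈ Q → x ≢ y → x′ ∈ Q′ → y′ ∈ Q′ → x′ ≢ y′ →
        Packing.Covers P b x y → Packing.Covers P b x′ y′ → SamePair x y x′ y′)
  (done : ∀ {u v} → u ≢ v → Edge G u v → ¬ Packing.Covered P u v → ∃ λ Q → Q ∈ Qs × u ∈ Q × v ∈ Q)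
  where
  open Packing P

  k = suc (suc m)

  InQs : Fin n → Fin n → Set
  InQs u v = Any (λ Q → u ∈ Q × v ∈ Q) Qs

  inQs? : ∀ u v → Dec (InQs u v)
  inQs? u v = Any.any? (λ Q → Any.any? (u F.≟_) Q ×-dec Any.any? (v F.≟_) Q) Qs

  record BlockCopy (b : Fin #blocks) : Set where
    field
      copy : Maybe (Copy k G)
      copy⁻ : ∀ {C u v} → copy ≡ just C → InCopy C u v → Covers b u v × u ≢ v × ¬ InQs u v
      copy⁺ : ∀ {u v} → Covers b u v → u ≢ v → ¬ InQs u v → ∃ λ C → copy ≡ just C × InCopy C u v

  Touched : Fin #blocks → Set
  Touched b = Any (λ x → Any (λ y → x ≢ y × InQs x y) (block b)) (block b)

  touched? : ∀ b → Dec (Touched b)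
  touched? b = Any.any? (λ x → Any.any? (λ y → ¬? (x F.≟ y) ×-dec inQs? x y) (block b)) (block b)

  -- By `separate` all clique edges inside the block are the same pair, so deleting the one that is
  -- found deletes exactly the edges the cliques have taken.
  block-copy : ∀ b → BlockCopy b
  block-copy b with size-r b
  ... | inj₁ e = record { copy = nothing ; copy⁻ = λ () ; copy⁺ = λ { (p , _) → contradiction (subst (_ ∈_) e p) λ () } }
  ... | inj₂ l with touched? b
  ...   | no ¬t = record
    { copy = just (full clique2k-1 l id)
    ; copy⁻ = λ { refl c → let (u∈ , v∈ , ne) = full⁻ clique2k-1 l id c in (u∈ , v∈) , ne , λ q → ¬t (lose u∈ (lose v∈ (ne , q))) }
    ; copy⁺ = λ { (u∈ , v∈) ne _ → _ , refl , full⁺ clique2k-1 l id id u∈ v∈ ne } }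
    where open CliqueCopy {k = k} G (distinct b) (edges b)
  ...   | yes t with find t
  ...     | x , x∈ , t′ with find t′
  ...       | y , y∈ , x≢y , q with find q
  ...         | Q , Q∈ , x∈Q , y∈Q = record
    { copy = just minus
    ; copy⁻ = λ { refl c → let (u∈ , v∈ , ne , ¬same) = minus⁻ c in (sub⁻ u∈ , sub⁻ v∈) , ne ,
        λ r → let (Q′ , Q′∈ , u∈Q , v∈Q) = find r in ¬same (separate Q′∈ Q∈ u∈Q v∈Q ne x∈Q y∈Q x≢y (sub⁻ u∈ , sub⁻ v∈) (x∈ , y∈)) }
    ; copy⁺ = λ { {u} {v} (u∈ , v∈) ne ¬q → _ , refl , minus⁺ (sub⁺ u∈) (sub⁺ v∈) ne
        λ { (inj₁ (refl , refl)) → ¬q q ; (inj₂ (refl , refl)) → ¬q (lose Q∈ (y∈Q , x∈Q)) } } }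
    where
    zs = others x (others y (block b))
    x∈′ : x ∈ others y (block b)
    x∈′ = ∈-others x∈ x≢y
    sub⁻ : ∀ {v} → v ∈ x ∷ y ∷ zs → v ∈ block b
    sub⁻ (here refl) = x∈
    sub⁻ (there (here refl)) = y∈
    sub⁻ (there (there p)) = proj₁ (∈-others⁻ {x = y} {xs = block b} (proj₁ (∈-others⁻ {x = x} {xs = others y (block b)} p)))
    sub⁺ : ∀ {v} → v ∈ block b → v ∈ x ∷ y ∷ zs
    sub⁺ {v} p with v F.≟ x | v F.≟ y
    ... | yes refl | _ = here refl
    ... | no _ | yes refl = there (here refl)
    ... | no v≢x | no v≢y = there (there (∈-others (∈-others p v≢y) v≢x))
    uniq : Unique (x ∷ y ∷ zs)
    uniq = (x≢y ∷ All.tabulate (λ p e → proj₂ (∈-others⁻ {x = x} {xs = others y (block b)} p) (sym e)))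
      ∷ (All.tabulate (λ p e → proj₂ (∈-others⁻ {x = y} {xs = block b} (proj₁ (∈-others⁻ {x = x} {xs = others y (block b)} p))) (sym e)))
      ∷ others-unique {x = x} (others-unique {x = y} (distinct b))
    len : length (x ∷ y ∷ zs) ≡ 2 * k ∸ 1
    len = trans (cong suc (length-others-unique {x = x} (others-unique {x = y} (distinct b)) x∈′)) (trans (length-others-unique {x = y} (distinct b) y∈) l)
    open MinusCopy {m = m} G uniq (λ p q → edges b (sub⁻ p) (sub⁻ q)) len

  private
    #Qs = length Qs

    module QCopy (i : Fin #Qs) = CliqueCopy {k = k} G (distinct-Q (∈-lookup i)) (clique (∈-lookup i))

    Q-copy : Fin #Qs → Copy k G
    Q-copy i = QCopy.full i cliqueK (#Q (∈-lookup i)) id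

    copies : Fin #Qs ⊎ Fin #blocks → Maybe (Copy k G)
    copies (inj₁ i) = just (Q-copy i)
    copies (inj₂ b) = BlockCopy.copy (block-copy b)

    inQ : ∀ {i u v} → InCopy (Q-copy i) u v → u ∈ lookup Qs i × v ∈ lookup Qs i × u ≢ v
    inQ {i} = QCopy.full⁻ i cliqueK (#Q (∈-lookup i)) id

    cover : ∀ u v → Edge G u v → ∃ λ j → (∃ λ C → copies j ≡ just C × InCopy C u v) × (∀ j′ C → copies j′ ≡ just C → InCopy C u v → j′ ≡ j)
    cover u v uv with inQs? u v
    ... | yes q = inj₁ i , (Q-copy i , refl , QCopy.full⁺ i cliqueK (#Q (∈-lookup i)) id id u∈ v∈ u≢v) , uniq
      where
      i = Any.index q
      u≢v : u ≢ v
      u≢v refl = contradiction (trans (sym uv) (adj-irr G u)) λ ()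
      here-i : u ∈ lookup Qs i × v ∈ lookup Qs i
      here-i = lookup-index q

      u∈ = proj₁ here-i
      v∈ = proj₂ here-i
      uniq : ∀ j′ C → copies j′ ≡ just C → InCopy C u v → j′ ≡ inj₁ i
      uniq (inj₁ i′) C refl c with i′ F.≟ i
      ... | yes e = cong inj₁ e
      ... | no ne = ⊥-elim (AllPairs-lookup (λ {Q} {Q′} d {a} {b} ne p q p′ q′ → d {a} {b} ne p′ q′ p q) edge-disjoint ne u≢v (proj₁ (inQ c)) (proj₁ (proj₂ (inQ c))) u∈ v∈)
      uniq (inj₂ b) C e c = contradiction q (proj₂ (proj₂ (BlockCopy.copy⁻ (block-copy b) e c)))
    ... | no ¬q = by (covered? u v)
      where
      u≢v : u ≢ v
      u≢v refl = contradiction (trans (sym uv) (adj-irr G u)) λ ()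
      by : Dec (Covered u v) → ∃ λ j → (∃ λ C → copies j ≡ just C × InCopy C u v) × (∀ j′ C → copies j′ ≡ just C → InCopy C u v → j′ ≡ j)
      by (no ¬c) = let (Q , Q∈ , u∈ , v∈) = done u≢v uv ¬c in contradiction (lose Q∈ (u∈ , v∈)) ¬q
      by (yes (b , c)) = inj₂ b , BlockCopy.copy⁺ (block-copy b) c u≢v ¬q , uniq
        where
        uniq : ∀ j′ C → copies j′ ≡ just C → InCopy C u v → j′ ≡ inj₂ b
        uniq (inj₁ i) C refl c′ = contradiction (lose (∈-lookup i) (proj₁ (inQ c′) , proj₁ (proj₂ (inQ c′)))) ¬q
        uniq (inj₂ b′) C e c′ with BlockCopy.copy⁻ (block-copy b′) e c′
        ... | (u∈ , v∈) , _ = cong inj₂ (linear u≢v u∈ v∈ (proj₁ c) (proj₂ c))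

  assemble : Decomposition k G
  assemble = decomposition (#Qs + #blocks) (copies ∘ F.splitAt #Qs) λ u v uv →
    let (j , (C , e , c) , uniq) = cover u v uv in
    F.join #Qs #blocks j , (C , trans (cong copies (F.splitAt-join #Qs #blocks j)) e , c) ,
    λ j′ C′ e′ c′ → trans (sym (F.join-splitAt #Qs #blocks j′)) (cong (F.join #Qs #blocks) (uniq (F.splitAt #Qs j′) C′ e′ c′))

-- Numerical estimates

n<2^n : ∀ n → n < 2 ^ n
n<2^n zero = s≤s z≤n
n<2^n (suc n) = begin-strict
  suc n ≤⟨ n<2^n n ⟩
  2 ^ n <⟨ m<m+n (2 ^ n) (≤-trans (m^n>0 2 n) (≤-reflexive (sym (+-identityʳ _)))) ⟩
  2 ^ suc n ∎
  where open ≤-Reasoning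

n<d*suc[n/d] : ∀ n d .{{_ : NonZero d}} → n < d * suc (n / d)
n<d*suc[n/d] n d = begin-strict
  n ≡⟨ m≡m%n+[m/n]*n n d ⟩
  n % d + n / d * d <⟨ +-monoˡ-< _ (m%n<n n d) ⟩
  d + n / d * d ≡⟨ *-comm (suc (n / d)) d ⟩
  d * suc (n / d) ∎
  where open ≤-Reasoning

-- This is (j - 5)² + 3 ≥ 0; the cases avoid subtraction.
10j≤j²+28 : ∀ j → 10 * j ≤ j * j + 28
10j≤j²+28 j with ≤-total 5 j
... | inj₁ le with m≤n⇒∃[o]m+o≡n le
...   | t , refl = ≤-trans (m≤m+n (10 * (5 + t)) (t * t + 3)) (≤-reflexive (c t))
  where
  c : ∀ t → 10 * (5 + t) + (t * t + 3) ≡ (5 + t) * (5 + t) + 28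
  c = solve-∀
10j≤j²+28 j | inj₂ le with m≤n⇒∃[o]m+o≡n le
...   | t , e = begin
  10 * j ≡⟨ c₁ j ⟩
  2 * j * 5 ≡⟨ cong (2 * j *_) (sym e) ⟩
  2 * j * (j + t) ≤⟨ m≤m+n _ (t * t) ⟩
  2 * j * (j + t) + t * t ≡⟨ c₂ j t ⟩
  j * j + (j + t) * (j + t) ≡⟨ cong (λ z → j * j + z * z) e ⟩
  j * j + 25 ≤⟨ +-monoʳ-≤ (j * j) (m≤m+n 25 3) ⟩
  j * j + 28 ∎
  where
  open ≤-Reasoning
  c₁ : ∀ j → 10 * j ≡ 2 * j * 5
  c₁ = solve-∀
  c₂ : ∀ j t → 2 * j * (j + t) + t * t ≡ j * j + (j + t) * (j + t)
  c₂ = solve-∀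

-- The binomial expansion begins with j^8 + 8j^7 + 28j^6, and the first and third terms together
-- exceed 10j^7.
18j⁷≤[1+j]⁸ : ∀ j → 18 * (j ^ 6 * j) ≤ suc j ^ 8
18j⁷≤[1+j]⁸ j = begin
  18 * (j ^ 6 * j) ≡⟨ c₁ (j ^ 6) j ⟩
  j ^ 6 * (10 * j) + 8 * (j ^ 6 * j) ≤⟨ +-monoˡ-≤ _ (*-monoʳ-≤ (j ^ 6) (10j≤j²+28 j)) ⟩
  j ^ 6 * (j * j + 28) + 8 * (j ^ 6 * j) ≤⟨ m≤m+n _ (1 + 8 * j + 28 * (j * j) + 56 * (j * j * j) + 70 * (j * j * j * j) + 56 * (j * j * j * j * j)) ⟩
  j ^ 6 * (j * j + 28) + 8 * (j ^ 6 * j) + (1 + 8 * j + 28 * (j * j) + 56 * (j * j * j) + 70 * (j * j * j * j) + 56 * (j * j * j * j * j)) ≡⟨ c₂ j ⟩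
  suc j ^ 8 ∎
  where
  open ≤-Reasoning
  c₁ : ∀ a j → 18 * (a * j) ≡ a * (10 * j) + 8 * (a * j)
  c₁ = solve-∀
  c₂ : ∀ j → (j * (j * (j * (j * (j * (j * 1)))))) * (j * j + 28) + 8 * ((j * (j * (j * (j * (j * (j * 1)))))) * j) + (1 + 8 * j + 28 * (j * j) + 56 * (j * j * j) + 70 * (j * j * j * j) + 56 * (j * j * j * j * j)) ≡ ((1 + j) * ((1 + j) * ((1 + j) * ((1 + j) * ((1 + j) * ((1 + j) * ((1 + j) * ((1 + j) * 1))))))))
  c₂ = solve-∀

2*#new : ∀ m → 2 * #new m ≡ m * (m + 3)
2*#new zero = refl
2*#new (suc m) = trans (c₁ m (#new m)) (trans (cong (2 * (2 + m) +_) (2*#new m)) (c₂ m))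
  where
  c₁ : ∀ m x → 2 * (2 + m + x) ≡ 2 * (2 + m) + 2 * x
  c₁ = solve-∀
  c₂ : ∀ m → 2 * (2 + m) + m * (m + 3) ≡ (1 + m) * (1 + m + 3)
  c₂ = solve-∀

-- As r·s grows like j³, the left side grows like 18j^9. The power is split as 8 + 2: 18j^7 is at
-- most (j + 1)^8, and j(j + 2) is at most (j + 1)².
usage-bound : ∀ m → let j = suc m in 18 * (j ^ 6 * (suc (2 * j) * #new m)) ≤ suc j ^ 10
usage-bound m = begin
  18 * (j ^ 6 * (suc (2 * j) * #new m)) ≡⟨ c₁ (j ^ 6) (suc (2 * j)) (#new m) ⟩
  9 * (j ^ 6 * (suc (2 * j) * (2 * #new m))) ≡⟨ cong (λ z → 9 * (j ^ 6 * (suc (2 * j) * z))) (2*#new m) ⟩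
  9 * (j ^ 6 * (suc (2 * j) * (m * (m + 3)))) ≡⟨ cong (λ z → 9 * (j ^ 6 * z)) (sym (*-assoc (suc (2 * j)) m (m + 3))) ⟩
  9 * (j ^ 6 * (suc (2 * j) * m * (m + 3))) ≤⟨ *-monoʳ-≤ 9 (*-monoʳ-≤ (j ^ 6) (*-monoˡ-≤ (m + 3) b₁)) ⟩
  9 * (j ^ 6 * (2 * (j * j) * (m + 3))) ≡⟨ c₂ (j ^ 6) j m ⟩
  18 * (j ^ 6 * j) * (j * (m + 3)) ≤⟨ *-mono-≤ (18j⁷≤[1+j]⁸ j) b₂ ⟩
  suc j ^ 8 * suc j ^ 2 ≡⟨ ^-distribˡ-+-* (suc j) 8 2 ⟨
  suc j ^ 10 ∎
  where
  open ≤-Reasoning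
  j = suc m
  c₁ : ∀ a r s → 18 * (a * (r * s)) ≡ 9 * (a * (r * (2 * s)))
  c₁ = solve-∀
  c₂ : ∀ a j m → 9 * (a * (2 * (j * j) * (m + 3))) ≡ 18 * (a * j) * (j * (m + 3))
  c₂ = solve-∀
  b₁ : suc (2 * j) * m ≤ 2 * (j * j)
  b₁ = ≤-trans (m≤m+n _ (m + 2)) (≤-reflexive (c m))
    where
    c : ∀ m → (1 + 2 * (1 + m)) * m + (m + 2) ≡ 2 * ((1 + m) * (1 + m))
    c = solve-∀
  b₂ : j * (m + 3) ≤ suc j ^ 2
  b₂ = ≤-trans (n≤1+n _) (≤-reflexive (c m))
    where
    c : ∀ m → 1 + (1 + m) * (m + 3) ≡ ((2 + m) * ((2 + m) * 1))
    c = solve-∀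

64j⁵≤[1+j]¹⁰ : ∀ j → 2 ≤ j → 64 * j ^ 5 ≤ suc j ^ 10
64j⁵≤[1+j]¹⁰ j 2≤j = begin
  -- Since j ≥ 2, (j + 1)^5 is at least 3^5 = 243 = 64 + 179.
  64 * j ^ 5 ≤⟨ *-mono-≤ (≤-trans (m≤m+n 64 179) (^-monoˡ-≤ 5 (s≤s 2≤j))) (^-monoˡ-≤ 5 (n≤1+n j)) ⟩
  suc j ^ 5 * suc j ^ 5 ≡⟨ ^-distribˡ-+-* (suc j) 5 5 ⟨
  suc j ^ 10 ∎
  where open ≤-Reasoning

-- The three main terms take up 6/24, 16/24 and 1/24 of n.
room-bound : ∀ m w s cap d n K → let j = suc m; M = 6 * (j * j * d); σ = 9 * (j * j) * (suc w * (s * M)) in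
  w ≡ 2 * j → 18 * (j ^ 6 * (suc w * s)) ≤ K → 64 * j ^ 5 ≤ K → 9 * K * d ≤ n → 8 * (j * j) * cap ≤ n → 24 * (j + 4 * (j * j) * s) < n →
  j * (suc M + w * (cap + s + m * (M + M) + s) + w * σ) < n
room-bound m w s cap d n K refl hσ hM hd hcap hs = *-cancelˡ-< 24 _ _ (begin-strict
  24 * (j * (suc M + w * (cap + s + m * (M + M) + s) + w * σ)) ≡⟨ c₁ m s cap M σ ⟩
  24 * (j + 4 * (j * j) * s) + ((24 * j + 96 * (j * j) * m) * M + 6 * (8 * (j * j) * cap) + 48 * (j * j) * σ) <⟨ +-monoˡ-< _ hs ⟩
  n + ((24 * j + 96 * (j * j) * m) * M + 6 * (8 * (j * j) * cap) + 48 * (j * j) * σ) ≤⟨ +-monoʳ-≤ n (+-mono-≤ (+-mono-≤ bM (*-monoʳ-≤ 6 hcap)) bσ) ⟩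
  n + (n + 6 * n + 16 * n) ≡⟨ c₂ n ⟩
  24 * n ∎)
  where
  open ≤-Reasoning
  j = suc m
  M = 6 * (j * j * d)
  σ = 9 * (j * j) * (suc w * (s * M))
  c₁ : ∀ m s cap M σ → 24 * ((1 + m) * (1 + M + 2 * (1 + m) * (cap + s + m * (M + M) + s) + 2 * (1 + m) * σ)) ≡
    24 * ((1 + m) + 4 * ((1 + m) * (1 + m)) * s) + ((24 * (1 + m) + 96 * ((1 + m) * (1 + m)) * m) * M + 6 * (8 * ((1 + m) * (1 + m)) * cap) + 48 * ((1 + m) * (1 + m)) * σ)
  c₁ = solve-∀
  c₂ : ∀ n → n + (n + 6 * n + 16 * n) ≡ 24 * n
  c₂ = solve-∀
  bM : (24 * j + 96 * (j * j) * m) * M ≤ n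
  bM = begin
    (24 * j + 96 * (j * j) * m) * M ≤⟨ m≤m+n _ ((24 * m * (1 + m) + 72 * (j * j)) * M) ⟩
    (24 * j + 96 * (j * j) * m) * M + (24 * m * (1 + m) + 72 * (j * j)) * M ≡⟨ c m d ⟩
    9 * (64 * j ^ 5) * d ≤⟨ *-monoˡ-≤ d (*-monoʳ-≤ 9 hM) ⟩
    9 * K * d ≤⟨ hd ⟩
    n ∎
    where
    c : ∀ m d → (24 * (1 + m) + 96 * ((1 + m) * (1 + m)) * m) * (6 * ((1 + m) * (1 + m) * d)) + (24 * m * (1 + m) + 72 * ((1 + m) * (1 + m))) * (6 * ((1 + m) * (1 + m) * d)) ≡ 9 * (64 * ((1 + m) * ((1 + m) * ((1 + m) * ((1 + m) * ((1 + m) * 1)))))) * d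
    c = solve-∀
  bσ : 48 * (j * j) * σ ≤ 16 * n
  bσ = begin
    48 * (j * j) * σ ≡⟨ c j w s d ⟩
    144 * (18 * (j ^ 6 * (suc w * s))) * d ≤⟨ *-monoˡ-≤ d (*-monoʳ-≤ 144 hσ) ⟩
    144 * K * d ≡⟨ c′ K d ⟩
    16 * (9 * K * d) ≤⟨ *-monoʳ-≤ 16 hd ⟩
    16 * n ∎
    where
    c : ∀ j w s d → 48 * (j * j) * (9 * (j * j) * ((1 + w) * (s * (6 * (j * j * d))))) ≡ 144 * (18 * ((j * (j * (j * (j * (j * (j * 1)))))) * ((1 + w) * s))) * d
    c = solve-∀
    c′ : ∀ K d → 144 * K * d ≡ 16 * (9 * K * d)
    c′ = solve-∀

-- With t at most 3ρd/2 and ρ + 1 = 2j, the left side is at most d + 2jd + 3j(2j - 1)d = 6j²d + d -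
-- jd. This is where the 6 in `M` comes from.
uncovered-bound : ∀ j ρ l d t → 1 ≤ j → suc ρ ≡ 2 * j → l ≤ d → 4 * t ≤ 6 * (ρ * d) → l + (d + t) * suc ρ ≤ 6 * (j * j * d)
uncovered-bound j ρ l d t 1≤j ρj l≤d t≤ = *-cancelˡ-≤ 2 (+-cancelʳ-≤ (2 * (j * d)) _ _ (begin
  2 * (l + (d + t) * suc ρ) + 2 * (j * d) ≡⟨ cong (λ z → 2 * (l + (d + t) * z) + 2 * (j * d)) ρj ⟩
  2 * (l + (d + t) * (2 * j)) + 2 * (j * d) ≡⟨ c₁ l d t j ⟩
  2 * l + (j * (4 * t) + 6 * (j * d)) ≤⟨ +-mono-≤ (*-monoʳ-≤ 2 (≤-trans l≤d (≤-trans (≤-reflexive (sym (*-identityˡ d))) (*-monoˡ-≤ d 1≤j)))) (+-monoˡ-≤ _ (*-monoʳ-≤ j t≤)) ⟩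
  2 * (j * d) + (j * (6 * (ρ * d)) + 6 * (j * d)) ≡⟨ c₂ j ρ d ⟩
  2 * (j * d) + 6 * (j * (suc ρ * d)) ≡⟨ cong (λ z → 2 * (j * d) + 6 * (j * (z * d))) ρj ⟩
  2 * (j * d) + 6 * (j * (2 * j * d)) ≡⟨ c₃ j d ⟩
  2 * (6 * (j * j * d)) + 2 * (j * d) ∎))
  where
  open ≤-Reasoning
  c₁ : ∀ l d t j → 2 * (l + (d + t) * (2 * j)) + 2 * (j * d) ≡ 2 * l + (j * (4 * t) + 6 * (j * d))
  c₁ = solve-∀
  c₂ : ∀ j ρ d → 2 * (j * d) + (j * (6 * (ρ * d)) + 6 * (j * d)) ≡ 2 * (j * d) + 6 * (j * ((1 + ρ) * d))
  c₂ = solve-∀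
  c₃ : ∀ j d → 2 * (j * d) + 6 * (j * (2 * j * d)) ≡ 2 * (6 * (j * j * d)) + 2 * (j * d)
  c₃ = solve-∀

-- The ratio of K₁ = 11c to K₂ = 9c + 1 is below 11/9, and T₀ is at least 5/4 of ρd. Since 5·9 =
-- 11·4 + 1, one unit of c·n·T₀ is left, and it absorbs 55·c·T₀ once n ≥ 55.
drift-bound : ∀ n c ρ d T₀ → 55 ≤ n → 5 * (ρ * d) ≤ 4 * T₀ → (10 * c + c) * (n * (ρ * d) + T₀) ≤ n * (9 * c + 1) * T₀
drift-bound n c ρ d T₀ 55≤n h = *-cancelˡ-≤ 5 (begin
  5 * ((10 * c + c) * (n * (ρ * d) + T₀)) ≡⟨ c₁ n c (ρ * d) T₀ ⟩
  11 * (c * n) * (5 * (ρ * d)) + 55 * (c * T₀) ≤⟨ +-mono-≤ (*-monoʳ-≤ (11 * (c * n)) h) (*-monoˡ-≤ (c * T₀) 55≤n) ⟩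
  11 * (c * n) * (4 * T₀) + n * (c * T₀) ≤⟨ m≤m+n _ (5 * (n * T₀)) ⟩
  11 * (c * n) * (4 * T₀) + n * (c * T₀) + 5 * (n * T₀) ≡⟨ c₂ n c T₀ ⟩
  5 * (n * (9 * c + 1) * T₀) ∎)
  where
  open ≤-Reasoning
  c₁ : ∀ n c x t → 5 * ((10 * c + c) * (n * x + t)) ≡ 11 * (c * n) * (5 * x) + 55 * (c * t)
  c₁ = solve-∀
  c₂ : ∀ n c t → 11 * (c * n) * (4 * t) + n * (c * t) + 5 * (n * t) ≡ 5 * (n * (9 * c + 1) * t)
  c₂ = solve-∀

-- The left side is at most a constant times (x + 1)³. One more factor x + 1 beats the constant, and
-- (x + 1)^4 is at most 2^(4x).
exponential-bound : ∀ n K₁ ρ d C x → n ≤ C * suc x → d ≤ n → suc (K₁ * ρ * (C * C * C)) ≤ x → n * (K₁ * (n * (ρ * d))) < 2 ^ (x * 4)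
exponential-bound n K₁ ρ d C x nx dn xl = begin-strict
  n * (K₁ * (n * (ρ * d))) ≡⟨ c₁ n K₁ ρ d ⟩
  K₁ * ρ * (n * n * d) ≤⟨ *-monoʳ-≤ (K₁ * ρ) (*-mono-≤ (*-mono-≤ nx nx) (≤-trans dn nx)) ⟩
  K₁ * ρ * (C * suc x * (C * suc x) * (C * suc x)) ≡⟨ c₂ (K₁ * ρ) C (suc x) ⟩
  K₁ * ρ * (C * C * C) * (suc x * suc x * suc x) <⟨ *-monoˡ-< (suc x * suc x * suc x) (m<n⇒m<1+n xl) ⟩
  suc x * (suc x * suc x * suc x) ≡⟨ c₃ (suc x) ⟩
  suc x ^ 4 ≤⟨ ^-monoˡ-≤ 4 (n<2^n x) ⟩
  (2 ^ x) ^ 4 ≡⟨ ^-*-assoc 2 x 4 ⟩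
  2 ^ (x * 4) ∎
  where
  open ≤-Reasoning
  c₁ : ∀ n k ρ d → n * (k * (n * (ρ * d))) ≡ k * ρ * (n * n * d)
  c₁ = solve-∀
  c₂ : ∀ a C y → a * (C * y * (C * y) * (C * y)) ≡ a * (C * C * C) * (y * y * y)
  c₂ = solve-∀
  c₃ : ∀ y → y * (y * y * y) ≡ (y * (y * (y * (y * 1))))
  c₃ = solve-∀

d*x≤n⇒x≤n/d : ∀ {x n} d .{{_ : NonZero d}} → d * x ≤ n → x ≤ n / d
d*x≤n⇒x≤n/d {x} {n} d le = s≤s⁻¹ (*-cancelˡ-< d x (suc (n / d)) (≤-<-trans le (n<d*suc[n/d] n d)))

nonEdges+degree : ∀ {n} (G : Graph n) v → ∑ (allFin n) (Complement.h G v) + degree G v ≤ n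
nonEdges+degree {n} G v = begin
  ∑ (allFin n) (h v) + ∑ (allFin n) (λ w → if adj G v w then 1 else 0) ≡⟨ ∑-+ (allFin n) (h v) _ ⟨
  ∑ (allFin n) (λ w → h v w + (if adj G v w then 1 else 0)) ≤⟨ ∑-≤const (allFin n) 1 one ⟩
  length (allFin n) * 1 ≡⟨ trans (*-identityʳ _) (length-allFin n) ⟩
  n ∎
  where
  open ≤-Reasoning
  open Complement G
  at-most-one : ∀ {w} (e? : Dec (NonEdge v w)) b → adj G v w ≡ b → 𝟙 e? + (if b then 1 else 0) ≤ 1
  at-most-one (yes (_ , e)) true e′ = contradiction (trans (sym e) e′) λ ()
  at-most-one (yes _) false _ = ≤-refl
  at-most-one (no _) true _ = ≤-refl
  at-most-one (no _) false _ = z≤n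
  one : ∀ w → h v w + (if adj G v w then 1 else 0) ≤ 1
  one w = at-most-one (nonEdge? v w) (adj G v w) refl

-- Decomposition of dense graphs of large order

-- K is k ^ 10, kept abstract so that the power is never unfolded.
module Dense (m′ K : ℕ) (0<K : 0 < K)
  (usage : 18 * (suc (suc m′) ^ 6 * (suc (2 * suc (suc m′)) * #new (suc m′))) ≤ K) (64j⁵≤K : 64 * suc (suc m′) ^ 5 ≤ K) where

  m = suc m′
  j = suc m
  k = suc j

  private
    ρ = m′ + (k + 0)
    w = suc ρ
    w≡2j : w ≡ 2 * j
    w≡2j = c m′
      where
      c : ∀ m → 1 + (m + (3 + m + 0)) ≡ 2 * (2 + m)
      c = solve-∀
    s = #new m
    E = 9 * K
    instance
      nzE : NonZero E
      nzE = m*n≢0 9 K {{_}} {{>-nonZero 0<K}}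
    c = 4 * ρ + 4
    Z = 10 * c
    K₁ = Z + c
    -- Since `r ^ depth` exceeds 2E, the leftover is at most (n + C)/(2E), which is at most `d` once
    -- C < d.
    depth = 2 * E
    -- With x = d / D and J = 4x, the summand 16Z pays for four times J·Z, and the 4 pays for the
    -- rounding in `T₀`; together they cost at most `d`.
    D = 16 * Z + 4
    instance
      nzD : NonZero D
      nzD = >-nonZero (≤-trans (s≤s z≤n) (m≤n+m 4 (16 * Z)))
    C = proj₁ (almost-decomposition w depth)
    X₀ = suc (K₁ * ρ * (E * D * (E * D) * (E * D)))

  -- The summands secure, in this order, x ≥ X₀ for the exponential bound, n ≥ 55 for the drift, C <
  -- d for the leftover, cap ≥ 8, and the lower-order terms of `room-bound`.
  N = E * (D * X₀) + (55 + (E * suc C + (8 * (j * j) * 8 + suc (24 * (j + 4 * (j * j) * s)))))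

  module _ {n : ℕ} (N≤n : N ≤ n) (G : Graph n) (dense : ∀ v → E * n ≤ E * degree G v + n) where
    private
      N₁ : E * (D * X₀) ≤ n
      N₁ = m+n≤o⇒m≤o _ N≤n
      N₂ : 55 + (E * suc C + (8 * (j * j) * 8 + suc (24 * (j + 4 * (j * j) * s)))) ≤ n
      N₂ = m+n≤o⇒n≤o (E * (D * X₀)) N≤n
      N₃ : E * suc C + (8 * (j * j) * 8 + suc (24 * (j + 4 * (j * j) * s))) ≤ n
      N₃ = m+n≤o⇒n≤o 55 N₂
      N₄ : 8 * (j * j) * 8 + suc (24 * (j + 4 * (j * j) * s)) ≤ n
      N₄ = m+n≤o⇒n≤o (E * suc C) N₃
      55≤n : 55 ≤ n
      55≤n = m+n≤o⇒m≤o 55 N₂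

      d = n / E
      Ed≤n : E * d ≤ n
      Ed≤n = ≤-trans (≤-reflexive (*-comm E d)) (m/n*n≤m n E)
      d≤n : d ≤ n
      d≤n = ≤-trans (m≤n*m d E) Ed≤n
      DX₀≤d : D * X₀ ≤ d
      DX₀≤d = d*x≤n⇒x≤n/d E N₁
      C<d : suc C ≤ d
      C<d = d*x≤n⇒x≤n/d E (m+n≤o⇒m≤o _ N₃)

      open Complement G

      h-deg : ∀ v → ∑ (allFin n) (h v) ≤ d
      h-deg v = d*x≤n⇒x≤n/d E (+-cancelʳ-≤ (E * degree G v) _ _ (begin
        E * ∑ (allFin n) (h v) + E * degree G v ≡⟨ *-distribˡ-+ E _ _ ⟨
        E * (∑ (allFin n) (h v) + degree G v) ≤⟨ *-monoʳ-≤ E (nonEdges+degree G v) ⟩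
        E * n ≤⟨ dense v ⟩
        E * degree G v + n ≡⟨ +-comm (E * degree G v) n ⟩
        n + E * degree G v ∎))
        where open ≤-Reasoning

      P₀ : Packing (suc w) n
      P₀ = proj₁ (proj₂ (almost-decomposition w depth) n)
      l = proj₁ (proj₂ (proj₂ (almost-decomposition w depth) n))
      left₀ : Packing.Leftover P₀ l
      left₀ = proj₁ (proj₂ (proj₂ (proj₂ (almost-decomposition w depth) n)))

      l≤d : l ≤ d
      l≤d = *-cancelʳ-≤ l d (2 * E) {{m*n≢0 2 E}} (begin
        l * (2 * E) ≤⟨ *-monoʳ-≤ l (≤-trans (<⇒≤ (n<2^n (2 * E))) (^-monoˡ-≤ (2 * E) {2} {suc w} (s≤s (s≤s z≤n)))) ⟩
        l * suc w ^ depth ≤⟨ proj₂ (proj₂ (proj₂ (proj₂ (almost-decomposition w depth) n))) ⟩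
        n + C ≤⟨ +-mono-≤ (<⇒≤ (n<d*suc[n/d] n E)) (m≤n*m C E) ⟩
        E * suc d + E * C ≡⟨ c₁ E d C ⟩
        E * d + E * suc C ≤⟨ +-monoʳ-≤ (E * d) (*-monoʳ-≤ E C<d) ⟩
        E * d + E * d ≡⟨ c₂ E d ⟩
        d * (2 * E) ∎)
        where
        open ≤-Reasoning
        c₁ : ∀ E d C → E * (1 + d) + E * C ≡ E * d + E * (1 + C)
        c₁ = solve-∀
        c₂ : ∀ E d → E * d + E * d ≡ d * (2 * E)
        c₂ = solve-∀

      open Cohabitation {ρ} P₀

      x = d / D
      X₀≤x : X₀ ≤ x
      X₀≤x = d*x≤n⇒x≤n/d D DX₀≤d
      J = x * 4
      -- Just above 5/4 of ρd, as `drift-bound` demands; the remaining quarter up to 3/2 of ρd is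
      -- left for J·Z and rounding.
      T₀ = ρ * d + suc (ρ * d / 4)

      5ρd≤4T₀ : 5 * (ρ * d) ≤ 4 * T₀
      5ρd≤4T₀ = begin
        5 * (ρ * d) ≡⟨ *-distribʳ-+ (ρ * d) 4 1 ⟩
        4 * (ρ * d) + 1 * (ρ * d) ≤⟨ +-monoʳ-≤ (4 * (ρ * d)) (≤-trans (≤-reflexive (*-identityˡ _)) (<⇒≤ (n<d*suc[n/d] (ρ * d) 4))) ⟩
        4 * (ρ * d) + 4 * suc (ρ * d / 4) ≡⟨ *-distribˡ-+ 4 (ρ * d) _ ⟨
        4 * T₀ ∎
        where open ≤-Reasoning

      K₁<nK₂ : K₁ < n * (9 * c + 1)
      K₁<nK₂ = begin-strict
        10 * c + c <⟨ m<m+n _ (s≤s z≤n) ⟩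
        10 * c + c + suc (7 * c + 1) ≡⟨ c₁ c ⟩
        2 * (9 * c + 1) ≤⟨ *-monoˡ-≤ (9 * c + 1) (≤-trans (m≤m+n 2 53) 55≤n) ⟩
        n * (9 * c + 1) ∎
        where
        open ≤-Reasoning
        c₁ : ∀ c → 10 * c + c + (1 + (7 * c + 1)) ≡ 2 * (9 * c + 1)
        c₁ = solve-∀

      n≤ : n ≤ E * D * suc x
      n≤ = begin
        n ≤⟨ <⇒≤ (n<d*suc[n/d] n E) ⟩
        E * suc d ≤⟨ *-monoʳ-≤ E (n<d*suc[n/d] d D) ⟩
        E * (D * suc x) ≡⟨ *-assoc E D (suc x) ⟨
        E * D * suc x ∎
        where open ≤-Reasoning

      K₂c : (9 * c + 1) + c ≡ suc Z
      K₂c = c₁ c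
        where
        c₁ : ∀ c → 9 * c + 1 + c ≡ 1 + 10 * c
        c₁ = solve-∀

      placement = SmallOverlap.small-overlap h h-sym h-diag h≤1 d h-deg S S-sym S-diag S≤1 ρ S-deg Z (9 * c + 1)
        (≤-trans (≤-trans (s≤s z≤n) (m≤n+m 4 (4 * ρ))) (m≤n*m c 10)) K₂c T₀ J (drift-bound n c ρ d T₀ 55≤n 5ρd≤4T₀) K₁<nK₂
        (exponential-bound n K₁ ρ d (E * D) x n≤ d≤n X₀≤x)

      π = proj₁ placement
      t = T₀ + J * Z

      open Overlap h h-sym h-diag using (total)

      small : ∀ q → total (S q) (π ⟨$⟩ʳ_) ≤ t
      small q = s≤s⁻¹ (≤-trans (proj₂ placement q) (≤-reflexive (+-suc T₀ (J * Z))))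

      4t≤6ρd : 4 * t ≤ 6 * (ρ * d)
      4t≤6ρd = begin
        4 * (ρ * d + suc (ρ * d / 4) + x * 4 * Z) ≡⟨ c₁ (ρ * d) (ρ * d / 4) x Z ⟩
        4 * (ρ * d) + ρ * d / 4 * 4 + (1 * 4 + x * (16 * Z)) ≤⟨ +-mono-≤ (+-monoʳ-≤ (4 * (ρ * d)) (m/n*n≤m (ρ * d) 4)) (+-monoˡ-≤ _ (*-monoˡ-≤ 4 (≤-trans (s≤s z≤n) X₀≤x))) ⟩
        4 * (ρ * d) + ρ * d + (x * 4 + x * (16 * Z)) ≡⟨ cong (4 * (ρ * d) + ρ * d +_) (c₂ x Z) ⟩
        4 * (ρ * d) + ρ * d + x * D ≤⟨ +-monoʳ-≤ _ (≤-trans (m/n*n≤m d D) (m≤n*m d ρ {{ρ≢0}})) ⟩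
        4 * (ρ * d) + ρ * d + ρ * d ≡⟨ c₃ (ρ * d) ⟩
        6 * (ρ * d) ∎
        where
        open ≤-Reasoning
        ρ≢0 : NonZero ρ
        ρ≢0 = >-nonZero (≤-trans (s≤s z≤n) (m≤n+m (k + 0) m′))
        c₁ : ∀ a b x Z → 4 * (a + (1 + b) + x * 4 * Z) ≡ 4 * a + b * 4 + (1 * 4 + x * (16 * Z))
        c₁ = solve-∀
        c₂ : ∀ x Z → x * 4 + x * (16 * Z) ≡ x * (16 * Z + 4)
        c₂ = solve-∀
        c₃ : ∀ a → 4 * a + a + a ≡ 6 * a
        c₃ = solve-∀

      open CleanBlocks {ρ} G P₀ π

      M = 6 * (j * j * d)

      left : Packing.Leftover clean M
      left v = let (us , len , cov) = clean-leftover left₀ h-deg small v in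
        us , ≤-trans len (uncovered-bound j ρ l d t (s≤s z≤n) w≡2j l≤d 4t≤6ρd) , cov

      -- The touched blocks below the cap then exclude at most j·w·cap = 2j²·cap ≤ n/4 vertices.
      -- From cap ≥ 8 follows n ≤ 9j²·cap, the source of the 9 in `σ`.
      cap = n / (8 * (j * j))
      8≤cap : 8 ≤ cap
      8≤cap = d*x≤n⇒x≤n/d (8 * (j * j)) (m+n≤o⇒m≤o _ N₄)

      σ = 9 * (j * j) * (suc w * (s * M))

      n≤9j²cap : n ≤ 9 * (j * j) * cap
      n≤9j²cap = begin
        n ≤⟨ <⇒≤ (n<d*suc[n/d] n (8 * (j * j))) ⟩
        8 * (j * j) * suc cap ≡⟨ c₁ (j * j) cap ⟩
        j * j * 8 + 8 * (j * j) * cap ≤⟨ +-monoˡ-≤ _ (*-monoʳ-≤ (j * j) 8≤cap) ⟩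
        j * j * cap + 8 * (j * j) * cap ≡⟨ c₂ (j * j) cap ⟩
        9 * (j * j) * cap ∎
        where
        open ≤-Reasoning
        c₁ : ∀ a b → 8 * a * (1 + b) ≡ a * 8 + 8 * a * b
        c₁ = solve-∀
        c₂ : ∀ a b → a * b + 8 * a * b ≡ 9 * a * b
        c₂ = solve-∀

      σ-large : ∀ y → y * cap ≤ suc w * (s * (n * M)) → y ≤ σ
      σ-large y le = *-cancelʳ-≤ y σ cap {{>-nonZero (≤-trans (s≤s z≤n) 8≤cap)}} (begin
        y * cap ≤⟨ le ⟩
        suc w * (s * (n * M)) ≤⟨ *-monoʳ-≤ (suc w) (*-monoʳ-≤ s (*-monoˡ-≤ M n≤9j²cap)) ⟩
        suc w * (s * (9 * (j * j) * cap * M)) ≡⟨ c₁ (suc w) s (9 * (j * j)) cap M ⟩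
        σ * cap ∎)
        where
        open ≤-Reasoning
        c₁ : ∀ r s a b M → r * (s * (a * b * M)) ≡ a * (r * (s * M)) * b
        c₁ = solve-∀

      room : suc m * (suc M + w * (cap + s + m * (M + M) + s) + w * σ) < n
      room = room-bound m w s cap d n K w≡2j
        (≤-trans (≤-reflexive (cong (λ z → 18 * (j ^ 6 * (suc z * s))) w≡2j)) usage) 64j⁵≤K Ed≤n
        (≤-trans (≤-reflexive (*-comm (8 * (j * j)) cap)) (m/n*n≤m n (8 * (j * j))))
        (m+n≤o⇒n≤o (8 * (j * j) * 8) N₄)

      state = Greedy.cliques G clean clean-edges left m cap σ σ-large room
      open Greedy.State state

    dense-decomposition : Decomposition k G
    dense-decomposition = Assemble.assemble {m = m} G clean clean-edges Qs #Q distinct-Q clique edge-disjoint separate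
      (done (Greedy.∈-all-pairs G clean clean-edges left m cap σ σ-large room _ _))

-- The error function and the theorem

-- Below N the threshold exceeds n, so only n = 0 remains there.
module LargeOrder (k N E : ℕ) (0<E : 0 < E)
  (threshold-E : ∀ n c D (f : ℕ → ℚ) → f n ≡ ℕ→ℚ c → threshold k f n ≤ℚ ℕ→ℚ D → E * n + E * c ≤ E * D + n)
  (decompose : ∀ {n} → N ≤ n → (G : Graph n) → (∀ v → E * n ≤ E * degree G v + n) → Decomposition k G) where

  f : ℕ → ℚ
  f n with n <? N
  ... | yes _ = ℕ→ℚ (suc n)
  ... | no _ = 0ℚ

  f-small : ∀ {n} → n < N → f n ≡ ℕ→ℚ (suc n)
  f-small {n} lt with n <? N
  ... | yes _ = refl
  ... | no ge = contradiction lt ge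

  f-large : ∀ {n} → N ≤ n → f n ≡ ℕ→ℚ 0
  f-large {n} ge with n <? N
  ... | yes lt = contradiction ge (<⇒≱ lt)
  ... | no _ = refl

  f-littleo : IsLittleO-n f
  f-littleo ε 0<ε = N , λ n N≤n → subst (λ z → ℚ.∣ z ∣ ≤ℚ ε ℚ.* ℕ→ℚ n) (sym (f-large N≤n))
    (ℚ.nonNegative⁻¹ (ε ℚ.* ℕ→ℚ n) {{ℚ.nonNeg*nonNeg⇒nonNeg ε {{ℚ.nonNegative (ℚ.<⇒≤ 0<ε)}} (ℕ→ℚ n) {{ℚ.normalize-nonNeg n 1}}}})

  decomposes : ∀ (n : ℕ) (G : Graph n) → (∀ (v : Fin n) → threshold k f n ≤ℚ ℕ→ℚ (degree G v)) → Decomposition k G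
  decomposes zero G _ = [] , λ ()
  decomposes n@(suc _) G h = by (n <? N)
    where
    open ≤-Reasoning
    v : Fin n
    v = Fin.zero
    by : Dec (n < N) → Decomposition k G
    by (yes n<N) = contradiction (begin-strict
      E * n + n <⟨ +-monoʳ-< (E * n) (n<1+n n) ⟩
      E * n + suc n ≤⟨ +-monoʳ-≤ (E * n) (m≤n*m (suc n) E {{>-nonZero 0<E}}) ⟩
      E * n + E * suc n ≤⟨ threshold-E n (suc n) (degree G v) f (f-small n<N) (h v) ⟩
      E * degree G v + n ≤⟨ +-monoˡ-≤ n (*-monoʳ-≤ E (m+n≤o⇒n≤o (∑ (allFin n) (Complement.h G v)) (nonEdges+degree G v))) ⟩
      E * n + n ∎) (<-irrefl refl)
    by (no n≮N) = decompose (≮⇒≥ n≮N) G λ v → subst (_≤ E * degree G v + n)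
      (trans (cong (E * n +_) (*-zeroʳ E)) (+-identityʳ (E * n)))
      (threshold-E n 0 (degree G v) f (f-large (≮⇒≥ n≮N)) (h v))

dense⇒theorem : ∀ (k K : ℕ) → 0 < K →
  (∀ n c D (f : ℕ → ℚ) → f n ≡ ℕ→ℚ c → threshold k f n ≤ℚ ℕ→ℚ D → 9 * K * n + 9 * K * c ≤ 9 * K * D + n) →
  (Σ ℕ λ N → ∀ {n} → N ≤ n → (G : Graph n) → (∀ v → 9 * K * n ≤ 9 * K * degree G v + n) → Decomposition k G) →
  Σ (ℕ → ℚ) λ f → IsLittleO-n f × (∀ (n : ℕ) (G : Graph n) → (∀ (v : Fin n) → threshold k f n ≤ℚ ℕ→ℚ (degree G v)) → Decomposition k G)
dense⇒theorem k K 0<K thr (N , decompose) = f , f-littleo , decomposes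
  where open LargeOrder k N (9 * K) (*-mono-≤ {1} {9} (s≤s z≤n) 0<K) thr decompose

dense-theorem : ∀ m K → 0 < K → 18 * (suc (suc m) ^ 6 * (suc (2 * suc (suc m)) * #new (suc m))) ≤ K → 64 * suc (suc m) ^ 5 ≤ K →
  Σ ℕ λ N → ∀ {n} → N ≤ n → (G : Graph n) → (∀ v → 9 * K * n ≤ 9 * K * degree G v + n) → Decomposition (suc (suc (suc m))) G
dense-theorem m K 0<K usage 64j⁵≤K = N , λ N≤n G → dense-decomposition N≤n G
  where open Dense m K 0<K usage 64j⁵≤K

theorem2p1 : ∀ (k : ℕ) → 3 ≤ k →
    Σ (ℕ → ℚ) λ f → IsLittleO-n f ×
    (∀ (n : ℕ) (G : Graph n) →
    (∀ (v : Fin n) → threshold k f n ≤ℚ ℕ→ℚ (degree G v)) →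
    Decomposition k G)
theorem2p1 (suc (suc (suc m))) (s≤s (s≤s (s≤s z≤n))) =
  dense⇒theorem (suc (suc (suc m))) (suc (suc (suc m)) ^ 10) (m^n>0 (suc (suc (suc m))) 10) (threshold-ℕ (suc (suc m)))
    (dense-theorem m (suc (suc (suc m)) ^ 10) (m^n>0 (suc (suc (suc m))) 10) (usage-bound (suc m)) (64j⁵≤[1+j]¹⁰ (suc (suc m)) (s≤s (s≤s z≤n))))
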